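{- There exist absolute constants $C_0>0$ and $\varepsilon_0>0$ such that the following holds for every positive integer $n$. Let $U$ be the linear span of the indicator functions of stars in $\mathcal{M}_n$, and let $A$ be any set of perfect matchings of $\mathcal{K}_{2n}$ of size $c(2n-3)!!$, where $c\leq\frac{2n-1}{2}$. If $0\le \varepsilon\leq\varepsilon_0$ and $$\|\mathbf{1}_A-\operatorname{Proj}_U(\mathbf{1}_A)\|^2\leq \varepsilon\,\frac{c}{2n-1},$$ then there is a set $B$ that is a union of $\mathrm{round}(c)$ stars in $\mathcal{M}_n$ such that $$|A\,\Delta\, B|\leq C_0c^2(2n-3)!!\left(\sqrt{\varepsilon}+\frac{1}{2n-1}\right).$$ Moreover $|c-\mathrm{round}(c)|\leq C_0c^2\left(\sqrt{\varepsilon}+\frac{1}{2n-1}\right)$.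
   Context: $\mathcal{M}_n$ denotes the perfect matching graph, whose vertex set $V$ is the set of all $(2n-1)!!$ perfect matchings of the complete graph $\mathcal{K}_{2n}$ (matchings adjacent iff they have no common edge). For an edge $\mathsf{e}$ of $\mathcal{K}_{2n}$, the star $\mathcal{S}_{\mathsf{e}}$ is the set of all perfect matchings containing $\mathsf{e}$. $\mathbf{1}_A\in\mathbb{R}[V]$ (the real-valued functions on $V$) is the $0/1$ indicator function of $A$. The norm on $\mathbb{R}[V]$ is $\|f\|=\left(\frac{1}{|V|}\sum_{v\in V}f(v)^2\right)^{1/2}$, and $\operatorname{Proj}_U$ is the orthogonal projection onto $U$. $\mathrm{round}(c)$ is the integer closest to $c$ (rounding up in case of a tie). $\Delta$ is symmetric difference. $(2m-1)!!=(2m-1)(2m-3)\cdots1$, with $(-1)!!=1$. -}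

module Defs where

open import Algebra.Bundles.Raw using (RawMonoid)
import Algebra.Definitions.RawMonoid as RawMonoidDefs
open import Data.Bool.Base using (true; false; if_then_else_)
open import Data.Fin.Base as Fin using (Fin)
open import Data.Fin.Properties using (all?)
open import Data.Fin.Subset as Subset using (Subset; inside; outside; _∈_; _∉_; _∪_; _─_; ⋃)
open import Data.Fin.Subset.Properties using (_∈?_)
open import Data.Integer.Base as ℤ using (+_)
open import Data.List.Base as List using (List; []; _∷_; filter; cartesianProductWith)
open import Data.List.Membership.Propositional using () renaming (_∈_ to _∈ˡ_)
open import Data.List.Membership.Propositional.Properties
  using (∈-cartesianProductWith⁺; ∈-filter⁺; ∈-filter⁻)
open import Data.List.Relation.Unary.All using (All; []; _∷_)
open import Data.List.Relation.Unary.AllPairs using ([]; _∷_)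
open import Data.List.Relation.Unary.Any using (here; there)
open import Data.List.Relation.Unary.Unique.Propositional using (Unique)
import Data.List.Relation.Unary.Unique.Propositional.Properties as Unique
open import Data.Nat.Base as ℕ using (ℕ; zero; suc)
import Data.Nat.Properties as ℕ
open import Data.Product.Base using (Σ; ∃; _×_; _,_; proj₁; proj₂)
open import Data.Rational.Base as ℚ using (ℚ; 0ℚ; 1ℚ; ½)
import Data.Rational.Properties as ℚ
open import Data.Rational.Solver using (module +-*-Solver)
open import Data.Vec.Base as Vec using (Vec; []; _∷_; lookup; tabulate)
open import Data.Vec.Properties using (∷-injective)
open import Level using (0ℓ)
open import Relation.Binary.PropositionalEquality
  using (_≡_; refl; sym; trans; cong; cong₂; subst)
open import Relation.Nullary.Decidable using (Dec; does; _×-dec_; _→-dec_; ¬?)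

------------------------------------------------------------------------
-- Real numbers: Cauchy sequences of rationals with a modulus of
-- convergence, compared by the setoid equality _≃_.

IsCauchy : (ℕ → ℚ) → Set
IsCauchy x = ∀ δ → 0ℚ ℚ.< δ →
  ∃ λ N → ∀ m n → N ℕ.≤ m → N ℕ.≤ n → ℚ.∣ x m ℚ.- x n ∣ ℚ.≤ δ

record ℝ : Set where
  constructor mkℝ
  field
    seq    : ℕ → ℚ
    cauchy : IsCauchy seq
open ℝ public

infix 4 _≃_ _≤_ _<_

_≃_ _≤_ _<_ : ℝ → ℝ → Set
x ≃ y = ∀ δ → 0ℚ ℚ.< δ →
  ∃ λ N → ∀ n → N ℕ.≤ n → ℚ.∣ seq x n ℚ.- seq y n ∣ ℚ.≤ δ
x ≤ y = ∀ δ → 0ℚ ℚ.< δ →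
  ∃ λ N → ∀ n → N ℕ.≤ n → seq x n ℚ.≤ seq y n ℚ.+ δ
x < y = ∃ λ δ → 0ℚ ℚ.< δ ×
  ∃ λ N → ∀ n → N ℕ.≤ n → seq x n ℚ.+ δ ℚ.≤ seq y n

open +-*-Solver using (solve; _:=_; _:+_; _:*_; _:-_)

private abstract
  0<½* : ∀ {δ} → 0ℚ ℚ.< δ → 0ℚ ℚ.< ½ ℚ.* δ
  0<½* {δ} 0<δ = subst (ℚ._< ½ ℚ.* δ) (ℚ.*-zeroʳ ½) (ℚ.*-monoʳ-<-pos ½ 0<δ)

  ½*+½* : ∀ δ → ½ ℚ.* δ ℚ.+ ½ ℚ.* δ ≡ δ
  ½*+½* δ = trans (sym (ℚ.*-distribʳ-+ δ ½ ½)) (ℚ.*-identityˡ δ)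

  const-cauchy : ∀ q → IsCauchy (λ _ → q)
  const-cauchy q δ 0<δ = 0 , λ _ _ _ _ →
    subst (λ t → ℚ.∣ t ∣ ℚ.≤ δ) (sym (ℚ.+-inverseʳ q)) (ℚ.<⇒≤ 0<δ)

  +-cauchy : ∀ {x y} → IsCauchy x → IsCauchy y → IsCauchy (λ n → x n ℚ.+ y n)
  +-cauchy {x} {y} cx cy δ 0<δ
    with M , hx ← cx (½ ℚ.* δ) (0<½* 0<δ) | N , hy ← cy (½ ℚ.* δ) (0<½* 0<δ)
    = M ℕ.⊔ N , λ m n p q → begin
      ℚ.∣ (x m ℚ.+ y m) ℚ.- (x n ℚ.+ y n) ∣
        ≡⟨ cong ℚ.∣_∣ (solve 4 (λ a b c d →
             (a :+ b) :- (c :+ d) := (a :- c) :+ (b :- d)) refl (x m) (y m) (x n) (y n)) ⟩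
      ℚ.∣ (x m ℚ.- x n) ℚ.+ (y m ℚ.- y n) ∣
        ≤⟨ ℚ.∣p+q∣≤∣p∣+∣q∣ (x m ℚ.- x n) (y m ℚ.- y n) ⟩
      ℚ.∣ x m ℚ.- x n ∣ ℚ.+ ℚ.∣ y m ℚ.- y n ∣
        ≤⟨ ℚ.+-mono-≤ (hx m n (ℕ.m⊔n≤o⇒m≤o M N p) (ℕ.m⊔n≤o⇒m≤o M N q))
                      (hy m n (ℕ.m⊔n≤o⇒n≤o M N p) (ℕ.m⊔n≤o⇒n≤o M N q)) ⟩
      ½ ℚ.* δ ℚ.+ ½ ℚ.* δ
        ≡⟨ ½*+½* δ ⟩
      δ ∎
    where open ℚ.≤-Reasoning

  -‿cauchy : ∀ {x} → IsCauchy x → IsCauchy (λ n → ℚ.- x n)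
  -‿cauchy {x} cx δ 0<δ with M , hx ← cx δ 0<δ = M , λ m n p q →
    subst (ℚ._≤ δ)
      (trans (sym (ℚ.∣-p∣≡∣p∣ (x m ℚ.- x n)))
             (cong ℚ.∣_∣ (ℚ.neg-distrib-+ (x m) (ℚ.- x n))))
      (hx m n p q)

  eventuallyBounded : ∀ {x} → IsCauchy x →
    ∃ λ B → 0ℚ ℚ.< B × ∃ λ N → ∀ n → N ℕ.≤ n → ℚ.∣ x n ∣ ℚ.≤ B
  eventuallyBounded {x} cx with N , h ← cx 1ℚ (ℚ.positive⁻¹ 1ℚ)
    = 1ℚ ℚ.+ ℚ.∣ x N ∣
    , ℚ.<-≤-trans (ℚ.positive⁻¹ 1ℚ)
        (subst (ℚ._≤ 1ℚ ℚ.+ ℚ.∣ x N ∣) (ℚ.+-identityʳ 1ℚ) (ℚ.+-monoʳ-≤ 1ℚ (ℚ.0≤∣p∣ (x N))))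
    , N , λ n p → begin
      ℚ.∣ x n ∣
        ≡⟨ cong ℚ.∣_∣ (solve 2 (λ a b → a := (a :- b) :+ b) refl (x n) (x N)) ⟩
      ℚ.∣ (x n ℚ.- x N) ℚ.+ x N ∣
        ≤⟨ ℚ.∣p+q∣≤∣p∣+∣q∣ (x n ℚ.- x N) (x N) ⟩
      ℚ.∣ x n ℚ.- x N ∣ ℚ.+ ℚ.∣ x N ∣
        ≤⟨ ℚ.+-monoˡ-≤ ℚ.∣ x N ∣ (h n N p ℕ.≤-refl) ⟩
      1ℚ ℚ.+ ℚ.∣ x N ∣ ∎
    where open ℚ.≤-Reasoning

  *-mono-≤₀ : ∀ {p q r s} → 0ℚ ℚ.≤ q → 0ℚ ℚ.≤ r → p ℚ.≤ q → r ℚ.≤ s → p ℚ.* r ℚ.≤ q ℚ.* s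
  *-mono-≤₀ {p} {q} {r} {s} 0≤q 0≤r p≤q r≤s = ℚ.≤-trans
    (ℚ.*-monoʳ-≤-nonNeg r {{ℚ.nonNegative 0≤r}} p≤q)
    (ℚ.*-monoˡ-≤-nonNeg q {{ℚ.nonNegative 0≤q}} r≤s)

  ∣ab-cd∣≤ : ∀ {a b c d B C η} → 0ℚ ℚ.≤ B → 0ℚ ℚ.≤ η →
    ℚ.∣ a ∣ ℚ.≤ B → ℚ.∣ d ∣ ℚ.≤ C → ℚ.∣ a ℚ.- c ∣ ℚ.≤ η → ℚ.∣ b ℚ.- d ∣ ℚ.≤ η →
    ℚ.∣ a ℚ.* b ℚ.- c ℚ.* d ∣ ℚ.≤ (B ℚ.+ C) ℚ.* η
  ∣ab-cd∣≤ {a} {b} {c} {d} {B} {C} {η} 0≤B 0≤η a≤B d≤C ac≤η bd≤η = begin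
    ℚ.∣ a ℚ.* b ℚ.- c ℚ.* d ∣
      ≡⟨ cong ℚ.∣_∣ (solve 4 (λ a b c d →
           a :* b :- c :* d := a :* (b :- d) :+ (a :- c) :* d) refl a b c d) ⟩
    ℚ.∣ a ℚ.* (b ℚ.- d) ℚ.+ (a ℚ.- c) ℚ.* d ∣
      ≤⟨ ℚ.∣p+q∣≤∣p∣+∣q∣ (a ℚ.* (b ℚ.- d)) ((a ℚ.- c) ℚ.* d) ⟩
    ℚ.∣ a ℚ.* (b ℚ.- d) ∣ ℚ.+ ℚ.∣ (a ℚ.- c) ℚ.* d ∣
      ≡⟨ cong₂ ℚ._+_ (ℚ.∣p*q∣≡∣p∣*∣q∣ a (b ℚ.- d)) (ℚ.∣p*q∣≡∣p∣*∣q∣ (a ℚ.- c) d) ⟩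
    ℚ.∣ a ∣ ℚ.* ℚ.∣ b ℚ.- d ∣ ℚ.+ ℚ.∣ a ℚ.- c ∣ ℚ.* ℚ.∣ d ∣
      ≤⟨ ℚ.+-mono-≤ (*-mono-≤₀ 0≤B (ℚ.0≤∣p∣ (b ℚ.- d)) a≤B bd≤η)
                    (*-mono-≤₀ 0≤η (ℚ.0≤∣p∣ d) ac≤η d≤C) ⟩
    B ℚ.* η ℚ.+ η ℚ.* C
      ≡⟨ cong (B ℚ.* η ℚ.+_) (ℚ.*-comm η C) ⟩
    B ℚ.* η ℚ.+ C ℚ.* η
      ≡⟨ ℚ.*-distribʳ-+ η B C ⟨
    (B ℚ.+ C) ℚ.* η ∎
    where open ℚ.≤-Reasoning

  split : ∀ D {δ} → 0ℚ ℚ.< D → 0ℚ ℚ.< δ → ∃ λ η → 0ℚ ℚ.< η × D ℚ.* η ≡ δ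
  split D {δ} 0<D 0<δ = η
    , subst (ℚ._< η) (ℚ.*-zeroʳ (ℚ.1/ D))
        (ℚ.*-monoʳ-<-pos (ℚ.1/ D) {{ℚ.1/pos⇒pos D}} 0<δ)
    , trans (sym (ℚ.*-assoc D (ℚ.1/ D) δ))
        (trans (cong (ℚ._* δ) (ℚ.*-inverseʳ D)) (ℚ.*-identityˡ δ))
    where
    instance
      D⁺ : ℚ.Positive D
      D⁺ = ℚ.positive 0<D
      D≢0 : ℚ.NonZero D
      D≢0 = ℚ.pos⇒nonZero D
    η : ℚ
    η = ℚ.1/ D ℚ.* δ

  0<+ : ∀ {p q} → 0ℚ ℚ.< p → 0ℚ ℚ.< q → 0ℚ ℚ.< p ℚ.+ q
  0<+ {p} {q} 0<p 0<q = subst (ℚ._< p ℚ.+ q) (ℚ.+-identityˡ 0ℚ) (ℚ.+-mono-< 0<p 0<q)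

  *-cauchy : ∀ {x y} → IsCauchy x → IsCauchy y → IsCauchy (λ n → x n ℚ.* y n)
  *-cauchy {x} {y} cx cy δ 0<δ =
    let B , 0<B , K , bx = eventuallyBounded {x} cx
        C , 0<C , L , by = eventuallyBounded {y} cy
        η , 0<η , Dη≡δ   = split (B ℚ.+ C) (0<+ 0<B 0<C) 0<δ
        M , hx           = cx η 0<η
        N , hy           = cy η 0<η
    in (M ℕ.⊔ N) ℕ.⊔ (K ℕ.⊔ L) , λ m n p q →
      let p₁ = ℕ.m⊔n≤o⇒m≤o (M ℕ.⊔ N) (K ℕ.⊔ L) p
          q₁ = ℕ.m⊔n≤o⇒m≤o (M ℕ.⊔ N) (K ℕ.⊔ L) q
          p₂ = ℕ.m⊔n≤o⇒n≤o (M ℕ.⊔ N) (K ℕ.⊔ L) p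
          q₂ = ℕ.m⊔n≤o⇒n≤o (M ℕ.⊔ N) (K ℕ.⊔ L) q
      in subst (ℚ.∣ x m ℚ.* y m ℚ.- x n ℚ.* y n ∣ ℚ.≤_) Dη≡δ
        (∣ab-cd∣≤ {x m} {y m} {x n} {y n} {B} {C} {η} (ℚ.<⇒≤ 0<B) (ℚ.<⇒≤ 0<η)
          (bx m (ℕ.m⊔n≤o⇒m≤o K L p₂))
          (by n (ℕ.m⊔n≤o⇒n≤o K L q₂))
          (hx m n (ℕ.m⊔n≤o⇒m≤o M N p₁) (ℕ.m⊔n≤o⇒m≤o M N q₁))
          (hy m n (ℕ.m⊔n≤o⇒n≤o M N p₁) (ℕ.m⊔n≤o⇒n≤o M N q₁)))

infixl 7 _*_
infixl 6 _+_ _-_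
infix  8 -_

fromℚ : ℚ → ℝ
fromℚ q = mkℝ (λ _ → q) (const-cauchy q)

fromℕ : ℕ → ℝ
fromℕ n = fromℚ (+ n ℚ./ 1)

0ℝ 1ℝ : ℝ
0ℝ = fromℚ 0ℚ
1ℝ = fromℚ 1ℚ

_+_ _*_ : ℝ → ℝ → ℝ
x + y = mkℝ (λ n → seq x n ℚ.+ seq y n) (+-cauchy {seq x} {seq y} (cauchy x) (cauchy y))
x * y = mkℝ (λ n → seq x n ℚ.* seq y n) (*-cauchy {seq x} {seq y} (cauchy x) (cauchy y))

-_ : ℝ → ℝ
- x = mkℝ (λ n → ℚ.- seq x n) (-‿cauchy {seq x} (cauchy x))

_-_ : ℝ → ℝ → ℝ
x - y = x + (- y)

IsSqrt : ℝ → ℝ → Set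
IsSqrt x s = 0ℝ ≤ s × s * s ≃ x

ℝ-+-rawMonoid : RawMonoid 0ℓ 0ℓ
ℝ-+-rawMonoid = record { _≈_ = _≃_ ; _∙_ = _+_ ; ε = 0ℝ }

open RawMonoidDefs ℝ-+-rawMonoid public using (sum)

------------------------------------------------------------------------
-- The space ℝ[V] of real functions on a k-element set V

ℝ[_] : ℕ → Set
ℝ[ k ] = Fin k → ℝ

𝟙 : ∀ {k} → Subset k → ℝ[ k ]
𝟙 A v = if lookup A v then 1ℝ else 0ℝ

_⊖_ : ∀ {k} → ℝ[ k ] → ℝ[ k ] → ℝ[ k ]
(f ⊖ g) v = f v - g v

-- The value on the empty domain is irrelevant.
mean : ∀ {k} → ℝ[ k ] → ℝ
mean {zero}  f = 0ℝ
mean {suc k} f = fromℚ (+ 1 ℚ./ suc k) * sum f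

⟨_,_⟩ : ∀ {k} → ℝ[ k ] → ℝ[ k ] → ℝ
⟨ f , g ⟩ = mean λ v → f v * g v

∥_∥² : ∀ {k} → ℝ[ k ] → ℝ
∥ f ∥² = ⟨ f , f ⟩

Span : ∀ {k} {I : Set} → (I → ℝ[ k ]) → ℝ[ k ] → Set
Span {I = I} g f =
  ∃ λ r → Σ (Fin r → ℝ) λ a → Σ (Fin r → I) λ i →
    ∀ v → f v ≃ sum (λ j → a j * g (i j) v)

-- p = Proj_U f
IsProjection : ∀ {k} → (ℝ[ k ] → Set) → ℝ[ k ] → ℝ[ k ] → Set
IsProjection U f p = U p × (∀ u → U u → ⟨ f ⊖ p , u ⟩ ≃ 0ℝ)

------------------------------------------------------------------------
-- Perfect matchings of the complete graph on N vertices

-- An unordered pair of distinct vertices, stored in increasing order.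
record Edge (N : ℕ) : Set where
  constructor edge
  field
    lo hi  : Fin N
    .lo<hi : lo Fin.< hi
open Edge public

-- A set of edges is stored as its adjacency matrix: j ∈ lookup M i says
-- that {i , j} belongs to M.
EdgeSet : ℕ → Set
EdgeSet N = Vec (Subset N) N

_∈ᴱ_ : ∀ {N} → Edge N → EdgeSet N → Set
e ∈ᴱ M = hi e ∈ lookup M (lo e)

_∈ᴱ?_ : ∀ {N} (e : Edge N) (M : EdgeSet N) → Dec (e ∈ᴱ M)
e ∈ᴱ? M = hi e ∈? lookup M (lo e)

-- The first two conditions say that M is the adjacency matrix of a set of
-- edges, the third that every vertex lies on exactly one of them.
IsPerfectMatching : ∀ {N} → EdgeSet N → Set
IsPerfectMatching M =
  (∀ i j → j ∈ lookup M i → i ∈ lookup M j) ×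
  (∀ i → i ∉ lookup M i) ×
  (∀ i → Subset.∣ lookup M i ∣ ≡ 1)

isPerfectMatching? : ∀ {N} (M : EdgeSet N) → Dec (IsPerfectMatching M)
isPerfectMatching? M =
  all? (λ i → all? λ j → (j ∈? lookup M i) →-dec (i ∈? lookup M j)) ×-dec
  all? (λ i → ¬? (i ∈? lookup M i)) ×-dec
  all? (λ i → Subset.∣ lookup M i ∣ ℕ.≟ 1)

allVecs : ∀ {A : Set} → List A → ∀ n → List (Vec A n)
allVecs xs zero    = [] ∷ []
allVecs xs (suc n) = cartesianProductWith _∷_ xs (allVecs xs n)

perfectMatchings : ∀ N → List (EdgeSet N)
perfectMatchings N =
  filter isPerfectMatching? (allVecs (allVecs (outside ∷ inside ∷ []) N) N)

private
  allVecs-complete : ∀ {A : Set} {xs : List A} → (∀ x → x ∈ˡ xs) →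
    ∀ {n} (v : Vec A n) → v ∈ˡ allVecs xs n
  allVecs-complete h []      = here refl
  allVecs-complete h (x ∷ v) = ∈-cartesianProductWith⁺ _∷_ (h x) (allVecs-complete h v)

  allVecs-unique : ∀ {A : Set} {xs : List A} → Unique xs → ∀ n → Unique (allVecs xs n)
  allVecs-unique u zero    = [] ∷ []
  allVecs-unique u (suc n) =
    Unique.cartesianProductWith⁺ _∷_ ∷-injective u (allVecs-unique u n)

perfectMatchings-complete : ∀ {N} {M : EdgeSet N} →
  IsPerfectMatching M → M ∈ˡ perfectMatchings N
perfectMatchings-complete {M = M} =
  ∈-filter⁺ isPerfectMatching? (allVecs-complete (allVecs-complete λ where
    false → here refl
    true  → there (here refl)) M)

perfectMatchings-sound : ∀ {N} {M : EdgeSet N} →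
  M ∈ˡ perfectMatchings N → IsPerfectMatching M
perfectMatchings-sound {N} M∈ =
  proj₂ (∈-filter⁻ isPerfectMatching? {xs = allVecs (allVecs (outside ∷ inside ∷ []) N) N} M∈)

perfectMatchings-unique : ∀ N → Unique (perfectMatchings N)
perfectMatchings-unique N = Unique.filter⁺ isPerfectMatching?
  (allVecs-unique (allVecs-unique (((λ ()) ∷ []) ∷ [] ∷ []) N) N)

------------------------------------------------------------------------
-- Stars in the perfect matching graph of K₂ₙ

-- The vertex set of the perfect matching graph is Fin ∣V∣[ n ], vertex v
-- being the matching ⟦ v ⟧.
∣V∣[_] : ℕ → ℕ
∣V∣[ n ] = List.length (perfectMatchings (2 ℕ.* n))

⟦_⟧ : ∀ {n} → Fin ∣V∣[ n ] → EdgeSet (2 ℕ.* n)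
⟦_⟧ {n} v = List.lookup (perfectMatchings (2 ℕ.* n)) v

star : ∀ n → Edge (2 ℕ.* n) → Subset ∣V∣[ n ]
star n e = tabulate λ v → does (e ∈ᴱ? ⟦_⟧ {n} v)

IsStar : ∀ n → Subset ∣V∣[ n ] → Set
IsStar n S = ∃ λ e → S ≡ star n e

-- The stars of the union are required to be distinct.
IsUnionOfStars : ∀ n → ℤ.ℤ → Subset ∣V∣[ n ] → Set
IsUnionOfStars n r B = Σ (List (Subset ∣V∣[ n ])) λ 𝒮 →
  Unique 𝒮 × All (IsStar n) 𝒮 × + List.length 𝒮 ≡ r × B ≡ ⋃ 𝒮

starSpan : ∀ n → ℝ[ ∣V∣[ n ] ] → Set
starSpan n = Span λ e → 𝟙 (star n e)

_△_ : ∀ {k} → Subset k → Subset k → Subset k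
A △ B = (A ─ B) ∪ (B ─ A)

-- 2n - 1 for positive n, in a form that is visibly nonzero.
2n-1[_] : ℕ → ℕ
2n-1[ n ] = suc (2 ℕ.* ℕ.pred n)

-- oddFactorial m = (2m - 1)!!
oddFactorial : ℕ → ℕ
oddFactorial zero    = 1
oddFactorial (suc m) = 2n-1[ suc m ] ℕ.* oddFactorial m

[2n-3]!![_] : ℕ → ℕ
[2n-3]!![ n ] = oddFactorial (ℕ.pred n)

{-# OPTIONS --safe #-}
module Submission where

-- Write f for the indicator of A, d e for the density of A in the star of e and
-- a e = d e - c/(2n-1). The projection is p = c/(2n-1) + β Σ_{e ∈ M} a e with
-- β = (2n-3)/(2n-2), so the hypothesis gives Σ a² ≥ (1 - ε - c/(2n-1)) c. Since
-- p(p-1) - f(f-1) = (p-f)(p+f-1), the error f - p is orthogonal to p, and p ≥ -c,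
-- the third moment of p is almost as large as its second moment. Expanding it with
-- the numbers of matchings through one, two and three given edges gives
-- Σ a² (1 - a) = O(c (1 + c) (ε + 1/(2n-1))): the a e are mostly close to 0 or to 1.
-- The stars of the edges with a e > 1/2 lie almost inside A, are about c in number,
-- and overlap little, so their union is almost A; adding or removing a few stars
-- makes their number round(c). As ε ≤ 1, the bound in ε implies the one in √ε.

open import Data.Nat.Base as ℕ using (ℕ; NonZero)

-- Subtracting `θ` centres the densities so that the matrix `a` is symmetric with zero diagonal and
-- zero rows. The obstacle is the range of c, from 1/(2n-3)!! up to order n, while the error sought
-- is quadratic in c. If c (η + 1/(2n-1)) is bounded below, any round(c) stars will do. Otherwise
-- the moment bound forces an entry above ½, hence c ≥ ½, and errors linear in c are absorbed into
-- c². Small n is paid for by the constant. Since ε is a real number and case distinctions need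
-- rationals, everything is proved for the exact relative error η of `p`. It is compared with ε only
-- at the end, through rational combinations of stars that approximate the given projection.

module PerfectMatchings where
  open import Data.Bool.Base using (Bool; true; false; if_then_else_; _∨_)
  import Data.Bool.Base as Bool
  import Data.Bool.Properties as Bool
  open import Data.Empty using (⊥; ⊥-elim)
  open import Data.Fin.Base as Fin using (Fin; zero; suc)
  import Data.Fin.Properties as Fin
  open import Data.Fin.Subset as Subset using (Subset; inside; outside; ⁅_⁆; _∪_; _─_; ⋃; ∣_∣)
  import Data.Fin.Subset.Properties as Subset
  open import Data.Integer.Base as ℤ using ()
  import Data.Integer.Properties as ℤ
  open import Data.List.Base as List using (List; []; _∷_; length; map; filter; cartesianProduct; allFin; _++_)
  open import Data.List.Properties using (length-map; length-tabulate)
  open import Data.List.Membership.Propositional using (_∈_; _∉_; find)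
  import Data.List.Membership.DecPropositional as DecMembership
  open import Data.List.Membership.Propositional.Properties using (∈-lookup; ∈-filter⁻)
  import Data.List.Membership.Setoid.Properties as Membershipₛ
  open import Data.List.Relation.Unary.All as All using (All; []; _∷_)
  import Data.List.Relation.Unary.All.Properties as All
  open import Data.List.Relation.Unary.AllPairs using ([]; _∷_)
  open import Data.List.Relation.Unary.Any as Any using (here; there)
  open import Data.List.Relation.Unary.Any.Properties using (lookup-index)
  open import Data.List.Relation.Unary.Unique.Propositional using (Unique)
  import Data.List.Relation.Unary.Unique.Propositional.Properties as Unique
  open import Data.Nat.Base using (zero; suc)
  import Data.Nat.DivMod as ℕ
  import Data.Nat.Properties as ℕ
  import Data.Nat.Solver as ℕ
  open import Data.Product.Base using (∃; _×_; _,_; proj₁; proj₂)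
  open import Data.Product.Properties using (≡-dec)
  open import Data.Rational.Base as ℚ
    using (ℚ; mkℚ; 0ℚ; 1ℚ; ½; _+_; _*_; _-_; -_; _≤_; _<_; *≤*; _/_; fromℚᵘ)
  import Data.Rational.Properties as ℚ
  open import Data.Rational.Solver using (module +-*-Solver)
  open +-*-Solver using (Polynomial; solve; con; _:=_; _:+_; _:*_; _:-_; :-_)
  open import Data.Rational.Unnormalised.Base as ℚᵘ using (ℚᵘ; mkℚᵘ)
  import Data.Rational.Unnormalised.Properties as ℚᵘ
  open import Data.Sum.Base using (_⊎_; inj₁; inj₂)
  open import Data.Vec.Base using ([]; _∷_; lookup; tabulate)
  import Data.Vec.Properties as Vec
  open import Defs as ℝ
    using ( ℝ; ℝ[_]; seq; sum; mean; 𝟙; _⊖_; ∥_∥²; IsSqrt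
          ; Edge; edge; lo; hi; EdgeSet; _∈ᴱ?_; IsPerfectMatching; perfectMatchings
          ; perfectMatchings-complete; perfectMatchings-sound; perfectMatchings-unique
          ; ∣V∣[_]; ⟦_⟧; star; IsStar; IsUnionOfStars; starSpan; _△_; 2n-1[_]; oddFactorial)
  open import Function.Base using (_∘_)
  open import Function.Bundles using (mk⇔)
  open import Relation.Binary.Definitions using (Tri; tri<; tri≈; tri>)
  open import Relation.Binary.PropositionalEquality
  open import Relation.Nullary using (¬_; Dec; yes; no; does)
  open import Relation.Nullary.Decidable using (_×-dec_; does-⇔; recompute)

  -- The opaque # keeps unification from unfolding casts of variables; num is for
  -- numerals, which the ring solver has to compute with.
  num : ℕ → ℚ
  num n = ℤ.+ n / 1

  opaque
    # : ℕ → ℚ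
    # = num

    #≡num : ∀ n → # n ≡ num n
    #≡num n = refl

  private
    fromℚᵘ-+ : ∀ p q → fromℚᵘ p + fromℚᵘ q ≡ fromℚᵘ (p ℚᵘ.+ q)
    fromℚᵘ-+ p q = trans (sym (ℚ.fromℚᵘ-toℚᵘ _)) (ℚ.fromℚᵘ-cong
      (ℚᵘ.≃-trans (ℚ.toℚᵘ-homo-+ (fromℚᵘ p) (fromℚᵘ q))
        (ℚᵘ.+-cong (ℚ.toℚᵘ-fromℚᵘ p) (ℚ.toℚᵘ-fromℚᵘ q))))

    fromℚᵘ-* : ∀ p q → fromℚᵘ p * fromℚᵘ q ≡ fromℚᵘ (p ℚᵘ.* q)
    fromℚᵘ-* p q = trans (sym (ℚ.fromℚᵘ-toℚᵘ _)) (ℚ.fromℚᵘ-cong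
      (ℚᵘ.≃-trans (ℚ.toℚᵘ-homo-* (fromℚᵘ p) (fromℚᵘ q))
        (ℚᵘ.*-cong (ℚ.toℚᵘ-fromℚᵘ p) (ℚ.toℚᵘ-fromℚᵘ q))))

    ⌈_⌉ : ℕ → ℚᵘ
    ⌈ n ⌉ = mkℚᵘ (ℤ.+ n) 0

  opaque
    unfolding #

    #-+ : ∀ m n → # (m ℕ.+ n) ≡ # m + # n
    #-+ m n = sym (trans (fromℚᵘ-+ ⌈ m ⌉ ⌈ n ⌉) (ℚ.fromℚᵘ-cong {⌈ m ⌉ ℚᵘ.+ ⌈ n ⌉} {⌈ m ℕ.+ n ⌉}
      (ℚᵘ.*≡* (cong (ℤ._* ℤ.+ 1) (cong₂ ℤ._+_ (ℤ.*-identityʳ (ℤ.+ m)) (ℤ.*-identityʳ (ℤ.+ n)))))))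

    #-* : ∀ m n → # (m ℕ.* n) ≡ # m * # n
    #-* m n = sym (trans (fromℚᵘ-* ⌈ m ⌉ ⌈ n ⌉) (ℚ.fromℚᵘ-cong {⌈ m ⌉ ℚᵘ.* ⌈ n ⌉} {⌈ m ℕ.* n ⌉}
      (ℚᵘ.*≡* (cong (ℤ._* ℤ.+ 1) (sym (ℤ.pos-* m n))))))

    #-suc : ∀ n → # (suc n) ≡ 1ℚ + # n
    #-suc n = trans (#-+ 1 n) (cong (_+ # n) (#≡num 1))

    a/n*n≡a : ∀ a n → (ℤ.+ a / suc n) * # (suc n) ≡ # a
    a/n*n≡a a n = trans (fromℚᵘ-* (mkℚᵘ (ℤ.+ a) n) ⌈ suc n ⌉)
      (ℚ.fromℚᵘ-cong {mkℚᵘ (ℤ.+ a) n ℚᵘ.* ⌈ suc n ⌉} {⌈ a ⌉}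
        (ℚᵘ.*≡* (trans (ℤ.*-assoc (ℤ.+ a) (ℤ.+ suc n) (ℤ.+ 1)) (cong (ℤ.+ a ℤ.*_) (sym (ℤ.pos-* (suc n) 1))))))

    1/n*n≡1 : ∀ n → (ℤ.+ 1 / suc n) * # (suc n) ≡ 1ℚ
    1/n*n≡1 = a/n*n≡a 1

    0≤# : ∀ n → 0ℚ ≤ # n
    0≤# n = ℚ.nonNegative⁻¹ (num n) {{ℚ.normalize-nonNeg n 1}}

    0<#suc : ∀ n → 0ℚ < # (suc n)
    0<#suc n = ℚ.positive⁻¹ (num (suc n)) {{ℚ.normalize-pos (suc n) 1}}

    0<1/suc : ∀ n → 0ℚ < ℤ.+ 1 / suc n
    0<1/suc n = ℚ.positive⁻¹ (ℤ.+ 1 / suc n) {{ℚ.normalize-pos 1 (suc n)}}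

  :0 :1 :½ : ∀ {n} → Polynomial n
  :0 = con 0ℚ
  :1 = con 1ℚ
  :½ = con ½

  :# : ∀ {n} → ℕ → Polynomial n
  :# k = con (num k)

  -- An inequality a ≤ b is proved by writing b - a as a sum (⊕) of products (⊗) of
  -- nonnegative terms, among them the gaps of known inequalities; the ring solver
  -- checks the identity.
  infixl 6 _⊕_
  infixl 7 _⊗_

  opaque
    gap : ∀ {a b} → a ≤ b → 0ℚ ≤ b - a
    gap {a} {b} h = subst (_≤ b - a) (ℚ.+-inverseʳ a) (ℚ.+-monoˡ-≤ (- a) h)

    _⊕_ : ∀ {a b} → 0ℚ ≤ a → 0ℚ ≤ b → 0ℚ ≤ a + b
    _⊕_ {a} {b} h k = subst (_≤ a + b) (ℚ.+-identityʳ 0ℚ) (ℚ.+-mono-≤ h k)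

    _⊗_ : ∀ {a b} → 0ℚ ≤ a → 0ℚ ≤ b → 0ℚ ≤ a * b
    _⊗_ {a} {b} h k = subst (_≤ a * b) (ℚ.*-zeroʳ a) (ℚ.*-monoˡ-≤-nonNeg a {{ℚ.nonNegative h}} k)

    certify : ∀ {a b s} → 0ℚ ≤ s → b - a ≡ s → a ≤ b
    certify {a} {b} h refl = subst₂ _≤_ {a + 0ℚ} {a} {a + (b - a)} {b} (ℚ.+-identityʳ a)
      (trans (cong (λ t → a + t) (ℚ.+-comm b (- a)))
        (trans (sym (ℚ.+-assoc a (- a) b))
          (trans (cong (λ t → t + b) (ℚ.+-inverseʳ a)) (ℚ.+-identityˡ b))))
      (ℚ.+-monoʳ-≤ a h)

    square≥0 : ∀ a → 0ℚ ≤ a * a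
    square≥0 a with ℚ.≤-total 0ℚ a
    ... | inj₁ h = h ⊗ h
    ... | inj₂ h = certify (gap h ⊗ gap h)
        (solve 1 (λ a → a :* a :- :0 := (:0 :- a) :* (:0 :- a)) refl a)

    monoˡ-≤ : ∀ {c a b} → 0ℚ ≤ c → a ≤ b → c * a ≤ c * b
    monoˡ-≤ {c} 0≤c = ℚ.*-monoˡ-≤-nonNeg c {{ℚ.nonNegative 0≤c}}

    cancelˡ-≤ : ∀ {r a b} → 0ℚ < r → r * a ≤ r * b → a ≤ b
    cancelˡ-≤ {r} h = ℚ.*-cancelˡ-≤-pos r {{ℚ.positive h}}

    cancelˡ-≡ : ∀ {r a b} → 0ℚ < r → r * a ≡ r * b → a ≡ b
    cancelˡ-≡ h e = ℚ.≤-antisym (cancelˡ-≤ h (ℚ.≤-reflexive e)) (cancelˡ-≤ h (ℚ.≤-reflexive (sym e)))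

    #-mono-≤ : ∀ {m n} → m ℕ.≤ n → # m ≤ # n
    #-mono-≤ {m} {n} h = subst (# m ≤_) (trans (sym (#-+ m (n ℕ.∸ m))) (cong # (ℕ.m+[n∸m]≡n h)))
      (certify (0≤# (n ℕ.∸ m)) (solve 2 (λ a b → (a :+ b) :- a := b) refl (# m) (# (n ℕ.∸ m))))

    #-cancel-≤ : ∀ {m n} → # m ≤ # n → m ℕ.≤ n
    #-cancel-≤ {m} {n} h with ℕ.≤-<-connex m n
    ... | inj₁ m≤n = m≤n
    ... | inj₂ n<m = ⊥-elim (ℚ.<-irrefl {# n} {# n} refl
      (ℚ.<-≤-trans {# n} {# (suc n)} n<1+n (ℚ.≤-trans (#-mono-≤ n<m) h)))
      where
      n<1+n : # n < # (suc n)
      n<1+n = subst₂ _<_ {0ℚ + # n} {# n} {1ℚ + # n} {# (suc n)} (ℚ.+-identityˡ (# n)) (sym (#-suc n))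
        (ℚ.+-monoˡ-< (# n) {0ℚ} {1ℚ} (ℚ.positive⁻¹ 1ℚ))

  -- Finite sums of rationals.

  opaque
    ∑ : ∀ {n} → (Fin n → ℚ) → ℚ
    ∑ {zero}  f = 0ℚ
    ∑ {suc n} f = f zero + ∑ (λ i → f (suc i))

    ∑-nil : (f : Fin 0 → ℚ) → ∑ f ≡ 0ℚ
    ∑-nil f = refl

    ∑-cons : ∀ {n} (f : Fin (suc n) → ℚ) → ∑ f ≡ f zero + ∑ (λ i → f (suc i))
    ∑-cons f = refl

  infixl 8 ∑
  syntax ∑ (λ i → x) = ∑[ i ] x

  private variable
    n k : ℕ

  opaque
    unfolding ∑

    ∑-cong : {f g : Fin n → ℚ} → (∀ i → f i ≡ g i) → ∑ f ≡ ∑ g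
    ∑-cong {zero}  h = refl
    ∑-cong {suc n} h = cong₂ _+_ (h zero) (∑-cong (λ i → h (suc i)))

    ∑-+ : (f g : Fin n → ℚ) → ∑[ i ] (f i + g i) ≡ ∑ f + ∑ g
    ∑-+ {zero}  f g = sym (ℚ.+-identityˡ 0ℚ)
    ∑-+ {suc n} f g = trans (cong (λ t → f zero + g zero + t) (∑-+ (λ i → f (suc i)) (λ i → g (suc i))))
      (solve 4 (λ a b c d → a :+ b :+ (c :+ d) := (a :+ c) :+ (b :+ d)) refl (f zero) (g zero)
        (∑[ i ] f (suc i)) (∑[ i ] g (suc i)))

    ∑-* : ∀ c (f : Fin n → ℚ) → ∑[ i ] (c * f i) ≡ c * ∑ f
    ∑-* {zero}  c f = sym (ℚ.*-zeroʳ c)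
    ∑-* {suc n} c f = trans (cong (λ t → c * f zero + t) (∑-* c (λ i → f (suc i))))
      (sym (ℚ.*-distribˡ-+ c (f zero) (∑[ i ] f (suc i))))

    ∑-*ʳ : ∀ c (f : Fin n → ℚ) → ∑[ i ] (f i * c) ≡ ∑ f * c
    ∑-*ʳ c f = trans (∑-cong λ i → ℚ.*-comm (f i) c) (trans (∑-* c f) (ℚ.*-comm c (∑ f)))

    ∑-neg : (f : Fin n → ℚ) → ∑[ i ] (- f i) ≡ - ∑ f
    ∑-neg f = trans (∑-cong λ i → lemma (f i)) (trans (∑-* (- 1ℚ) f) (sym (lemma (∑ f))))
      where
      lemma : ∀ a → - a ≡ - 1ℚ * a
      lemma = solve 1 (λ a → :- a := :- :1 :* a) refl

    ∑-- : (f g : Fin n → ℚ) → ∑[ i ] (f i - g i) ≡ ∑ f - ∑ g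
    ∑-- f g = trans (∑-+ f (λ i → - g i)) (cong (λ t → ∑ f + t) (∑-neg g))

    ∑-zero : {f : Fin n → ℚ} → (∀ i → f i ≡ 0ℚ) → ∑ f ≡ 0ℚ
    ∑-zero {zero}  h = refl
    ∑-zero {suc n} h = trans (cong₂ _+_ (h zero) (∑-zero (λ i → h (suc i)))) (ℚ.+-identityˡ 0ℚ)

    ∑-comm : (f : Fin n → Fin k → ℚ) → ∑[ i ] ∑[ j ] f i j ≡ ∑[ j ] ∑[ i ] f i j
    ∑-comm {zero} {k} f = sym (∑-zero {k} {λ _ → 0ℚ} λ _ → refl)
    ∑-comm {suc n} f = trans (cong (λ t → ∑ (f zero) + t) (∑-comm (λ i → f (suc i))))
      (sym (∑-+ (f zero) (λ j → ∑[ i ] f (suc i) j)))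

    ∑-lin₂ : ∀ a (f : Fin n → ℚ) b g → ∑[ i ] (a * f i + b * g i) ≡ a * ∑ f + b * ∑ g
    ∑-lin₂ a f b g = trans (∑-+ (λ i → a * f i) (λ i → b * g i)) (cong₂ _+_ (∑-* a f) (∑-* b g))

    ∑-lin₃ : ∀ a (f : Fin n → ℚ) b g c h → ∑[ i ] (a * f i + b * g i + c * h i) ≡ a * ∑ f + b * ∑ g + c * ∑ h
    ∑-lin₃ a f b g c h = trans (∑-+ (λ i → a * f i + b * g i) (λ i → c * h i))
      (cong₂ _+_ (∑-lin₂ a f b g) (∑-* c h))

    ∑-lin₄ : ∀ a (f : Fin n → ℚ) b g c h d k → ∑[ i ] (a * f i + b * g i + c * h i + d * k i) ≡ a * ∑ f + b *
      ∑ g + c * ∑ h + d * ∑ k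
    ∑-lin₄ a f b g c h d k = trans (∑-+ (λ i → a * f i + b * g i + c * h i) (λ i → d * k i))
      (cong₂ _+_ (∑-lin₃ a f b g c h) (∑-* d k))

    ∑-const : ∀ n c → ∑ {n} (λ _ → c) ≡ # n * c
    ∑-const zero    c = sym (trans (cong (_* c) (#≡num 0)) (ℚ.*-zeroˡ c))
    ∑-const (suc n) c = trans (cong (λ t → c + t) (∑-const n c)) (trans
        (solve 2 (λ c n → c :+ n :* c := (:1 :+ n) :* c) refl c (# n)) (cong (_* c) (sym (#-suc n))))

    ∑-mono : {f g : Fin n → ℚ} → (∀ i → f i ≤ g i) → ∑ f ≤ ∑ g
    ∑-mono {zero}  h = ℚ.≤-refl
    ∑-mono {suc n} h = ℚ.+-mono-≤ (h zero) (∑-mono (λ i → h (suc i)))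

    ∑-nonneg : {f : Fin n → ℚ} → (∀ i → 0ℚ ≤ f i) → 0ℚ ≤ ∑ f
    ∑-nonneg {zero}  h = ℚ.≤-refl
    ∑-nonneg {suc n} h = h zero ⊕ ∑-nonneg (λ i → h (suc i))

    term≤∑ : {f : Fin n → ℚ} → (∀ i → 0ℚ ≤ f i) → ∀ i → f i ≤ ∑ f
    term≤∑ {f = f} h zero = subst (_≤ ∑ f) (ℚ.+-identityʳ (f zero))
      (ℚ.+-monoʳ-≤ (f zero) (∑-nonneg (λ i → h (suc i))))
    term≤∑ {f = f} h (suc i) = ℚ.≤-trans (term≤∑ (λ i → h (suc i)) i)
      (subst (_≤ ∑ f) (ℚ.+-identityˡ _) (ℚ.+-monoˡ-≤ _ (h zero)))

  opaque
    num≥0 : ∀ k → 0ℚ ≤ num k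
    num≥0 k = subst (0ℚ ≤_) (#≡num k) (0≤# k)

  module _ {A : Set} where
    lookup-injective : ∀ {xs : List A} → Unique xs → ∀ {i j} → List.lookup xs i ≡ List.lookup xs j → i ≡ j
    lookup-injective (_ ∷ _) {zero} {zero} _ = refl
    lookup-injective {x ∷ xs} (x∉ ∷ _) {zero} {suc j} e = ⊥-elim (All.lookup x∉ (∈-lookup {xs = xs} j) e)
    lookup-injective {x ∷ xs} (x∉ ∷ _) {suc i} {zero} e = ⊥-elim (All.lookup x∉ (∈-lookup {xs = xs} i) (sym e))
    lookup-injective (_ ∷ u) {suc i} {suc j} e = cong suc (lookup-injective u e)

  module _ {N : ℕ} where
    open DecMembership (Fin._≟_ {N}) using (_∈?_)

    unique⇒length≤ : ∀ {xs : List (Fin N)} → Unique xs → length xs ℕ.≤ N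
    unique⇒length≤ u = Fin.injective⇒≤ (lookup-injective u)

    full : ∀ {xs : List (Fin N)} → Unique xs → length xs ≡ N → ∀ i → i ∈ xs
    full {xs} u e i with i ∈? xs
    ... | yes i∈ = i∈
    ... | no i∉ = ⊥-elim (ℕ.1+n≰n (subst (λ m → suc m ℕ.≤ N) e
            (unique⇒length≤ {i ∷ xs} (All.tabulate (λ {y} y∈ i≡y → i∉ (subst (_∈ xs) (sym i≡y) y∈)) ∷ u))))

    -- Otherwise sending each vertex to its position in `xs` would inject `N` vertices into fewer
    -- places.
    fresh : ∀ (xs : List (Fin N)) → length xs ℕ.< N → ∃ λ i → i ∉ xs
    fresh xs h = Fin.¬∀⟶∃¬ N (_∈ xs) (_∈? xs) λ all → ℕ.<⇒≱ h
      (Fin.injective⇒≤ {f = λ i → Any.index (all i)}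
        (λ {i} {j} → Membershipₛ.index-injective (setoid (Fin N)) (all i) (all j)))

  -- Lists of vertices

  opaque
    δ : ∀ {N} → Fin N → Fin N → ℚ
    δ i j = if does (i Fin.≟ j) then 1ℚ else 0ℚ

    δ-refl : ∀ {N} (i : Fin N) → δ i i ≡ 1ℚ
    δ-refl i with i Fin.≟ i
    ... | yes _ = refl
    ... | no i≢i = ⊥-elim (i≢i refl)

    δ-≢ : ∀ {N} {i j : Fin N} → i ≢ j → δ i j ≡ 0ℚ
    δ-≢ {_} {i} {j} i≢j with i Fin.≟ j
    ... | yes i≡j = ⊥-elim (i≢j i≡j)
    ... | no _ = refl

    ∑-δ : ∀ {N} (i : Fin N) (F : Fin N → ℚ) → ∑[ j ] (δ i j * F j) ≡ F i
    ∑-δ {suc N} zero F = trans (∑-cons (λ j → δ zero j * F j))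
      (trans (cong₂ _+_ (ℚ.*-identityˡ (F zero)) (∑-zero λ j → ℚ.*-zeroˡ (F (suc j)))) (ℚ.+-identityʳ (F zero)))
    ∑-δ {suc N} (suc i) F = trans (∑-cons (λ j → δ (suc i) j * F j))
      (trans (cong₂ _+_ (ℚ.*-zeroˡ (F zero))
      (trans (∑-cong λ j → cong (_* F (suc j)) (δ-suc j)) (∑-δ i (λ j → F (suc j)))))
      (ℚ.+-identityˡ (F (suc i))))
      where
      δ-suc : ∀ j → δ (suc i) (suc j) ≡ δ i j
      δ-suc j with i Fin.≟ j
      ... | yes _ = refl
      ... | no _ = refl

  ∑ˡ : ∀ {A : Set} → List A → (A → ℚ) → ℚ
  ∑ˡ [] F = 0ℚ
  ∑ˡ (x ∷ xs) F = F x + ∑ˡ xs F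

  module _ {N : ℕ} where
    open DecMembership (Fin._≟_ {N}) using (_∈?_)

    opaque
      outsideOf : List (Fin N) → Fin N → ℚ
      outsideOf S j = if does (j ∈? S) then 0ℚ else 1ℚ

      outsideOf-∉ : ∀ {S j} → j ∉ S → outsideOf S j ≡ 1ℚ
      outsideOf-∉ {S} {j} j∉ with j ∈? S
      ... | yes j∈ = ⊥-elim (j∉ j∈)
      ... | no _ = refl

      outsideOf-∈ : ∀ {S j} → j ∈ S → outsideOf S j ≡ 0ℚ
      outsideOf-∈ {S} {j} j∈ with j ∈? S
      ... | yes _ = refl
      ... | no j∉ = ⊥-elim (j∉ j∈)

    outsideOf-∷ : ∀ {s S} → s ∉ S → ∀ j → outsideOf S j ≡ δ s j + outsideOf (s ∷ S) j
    outsideOf-∷ {s} {S} s∉ j = by (s Fin.≟ j) (j ∈? S)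
      where
      by : Dec (s ≡ j) → Dec (j ∈ S) → outsideOf S j ≡ δ s j + outsideOf (s ∷ S) j
      by (yes refl) _ = trans (outsideOf-∉ s∉) (sym (cong₂ _+_ (δ-refl s) (outsideOf-∈ {s ∷ S} (here refl))))
      by (no s≢j) (yes j∈) = trans (outsideOf-∈ j∈) (sym (cong₂ _+_ (δ-≢ s≢j) (outsideOf-∈ {s ∷ S} (there j∈))))
      by (no s≢j) (no j∉) = trans (outsideOf-∉ j∉) (sym (cong₂ _+_ (δ-≢ s≢j) (outsideOf-∉ {s ∷ S} λ where
        (here e) → s≢j (sym e)
        (there j∈) → j∉ j∈)))

    ∑-split : ∀ {S} → Unique S → (F : Fin N → ℚ) → ∑ F ≡ ∑ˡ S F + ∑[ j ] (outsideOf S j * F j)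
    ∑-split {[]} [] F = trans (∑-cong λ j → sym
      (trans (cong (_* F j) (outsideOf-∉ {[]} λ ())) (ℚ.*-identityˡ (F j))))
      (sym (ℚ.+-identityˡ (∑[ j ] (outsideOf [] j * F j))))
    ∑-split {s ∷ S} u@(_ ∷ u′) F = begin
      ∑ F
        ≡⟨ ∑-split u′ F ⟩
      ∑ˡ S F + ∑[ j ] (outsideOf S j * F j)
        ≡⟨ cong (λ t → ∑ˡ S F + t) (trans (∑-cong λ j → trans
          (cong (_* F j) (outsideOf-∷ (Unique.Unique[x∷xs]⇒x∉xs u) j))
          (ℚ.*-distribʳ-+ (F j) (δ s j) (outsideOf (s ∷ S) j)))
          (trans (∑-+ (λ j → δ s j * F j) (λ j → outsideOf (s ∷ S) j * F j))
          (cong (λ t → t + ∑[ j ] (outsideOf (s ∷ S) j * F j)) (∑-δ s F)))) ⟩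
      ∑ˡ S F + (F s + ∑[ j ] (outsideOf (s ∷ S) j * F j))
        ≡⟨ solve 3 (λ a b c → a :+ (b :+ c) := b :+ a :+ c) refl (∑ˡ S F) (F s) _ ⟩
      ∑ˡ (s ∷ S) F + ∑[ j ] (outsideOf (s ∷ S) j * F j) ∎
      where
      open ≡-Reasoning

    -- The constant function `w` is split along `S` too; subtracting its part on `S` leaves `m`
    -- copies of `w` without enumerating the complement.
    ∑-avoiding : ∀ {S} → Unique S → ∀ {F : Fin N → ℚ} {w} → (∀ {j} → j ∈ S → F j ≡ 0ℚ) →
      (∀ {j} → j ∉ S → F j ≡ w) →
      ∀ m → N ≡ length S ℕ.+ m → ∑ F ≡ # m * w
    ∑-avoiding {S} u {F} {w} F∈ F∉ m N≡ = begin
      ∑ F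
        ≡⟨ ∑-split u F ⟩
      ∑ˡ S F + ∑[ j ] (outsideOf S j * F j)
        ≡⟨ cong₂ _+_ (trans (∑ˡ-const S F∈) (ℚ.*-zeroʳ (# (length S)))) (∑-cong λ j → out* j) ⟩
      0ℚ + ∑[ j ] (outsideOf S j * w)
        ≡⟨ solve 3 (λ l w s → :0 :+ s := (l :* w :+ s) :- l :* w) refl (# (length S)) w
          (∑[ j ] (outsideOf S j * w)) ⟩
      (# (length S) * w + ∑[ j ] (outsideOf S j * w)) - # (length S) * w
        ≡⟨ cong (_- # (length S) * w) (trans
          (cong (λ t → t + ∑[ j ] (outsideOf S j * w)) (sym (∑ˡ-const S (λ _ → refl))))
          (sym (∑-split u (λ _ → w)))) ⟩
      ∑ (λ (_ : Fin N) → w) - # (length S) * w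
        ≡⟨ cong (_- # (length S) * w) (trans (∑-const N w)
          (cong (_* w) (trans (cong # N≡) (#-+ (length S) m)))) ⟩
      (# (length S) + # m) * w - # (length S) * w
        ≡⟨ solve 3 (λ l m w → (l :+ m) :* w :- l :* w := m :* w) refl (# (length S)) (# m) w ⟩
      # m * w ∎
      where
      open ≡-Reasoning
      ∑ˡ-const : ∀ (S : List (Fin N)) {F : Fin N → ℚ} {w} → (∀ {j} → j ∈ S → F j ≡ w) → ∑ˡ S F ≡ # (length S)
        * w
      ∑ˡ-const [] {w = w} h = sym (trans (cong (_* w) (#≡num 0)) (ℚ.*-zeroˡ w))
      ∑ˡ-const (s ∷ S) {w = w} h = trans (cong₂ _+_ (h (here refl)) (∑ˡ-const S (λ j∈ → h (there j∈)))) (trans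
          (solve 2 (λ w l → w :+ l :* w := (:1 :+ l) :* w) refl w (# (length S)))
            (cong (_* w) (sym (#-suc (length S)))))
      out* : ∀ j → outsideOf S j * F j ≡ outsideOf S j * w
      out* j with j ∈? S
      ... | yes j∈ = trans (cong (_* F j) (outsideOf-∈ j∈))
        (trans (trans (ℚ.*-zeroˡ (F j)) (sym (ℚ.*-zeroˡ w))) (cong (_* w) (sym (outsideOf-∈ j∈))))
      ... | no j∉ = cong (outsideOf S j *_) (F∉ j∉)

  -- Perfect matchings as fixed-point-free involutions

  ∣p∣≡0⇒p≡⊥ : ∀ {k} (p : Subset k) → Subset.∣ p ∣ ≡ 0 → p ≡ Subset.⊥
  ∣p∣≡0⇒p≡⊥ [] _ = refl
  ∣p∣≡0⇒p≡⊥ (outside ∷ p) e = cong (outside ∷_) (∣p∣≡0⇒p≡⊥ p e)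

  ∣p∣≡1⇒singleton : ∀ {k} (p : Subset k) → Subset.∣ p ∣ ≡ 1 → ∃ λ i → p ≡ ⁅ i ⁆
  ∣p∣≡1⇒singleton (inside ∷ p) e = zero , cong (inside ∷_) (∣p∣≡0⇒p≡⊥ p (ℕ.suc-injective e))
  ∣p∣≡1⇒singleton (outside ∷ p) e with i , q ← ∣p∣≡1⇒singleton p e = suc i , cong (outside ∷_) q

  module Matching (n : ℕ) where
    N : ℕ
    N = 2 ℕ.* n

    V : Set
    V = Fin ∣V∣[ n ]

    private
      perfect : ∀ (v : V) → IsPerfectMatching (⟦_⟧ {n} v)
      perfect v = perfectMatchings-sound {N} (∈-lookup {xs = perfectMatchings N} v)

      row : ∀ (v : V) i → ∃ λ j → lookup (⟦_⟧ {n} v) i ≡ ⁅ j ⁆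
      row v i = ∣p∣≡1⇒singleton _ (proj₂ (proj₂ (perfect v)) i)

    opaque
      mate : V → Fin N → Fin N
      mate v i = proj₁ (row v i)

      row≡ : ∀ v i → lookup (⟦_⟧ {n} v) i ≡ ⁅ mate v i ⁆
      row≡ v i = proj₂ (row v i)

    mate-∈ : ∀ v i → mate v i Subset.∈ lookup (⟦_⟧ {n} v) i
    mate-∈ v i = subst (mate v i Subset.∈_) (sym (row≡ v i)) (Subset.x∈⁅x⁆ (mate v i))

    ∈-mate : ∀ v i {j} → j Subset.∈ lookup (⟦_⟧ {n} v) i → mate v i ≡ j
    ∈-mate v i {j} j∈ = sym (Subset.x∈⁅y⁆⇒x≡y (mate v i) (subst (j Subset.∈_) (row≡ v i) j∈))

    mate-involutive : ∀ v i → mate v (mate v i) ≡ i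
    mate-involutive v i = ∈-mate v (mate v i) (proj₁ (perfect v) i (mate v i) (mate-∈ v i))

    mate≢ : ∀ v i → mate v i ≢ i
    mate≢ v i e = proj₁ (proj₂ (perfect v)) i (subst (Subset._∈ lookup (⟦_⟧ {n} v) i) e (mate-∈ v i))

    mate-injective : ∀ {v w} → (∀ i → mate v i ≡ mate w i) → v ≡ w
    mate-injective {v} {w} h = lookup-injective (perfectMatchings-unique N)
      (trans (sym (Vec.tabulate∘lookup (⟦_⟧ {n} v))) (trans
        (Vec.tabulate-cong (λ i → trans (row≡ v i) (trans (cong ⁅_⁆ (h i)) (sym (row≡ w i)))))
        (Vec.tabulate∘lookup (⟦_⟧ {n} w))))

    -- Together with `mate-injective` this identifies `V` with the fixed-point-free involutions of
    -- the vertices. The witness is the position of the adjacency matrix of `μ` in the list of all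
    -- matchings.
    mate-surjective : ∀ (μ : Fin N → Fin N) → (∀ i → μ (μ i) ≡ i) → (∀ i → μ i ≢ i) → ∃ λ v → ∀ i → mate v i ≡
      μ i
    mate-surjective μ μμ μ≢ = v , λ i → ∈-mate v i
      (subst (μ i Subset.∈_) (sym (trans (cong (λ M → lookup M i) (sym (lookup-index M∈))) (row-M i)))
      (Subset.x∈⁅x⁆ (μ i)))
      where
      M : EdgeSet N
      M = tabulate (λ i → ⁅ μ i ⁆)
      row-M : ∀ i → lookup M i ≡ ⁅ μ i ⁆
      row-M = Vec.lookup∘tabulate (λ i → ⁅ μ i ⁆)
      ∈M : ∀ i j → j Subset.∈ lookup M i → j ≡ μ i
      ∈M i j j∈ = Subset.x∈⁅y⁆⇒x≡y (μ i) (subst (j Subset.∈_) (row-M i) j∈)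
      M∈ : M ∈ perfectMatchings N
      M∈ = perfectMatchings-complete
        ( (λ i j j∈ → subst (i Subset.∈_) (sym (row-M j))
          (subst (λ t → i Subset.∈ ⁅ t ⁆) (trans (sym (μμ i)) (cong μ (sym (∈M i j j∈)))) (Subset.x∈⁅x⁆ i)))
        , (λ i i∈ → μ≢ i (sym (∈M i i i∈)))
        , λ i → trans (cong Subset.∣_∣ (row-M i)) (Subset.∣⁅x⁆∣≡1 (μ i)))
      v : V
      v = Any.index M∈

  -- Counting the matchings that contain given edges.

  module Counting (n : ℕ) where
    open Matching n public
    open DecMembership (Fin._≟_ {N}) using (_∈?_)

    -- The indicator of a star, indexed by an ordered pair. It is symmetric and zero for `i ≡ j`, so
    -- sums over all pairs meet each edge twice.
    x : Fin N → Fin N → V → ℚ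
    x i j v = δ (mate v i) j

    supp : List (Fin N × Fin N) → List (Fin N)
    supp [] = []
    supp ((i , j) ∷ L) = i ∷ j ∷ supp L

    X : List (Fin N × Fin N) → V → ℚ
    X [] v = 1ℚ
    X ((i , j) ∷ L) v = x i j v * X L v

    Matches : V → Fin N × Fin N → Set
    Matches v (i , j) = mate v i ≡ j

    X-matched : ∀ {v} L → All (Matches v) L → X L v ≡ 1ℚ
    X-matched [] [] = refl
    X-matched {v} ((i , j) ∷ L) (refl ∷ h) = trans (cong₂ _*_ (δ-refl (mate v i)) (X-matched L h))
      (ℚ.*-identityˡ 1ℚ)

    X-cases : ∀ v L → All (Matches v) L ⊎ X L v ≡ 0ℚ
    X-cases v [] = inj₁ []
    X-cases v ((i , j) ∷ L) with X-cases v L | mate v i Fin.≟ j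
    ... | inj₁ h | yes e = inj₁ (e ∷ h)
    ... | inj₁ h | no ≢ = inj₂ (trans (cong (_* X L v) (δ-≢ ≢)) (ℚ.*-zeroˡ (X L v)))
    ... | inj₂ e | _ = inj₂ (trans (cong (x i j v *_) e) (ℚ.*-zeroʳ (x i j v)))

    module _ {v : V} where
      matches-∈ : ∀ {i} L → All (Matches v) L → i ∈ supp L → mate v i ∈ supp L
      matches-∈ ((i , j) ∷ L) (e ∷ h) (here refl) = there (here e)
      matches-∈ ((i , j) ∷ L) (e ∷ h) (there (here refl)) = here
        (trans (cong (mate v) (sym e)) (mate-involutive v i))
      matches-∈ ((i , j) ∷ L) (e ∷ h) (there (there k∈)) = there (there (matches-∈ L h k∈))

      matches-unique : ∀ {w i} L → All (Matches v) L → All (Matches w) L → i ∈ supp L → mate v i ≡ mate w i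
      matches-unique ((i , j) ∷ L) (e ∷ h) (e′ ∷ h′) (here refl) = trans e (sym e′)
      matches-unique {w} ((i , j) ∷ L) (e ∷ h) (e′ ∷ h′) (there (here refl)) = trans
        (trans (cong (mate v) (sym e)) (mate-involutive v i))
          (sym (trans (cong (mate w) (sym e′)) (mate-involutive w i)))
      matches-unique ((i , j) ∷ L) (e ∷ h) (e′ ∷ h′) (there (there k∈)) = matches-unique L h h′ k∈

    -- The involution that the edges of `L` prescribe on their endpoints. Once `L` covers every
    -- vertex, it is the only matching containing `L`.
    partner : List (Fin N × Fin N) → Fin N → Fin N
    partner [] k = k
    partner ((i , j) ∷ L) k with k Fin.≟ i | k Fin.≟ j
    ... | yes _ | _ = j
    ... | no _ | yes _ = i
    ... | no _ | no _ = partner L k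

    module _ (i j : Fin N) (L : List (Fin N × Fin N)) where
      partner-fst : partner ((i , j) ∷ L) i ≡ j
      partner-fst with i Fin.≟ i
      ... | yes _ = refl
      ... | no ≢ = ⊥-elim (≢ refl)

      partner-snd : i ≢ j → partner ((i , j) ∷ L) j ≡ i
      partner-snd i≢j with j Fin.≟ i | j Fin.≟ j
      ... | yes e | _ = ⊥-elim (i≢j (sym e))
      ... | no _ | yes _ = refl
      ... | no _ | no ≢ = ⊥-elim (≢ refl)

      partner-skip : ∀ {k} → k ≢ i → k ≢ j → partner ((i , j) ∷ L) k ≡ partner L k
      partner-skip {k} k≢i k≢j with k Fin.≟ i | k Fin.≟ j
      ... | yes e | _ = ⊥-elim (k≢i e)
      ... | no _ | yes e = ⊥-elim (k≢j e)
      ... | no _ | no _ = refl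

    partner-skip-∈ : ∀ {i j L k} → Unique (i ∷ j ∷ supp L) → k ∈ supp L → partner ((i , j) ∷ L) k ≡ partner L k
    partner-skip-∈ {i} {j} {L} u@(_ ∷ u′) k∈ = partner-skip i j L
      (λ { refl → Unique.Unique[x∷xs]⇒x∉xs u (there k∈) }) (λ { refl → Unique.Unique[x∷xs]⇒x∉xs u′ k∈ })

    partner-∈ : ∀ {k} L → Unique (supp L) → k ∈ supp L → partner L k ∈ supp L
    partner-∈ ((i , j) ∷ L) u (here refl) = subst (_∈ i ∷ j ∷ supp L) (sym (partner-fst i j L))
      (there (here refl))
    partner-∈ ((i , j) ∷ L) ((i≢j ∷ _) ∷ _) (there (here refl)) = subst (_∈ i ∷ j ∷ supp L)
      (sym (partner-snd i j L i≢j)) (here refl)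
    partner-∈ ((i , j) ∷ L) u@(_ ∷ _ ∷ u″) (there (there k∈)) = subst (_∈ i ∷ j ∷ supp L)
      (sym (partner-skip-∈ u k∈)) (there (there (partner-∈ L u″ k∈)))

    partner-involutive : ∀ {k} L → Unique (supp L) → k ∈ supp L → partner L (partner L k) ≡ k
    partner-involutive ((i , j) ∷ L) ((i≢j ∷ _) ∷ _) (here refl) = trans
      (cong (partner ((i , j) ∷ L)) (partner-fst i j L)) (partner-snd i j L i≢j)
    partner-involutive ((i , j) ∷ L) ((i≢j ∷ _) ∷ _) (there (here refl)) = trans
      (cong (partner ((i , j) ∷ L)) (partner-snd i j L i≢j)) (partner-fst i j L)
    partner-involutive ((i , j) ∷ L) u@(_ ∷ _ ∷ u″) (there (there k∈)) = trans
      (cong (partner ((i , j) ∷ L)) (partner-skip-∈ u k∈))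
      (trans (partner-skip-∈ u (partner-∈ L u″ k∈)) (partner-involutive L u″ k∈))

    partner-≢ : ∀ {k} L → Unique (supp L) → k ∈ supp L → partner L k ≢ k
    partner-≢ ((i , j) ∷ L) ((i≢j ∷ _) ∷ _) (here refl) e = i≢j (trans (sym e) (partner-fst i j L))
    partner-≢ ((i , j) ∷ L) ((i≢j ∷ _) ∷ _) (there (here refl)) e = i≢j (trans (sym (partner-snd i j L i≢j)) e)
    partner-≢ ((i , j) ∷ L) u@(_ ∷ _ ∷ u″) (there (there k∈)) e = partner-≢ L u″ k∈
      (trans (sym (partner-skip-∈ u k∈)) e)

    partner-matches : ∀ L → Unique (supp L) → All (λ (i , j) → partner L i ≡ j) L
    partner-matches [] u = []
    partner-matches ((i , j) ∷ L) u@(_ ∷ _ ∷ u″) = partner-fst i j L ∷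
      All.tabulate (λ {(k , l)} kl∈ → trans (partner-skip-∈ u (fst∈ L kl∈))
        (All.lookup (partner-matches L u″) kl∈))
      where
      fst∈ : ∀ {k l} L → (k , l) ∈ L → k ∈ supp L
      fst∈ ((k , l) ∷ L) (here refl) = here refl
      fst∈ ((k , l) ∷ L) (there kl∈) = there (there (fst∈ L kl∈))

    length-supp : ∀ L → length (supp L) ≡ 2 ℕ.* length L
    length-supp [] = refl
    length-supp ((i , j) ∷ L) = trans (cong (λ t → suc (suc t)) (length-supp L)) (sym (ℕ.*-suc 2 (length L)))

    δ-sym : ∀ {M} (i j : Fin M) → δ i j ≡ δ j i
    δ-sym i j with i Fin.≟ j
    ... | yes refl = refl
    ... | no i≢j = trans (δ-≢ i≢j) (sym (δ-≢ λ e → i≢j (sym e)))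

    ∑-x : ∀ i v → ∑[ j ] x i j v ≡ 1ℚ
    ∑-x i v = trans (∑-cong λ j → sym (ℚ.*-identityʳ (x i j v))) (∑-δ (mate v i) (λ _ → 1ℚ))

    -- In a matching that contains `L`, the mate of an endpoint of `L` is again an endpoint, so it
    -- is not the uncovered `i`; and no vertex is its own mate.
    X-used : ∀ {L i j} → i ∉ supp L → j ∈ i ∷ supp L → ∀ v → X ((i , j) ∷ L) v ≡ 0ℚ
    X-used {L} {i} {j} i∉ j∈ v with X-cases v ((i , j) ∷ L)
    ... | inj₂ e = e
    ... | inj₁ (e ∷ h) = ⊥-elim (absurd j∈)
      where
      absurd : j ∉ i ∷ supp L
      absurd (here j≡i) = mate≢ v i (trans e j≡i)
      absurd (there j∈L) = i∉ (subst (_∈ supp L) (trans (cong (mate v) (sym e)) (mate-involutive v i))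
        (matches-∈ L h j∈L))

    unique-∷ : ∀ {L i j} → Unique (supp L) → i ∉ supp L → j ∉ i ∷ supp L → Unique (supp ((i , j) ∷ L))
    unique-∷ {L} {i} {j} u i∉ j∉ = All.tabulate i≢
      ∷ All.tabulate (λ {k} k∈ j≡k → j∉ (there (subst (_∈ supp L) (sym j≡k) k∈))) ∷ u
      where
      i≢ : ∀ {k} → k ∈ j ∷ supp L → i ≢ k
      i≢ (here refl) i≡j = j∉ (here (sym i≡j))
      i≢ (there k∈) i≡k = i∉ (subst (_∈ supp L) (sym i≡k) k∈)

    -- If L covers all vertices it determines the matching; otherwise an uncovered
    -- vertex can be matched to any of the 2m+1 other uncovered ones.
    count : ∀ m L → Unique (supp L) → length L ℕ.+ m ≡ n → ∑ (X L) ≡ # (oddFactorial m)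
    count zero L u e = trans (∑-cong X≡δ) (trans (∑-δ v₀ (λ _ → 1ℚ)) (sym (#≡num 1)))
      where
      all∈ : ∀ i → i ∈ supp L
      all∈ = full u (trans (length-supp L) (cong (2 ℕ.*_) (trans (sym (ℕ.+-identityʳ (length L))) e)))
      v₀,mate : ∃ λ v → ∀ i → mate v i ≡ partner L i
      v₀,mate = mate-surjective (partner L) (λ i → partner-involutive L u (all∈ i))
        (λ i → partner-≢ L u (all∈ i))
      v₀ : V
      v₀ = proj₁ v₀,mate
      matches₀ : All (Matches v₀) L
      matches₀ = All.map (λ {(i , j)} e → trans (proj₂ v₀,mate i) e) (partner-matches L u)
      X≡δ : ∀ v → X L v ≡ δ v₀ v * 1ℚ
      X≡δ v = trans (by (v₀ Fin.≟ v)) (sym (ℚ.*-identityʳ (δ v₀ v)))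
        where
        by : Dec (v₀ ≡ v) → X L v ≡ δ v₀ v
        by (yes refl) = trans (X-matched L matches₀) (sym (δ-refl v₀))
        by (no v₀≢v) with X-cases v L
        ... | inj₁ h = ⊥-elim (v₀≢v (mate-injective (λ i → matches-unique L matches₀ h (all∈ i))))
        ... | inj₂ X≡0 = trans X≡0 (sym (δ-≢ v₀≢v))
    count (suc m) L u e = begin
      ∑ (X L)
        ≡⟨ ∑-cong (λ v → trans (sym (ℚ.*-identityˡ (X L v)))
          (trans (cong (_* X L v) (sym (∑-x i v))) (sym (∑-*ʳ (X L v) (λ j → x i j v))))) ⟩
      ∑[ v ] ∑[ j ] X ((i , j) ∷ L) v
        ≡⟨ ∑-comm (λ v j → X ((i , j) ∷ L) v) ⟩
      ∑[ j ] ∑ (X ((i , j) ∷ L))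
        ≡⟨ ∑-avoiding i∷u {λ j → ∑ (X ((i , j) ∷ L))} used unused 2n-1[ suc m ] N≡ ⟩
      # 2n-1[ suc m ] * # (oddFactorial m)
        ≡⟨ sym (#-* 2n-1[ suc m ] (oddFactorial m)) ⟩
      # (oddFactorial (suc m)) ∎
      where
      open ≡-Reasoning
      1+ℓ≤n : suc (length L) ℕ.≤ n
      1+ℓ≤n = subst (suc (length L) ℕ.≤_) (trans (sym (ℕ.+-suc (length L) m)) e) (ℕ.m≤m+n (suc (length L)) m)
      i,i∉ : ∃ λ i → i ∉ supp L
      i,i∉ = fresh (supp L) (subst (ℕ._< N) (sym (length-supp L)) (ℕ.*-monoʳ-< 2 1+ℓ≤n))
      i : Fin N
      i = proj₁ i,i∉
      i∉ : i ∉ supp L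
      i∉ = proj₂ i,i∉
      i∷u : Unique (i ∷ supp L)
      i∷u = All.tabulate (λ {k} k∈ i≡k → i∉ (subst (_∈ supp L) (sym i≡k) k∈)) ∷ u
      N≡ : N ≡ length (i ∷ supp L) ℕ.+ 2n-1[ suc m ]
      N≡ = trans (cong (2 ℕ.*_) (sym e)) (trans
        (ℕS.solve 2 (λ l m → ℕS.con 2 ℕS.:* (l ℕS.:+ (ℕS.con 1 ℕS.:+ m)) ℕS.:=
        (ℕS.con 1 ℕS.:+ ℕS.con 2 ℕS.:* l) ℕS.:+ (ℕS.con 1 ℕS.:+ ℕS.con 2 ℕS.:* m)) refl (length L) m)
        (cong (λ t → suc t ℕ.+ suc (2 ℕ.* m)) (sym (length-supp L))))
        where module ℕS = ℕ.+-*-Solver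
      used : ∀ {j} → j ∈ i ∷ supp L → ∑ (X ((i , j) ∷ L)) ≡ 0ℚ
      used j∈ = ∑-zero (X-used i∉ j∈)
      unused : ∀ {j} → j ∉ i ∷ supp L → ∑ (X ((i , j) ∷ L)) ≡ # (oddFactorial m)
      unused {j} j∉ = count m ((i , j) ∷ L) (unique-∷ u i∉ j∉) (trans (sym (ℕ.+-suc (length L) m)) e)

  ∑ˡ-cong : ∀ {A : Set} {F G : A → ℚ} (xs : List A) → (∀ {x} → x ∈ xs → F x ≡ G x) → ∑ˡ xs F ≡ ∑ˡ xs G
  ∑ˡ-cong [] h = refl
  ∑ˡ-cong (x ∷ xs) h = cong₂ _+_ (h (here refl)) (∑ˡ-cong xs (λ x∈ → h (there x∈)))

  ∑ˡ-* : ∀ {A : Set} c (F : A → ℚ) (xs : List A) → ∑ˡ xs (λ x → c * F x) ≡ c * ∑ˡ xs F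
  ∑ˡ-* c F [] = sym (ℚ.*-zeroʳ c)
  ∑ˡ-* c F (x ∷ xs) = trans (cong (λ t → c * F x + t) (∑ˡ-* c F xs)) (sym (ℚ.*-distribˡ-+ c (F x) (∑ˡ xs F)))

  ∑-∑ˡ-comm : ∀ {k} {A : Set} (F : Fin k → A → ℚ) (xs : List A) → ∑[ i ] ∑ˡ xs (F i) ≡ ∑ˡ xs
    (λ x → ∑[ i ] F i x)
  ∑-∑ˡ-comm F [] = ∑-zero λ _ → refl
  ∑-∑ˡ-comm F (x ∷ xs) = trans (∑-+ (λ i → F i x) (λ i → ∑ˡ xs (F i)))
    (cong (λ t → (∑[ i ] F i x) + t) (∑-∑ˡ-comm F xs))

  -- Second and third moments

  module Moments (n m : ℕ) (n≡3+m : n ≡ suc (suc (suc m))) where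
    open Counting n public

    -- The numbers of matchings through one, two and three disjoint edges. The third moment needs
    -- all of them, hence n ≥ 3.
    t₁ t₂ t₃ : ℚ
    t₁ = # (oddFactorial (suc (suc m)))
    t₂ = # (oddFactorial (suc m))
    t₃ = # (oddFactorial m)

    module WithMatrix
      (a : Fin N → Fin N → ℚ)
      (a-sym : ∀ i j → a i j ≡ a j i)
      (a-diag : ∀ i → a i i ≡ 0ℚ)
      (a-row : ∀ i → ∑ (a i) ≡ 0ℚ)
      where

      y : Fin N → V → ℚ
      y r v = a r (mate v r)

      Q : V → ℚ
      Q v = ∑[ r ] y r v

      y≡∑ : ∀ r v → y r v ≡ ∑[ s ] (a r s * x r s v)
      y≡∑ r v = trans (sym (∑-δ (mate v r) (a r))) (∑-cong λ s → ℚ.*-comm (x r s v) (a r s))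

      -- For a multiple of a row of `a` the total vanishes, so the many vertices outside `S` are
      -- traded for the few inside, with a change of sign.
      ∑-vanish : ∀ {S} → Unique S → (F : Fin N → ℚ) → ∑[ j ] (outsideOf S j * F j) ≡ ∑ F - ∑ˡ S F
      ∑-vanish {S} u F = trans (solve 2 (λ s o → o := (s :+ o) :- s) refl (∑ˡ S F)
        (∑[ j ] (outsideOf S j * F j))) (cong (_- ∑ˡ S F) (sym (∑-split u F)))

      -- One more matched vertex: its partner runs over the unused vertices.
      expand : ∀ {L r} → Unique (supp L) → r ∉ supp L → (Φ : V → ℚ) → ∑[ v ] (X L v * y r v * Φ v) ≡
        ∑[ s ] (outsideOf (r ∷ supp L) s * (a r s * ∑[ v ] (X ((r , s) ∷ L) v * Φ v)))
      expand {L} {r} u r∉ Φ = begin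
        ∑[ v ] (X L v * y r v * Φ v)
          ≡⟨ ∑-cong (λ v → trans (cong (λ t → X L v * t * Φ v) (y≡∑ r v)) (trans
            (solve 3 (λ X y Φ → X :* y :* Φ := y :* (X :* Φ)) refl (X L v) (∑[ s ] (a r s * x r s v)) (Φ v))
               (trans (sym (∑-*ʳ (X L v * Φ v) (λ s → a r s * x r s v)))
                 (∑-cong λ s → solve 4 (λ a x X Φ → a :* x :* (X :* Φ) := a :* (x :* X :* Φ)) refl (a r s)
                 (x r s v) (X L v) (Φ v))))) ⟩
        ∑[ v ] ∑[ s ] (a r s * (X ((r , s) ∷ L) v * Φ v))
          ≡⟨ ∑-comm (λ v s → a r s * (X ((r , s) ∷ L) v * Φ v)) ⟩
        ∑[ s ] ∑[ v ] (a r s * (X ((r , s) ∷ L) v * Φ v))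
          ≡⟨ ∑-cong (λ s → trans (∑-* (a r s) (λ v → X ((r , s) ∷ L) v * Φ v)) (cut s)) ⟩
        ∑[ s ] (outsideOf (r ∷ supp L) s * (a r s * ∑[ v ] (X ((r , s) ∷ L) v * Φ v))) ∎
        where
        open ≡-Reasoning
        open DecMembership (Fin._≟_ {N}) using (_∈?_)
        cut : ∀ s → a r s * ∑[ v ] (X ((r , s) ∷ L) v * Φ v) ≡ outsideOf (r ∷ supp L) s *
          (a r s * ∑[ v ] (X ((r , s) ∷ L) v * Φ v))
        cut s = by (s ∈? (r ∷ supp L))
          where
          E : ℚ
          E = ∑[ v ] (X ((r , s) ∷ L) v * Φ v)
          by : Dec (s ∈ r ∷ supp L) → a r s * E ≡ outsideOf (r ∷ supp L) s * (a r s * E)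
          by (no s∉) = sym (trans (cong (_* (a r s * E)) (outsideOf-∉ s∉)) (ℚ.*-identityˡ (a r s * E)))
          by (yes s∈) = trans (trans (cong (a r s *_) E≡0) (ℚ.*-zeroʳ (a r s)))
            (sym (trans (cong (_* (a r s * E)) (outsideOf-∈ s∈)) (ℚ.*-zeroˡ (a r s * E))))
            where
            E≡0 : E ≡ 0ℚ
            E≡0 = ∑-zero λ v → trans (cong (_* Φ v) (X-used r∉ s∈ v)) (ℚ.*-zeroˡ (Φ v))

      matched : ∀ {L} {i j} → (i , j) ∈ L → ∀ v → (X L v * y i v ≡ X L v * a i j) ×
        (X L v * y j v ≡ X L v * a i j)
      matched {L} {i} {j} ij∈ v with X-cases v L
      ... | inj₂ e = vanish , vanish
        where
        vanish : ∀ {b c} → X L v * b ≡ X L v * c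
        vanish {b} {c} = trans (trans (cong (_* b) e) (ℚ.*-zeroˡ b)) (sym (trans (cong (_* c) e) (ℚ.*-zeroˡ c)))
      ... | inj₁ h = cong (λ t → X L v * a i t) e
                   , cong (X L v *_) (trans (cong (λ t → a j t)
                     (trans (cong (mate v) (sym e)) (mate-involutive v i))) (a-sym j i))
        where
        e : mate v i ≡ j
        e = All.lookup h ij∈

      ∑-matched : ∀ {L} {i j} → (i , j) ∈ L → (Φ : V → ℚ) →
        (∑[ v ] (X L v * y i v * Φ v) ≡ a i j * ∑[ v ] (X L v * Φ v)) ×
        (∑[ v ] (X L v * y j v * Φ v) ≡ a i j * ∑[ v ] (X L v * Φ v))
      ∑-matched {L} {i} {j} ij∈ Φ = by (y i) (λ v → proj₁ (matched ij∈ v)) , by (y j)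
        (λ v → proj₂ (matched ij∈ v))
        where
        by : (z : V → ℚ) → (∀ v → X L v * z v ≡ X L v * a i j) → ∑[ v ] (X L v * z v * Φ v) ≡ a i j * ∑[ v ]
          (X L v * Φ v)
        by z h = trans (∑-cong λ v → trans (cong (_* Φ v) (h v))
          (solve 3 (λ X a Φ → X :* a :* Φ := a :* (X :* Φ)) refl (X L v) (a i j) (Φ v)))
            (∑-* (a i j) (λ v → X L v * Φ v))

      ∑ˡ-matched : ∀ {L} (Φ : V → ℚ) → ∑ˡ (supp L) (λ r → ∑[ v ] (X L v * y r v * Φ v)) ≡
        ∑ˡ L (λ (i , j) → num 2 * a i j) * ∑[ v ] (X L v * Φ v)
      ∑ˡ-matched {L} Φ = go L (λ k → k)
        where
        E : ℚ
        E = ∑[ v ] (X L v * Φ v)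
        go : ∀ L′ → (∀ {e} → e ∈ L′ → e ∈ L) → ∑ˡ (supp L′) (λ r → ∑[ v ] (X L v * y r v * Φ v)) ≡ ∑ˡ L′
          (λ (i , j) → num 2 * a i j) * E
        go [] h = sym (ℚ.*-zeroˡ E)
        go ((i , j) ∷ L′) h = trans
          (cong₂ _+_ (proj₁ (∑-matched (h (here refl)) Φ))
            (cong₂ _+_ (proj₂ (∑-matched (h (here refl)) Φ)) (go L′ (λ k → h (there k)))))
          (solve 3 (λ a s E → a :* E :+ (a :* E :+ s :* E) := (:# 2 :* a :+ s) :* E) refl (a i j)
            (∑ˡ L′ (λ (i , j) → num 2 * a i j)) E)

      -- An edge of `L` contributes its entry at both ends, hence the factor 2. The uncovered `r`
      -- are left to `expand`.
      ∑-X*Q : ∀ {L} → Unique (supp L) → (Φ : V → ℚ) → ∑[ v ] (X L v * Q v * Φ v) ≡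
        ∑ˡ L (λ (i , j) → num 2 * a i j) * ∑[ v ] (X L v * Φ v) + ∑[ r ]
          (outsideOf (supp L) r * ∑[ v ] (X L v * y r v * Φ v))
      ∑-X*Q {L} u Φ = begin
        ∑[ v ] (X L v * Q v * Φ v)
          ≡⟨ ∑-cong (λ v → trans (lemma (X L v) (Q v) (Φ v))
            (trans (sym (∑-* (X L v * Φ v) (λ r → y r v))) (∑-cong λ r → lemma (X L v) (Φ v) (y r v)))) ⟩
        ∑[ v ] ∑[ r ] (X L v * y r v * Φ v)
          ≡⟨ ∑-comm (λ v r → X L v * y r v * Φ v) ⟩
        ∑[ r ] ∑[ v ] (X L v * y r v * Φ v)
          ≡⟨ ∑-split u (λ r → ∑[ v ] (X L v * y r v * Φ v)) ⟩
        ∑ˡ (supp L) (λ r → ∑[ v ] (X L v * y r v * Φ v)) + ∑[ r ]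
          (outsideOf (supp L) r * ∑[ v ] (X L v * y r v * Φ v))
          ≡⟨ cong (λ t → t + ∑[ r ] (outsideOf (supp L) r * ∑[ v ] (X L v * y r v * Φ v))) (∑ˡ-matched {L} Φ) ⟩
        ∑ˡ L (λ (i , j) → num 2 * a i j) * ∑[ v ] (X L v * Φ v) + ∑[ r ]
          (outsideOf (supp L) r * ∑[ v ] (X L v * y r v * Φ v)) ∎
        where
        open ≡-Reasoning
        lemma : ∀ X y Φ → X * y * Φ ≡ X * Φ * y
        lemma = solve 3 (λ X y Φ → X :* y :* Φ := X :* Φ :* y) refl

      outside-cong : ∀ {S} {F G : Fin N → ℚ} → (∀ {r} → r ∉ S → F r ≡ G r) → ∑[ r ] (outsideOf S r * F r) ≡ ∑[
        r ] (outsideOf S r * G r)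
      outside-cong {S} {F} {G} h = ∑-cong λ r → by r (r ∈? S)
        where
        open DecMembership (Fin._≟_ {N}) using (_∈?_)
        by : ∀ r → Dec (r ∈ S) → outsideOf S r * F r ≡ outsideOf S r * G r
        by r (no r∉) = cong (outsideOf S r *_) (h r∉)
        by r (yes r∈) = trans (cong (_* F r) (outsideOf-∈ r∈))
          (trans (trans (ℚ.*-zeroˡ (F r)) (sym (ℚ.*-zeroˡ (G r)))) (cong (_* G r) (sym (outsideOf-∈ r∈))))

      first-moment : ∀ {L} k → Unique (supp L) → length L ℕ.+ suc k ≡ n → ∑[ v ] (X L v * Q v) ≡
        ∑ˡ L (λ (i , j) → num 2 * a i j) * # (oddFactorial (suc k)) + # (oddFactorial k) * ∑ˡ (supp L)
          (λ r → ∑ˡ (supp L) (a r))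
      first-moment {L} k u e = begin
        ∑[ v ] (X L v * Q v)
          ≡⟨ ∑-cong (λ v → sym (ℚ.*-identityʳ (X L v * Q v))) ⟩
        ∑[ v ] (X L v * Q v * 1ℚ)
          ≡⟨ ∑-X*Q u (λ _ → 1ℚ) ⟩
        P * ∑[ v ] (X L v * 1ℚ) + ∑[ r ] (outsideOf (supp L) r * ∑[ v ] (X L v * y r v * 1ℚ))
          ≡⟨ cong₂ (λ s t → P * s + t) (trans (∑-cong λ v → ℚ.*-identityʳ (X L v)) (count (suc k) L u e))
            (trans (outside-cong y-sum) out-sum) ⟩
        P * # (oddFactorial (suc k)) + t′ * ∑ˡ (supp L) A ∎
        where
        open ≡-Reasoning
        P t′ : ℚ
        P = ∑ˡ L (λ (i , j) → num 2 * a i j)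
        t′ = # (oddFactorial k)
        A : Fin N → ℚ
        A r = ∑ˡ (supp L) (a r)
        lemma : ∀ t s → t * (0ℚ - (0ℚ + s)) ≡ - t * s
        lemma = solve 2 (λ t s → t :* (:0 :- (:0 :+ s)) := :- t :* s) refl
        y-sum : ∀ {r} → r ∉ supp L → ∑[ v ] (X L v * y r v * 1ℚ) ≡ - t′ * A r
        y-sum {r} r∉ = begin
          ∑[ v ] (X L v * y r v * 1ℚ)
            ≡⟨ expand u r∉ (λ _ → 1ℚ) ⟩
          ∑[ s ] (outsideOf (r ∷ supp L) s * (a r s * ∑[ v ] (X ((r , s) ∷ L) v * 1ℚ)))
            ≡⟨ outside-cong {r ∷ supp L} (λ {s} s∉ → trans
              (cong (a r s *_) (trans (∑-cong λ v → ℚ.*-identityʳ (X ((r , s) ∷ L) v))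
              (count k ((r , s) ∷ L) (unique-∷ u r∉ s∉) (trans (sym (ℕ.+-suc (length L) k)) e))))
              (ℚ.*-comm (a r s) t′)) ⟩
          ∑[ s ] (outsideOf (r ∷ supp L) s * (t′ * a r s))
            ≡⟨ ∑-vanish (unique-r∷ r∉) (λ s → t′ * a r s) ⟩
          ∑[ s ] (t′ * a r s) - ∑ˡ (r ∷ supp L) (λ s → t′ * a r s)
            ≡⟨ cong₂ _-_ (trans (∑-* t′ (a r)) (cong (t′ *_) (a-row r)))
              (trans (∑ˡ-* t′ (a r) (r ∷ supp L)) (cong (λ z → t′ * (z + A r)) (a-diag r))) ⟩
          t′ * 0ℚ - t′ * (0ℚ + A r)
            ≡⟨ solve 2 (λ t s → t :* :0 :- t :* (:0 :+ s) := :- t :* s) refl t′ (A r) ⟩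
          - t′ * A r ∎
          where
          unique-r∷ : ∀ {r} → r ∉ supp L → Unique (r ∷ supp L)
          unique-r∷ r∉ = All.tabulate (λ {k} k∈ r≡k → r∉ (subst (_∈ supp L) (sym r≡k) k∈)) ∷ u
        ∑A≡0 : ∑ A ≡ 0ℚ
        ∑A≡0 = trans (∑-∑ˡ-comm a (supp L)) (trans
          (∑ˡ-cong (supp L) (λ {s} _ → trans (∑-cong λ r → a-sym r s) (a-row s))) (zeros (supp L)))
          where
          zeros : ∀ (S : List (Fin N)) → ∑ˡ S (λ _ → 0ℚ) ≡ 0ℚ
          zeros [] = refl
          zeros (_ ∷ S) = trans (ℚ.+-identityˡ _) (zeros S)
        out-sum : ∑[ r ] (outsideOf (supp L) r * (- t′ * A r)) ≡ t′ * ∑ˡ (supp L) A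
        out-sum = begin
          ∑[ r ] (outsideOf (supp L) r * (- t′ * A r))
            ≡⟨ ∑-vanish u (λ r → - t′ * A r) ⟩
          ∑[ r ] (- t′ * A r) - ∑ˡ (supp L) (λ r → - t′ * A r)
            ≡⟨ cong₂ _-_ (trans (∑-* (- t′) A) (cong (- t′ *_) ∑A≡0)) (∑ˡ-* (- t′) A (supp L)) ⟩
          - t′ * 0ℚ - - t′ * ∑ˡ (supp L) A
            ≡⟨ solve 2 (λ t s → :- t :* :0 :- :- t :* s := t :* s) refl t′ (∑ˡ (supp L) A) ⟩
          t′ * ∑ˡ (supp L) A ∎

      a-col : ∀ j → ∑[ i ] a i j ≡ 0ℚ
      a-col j = trans (∑-cong λ i → a-sym i j) (a-row j)

      -- The square of the symmetric matrix `a`. Thus `S₂` and `T` are the traces of the second and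
      -- third powers of `a`, while `S₃` sums the cubes of its entries.
      R : Fin N → Fin N → ℚ
      R i j = ∑[ s ] (a i s * a j s)

      S₂ S₃ T : ℚ
      S₂ = ∑[ i ] R i i
      S₃ = ∑[ i ] ∑[ j ] (a i j * (a i j * a i j))
      T = ∑[ i ] ∑[ j ] (a i j * R i j)

      R-sym : ∀ i j → R i j ≡ R j i
      R-sym i j = ∑-cong λ s → ℚ.*-comm (a i s) (a j s)

      ∑R : ∀ i → ∑[ r ] R r i ≡ 0ℚ
      ∑R i = trans (∑-comm (λ r s → a r s * a i s)) (∑-zero λ s →
        trans (∑-*ʳ (a i s) (λ r → a r s)) (trans (cong (_* a i s) (a-col s)) (ℚ.*-zeroˡ (a i s))))

      ∑Q : ∑ Q ≡ 0ℚ
      ∑Q = trans (∑-cong λ v → sym (ℚ.*-identityˡ (Q v)))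
        (trans (first-moment {[]} (suc (suc m)) [] (sym n≡3+m))
          (solve 2 (λ t₁ t₀ → :0 :* t₀ :+ t₁ :* :0 := :0) refl t₁ (# (oddFactorial (suc (suc (suc m)))))))

      -- Summing `Q` over the star of an edge gives back its entry up to one scalar. This makes the
      -- projection explicit, and the scalar determines `β`.
      ∑xQ : ∀ {i j} → i ≢ j → ∑[ v ] (x i j v * Q v) ≡ num 2 * (t₁ + t₂) * a i j
      ∑xQ {i} {j} i≢j = trans (∑-cong λ v → cong (_* Q v) (sym (ℚ.*-identityʳ (x i j v))))
        (trans (first-moment {(i , j) ∷ []} (suc m) ((i≢j ∷ []) ∷ [] ∷ []) (sym n≡3+m))
          (trans (cong (λ z → (num 2 * a i j + 0ℚ) * t₁ + t₂ * z) doubled)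
            (solve 3 (λ t₁ t₂ d → (:# 2 :* d :+ :0) :* t₁ :+ t₂ :*
              ((:0 :+ (d :+ :0)) :+ ((d :+ (:0 :+ :0)) :+ :0)) := :# 2 :* (t₁ :+ t₂) :* d) refl t₁ t₂ (a i j))))
        where
        doubled : (a i i + (a i j + 0ℚ)) + ((a j i + (a j j + 0ℚ)) + 0ℚ) ≡ (0ℚ + (a i j + 0ℚ)) +
          ((a i j + (0ℚ + 0ℚ)) + 0ℚ)
        doubled = cong₂ (λ p q → (p + (a i j + 0ℚ)) + (q + 0ℚ)) (a-diag i)
          (cong₂ (λ p q → p + (q + 0ℚ)) (a-sym j i) (a-diag j))

      -- Writing one factor `Q` as a combination of stars reduces each moment of `Q` to the
      -- preceding moment over a single star.
      ∑-Q* : ∀ (Φ : V → ℚ) → ∑[ v ] (Q v * Φ v) ≡ ∑[ i ] ∑[ j ] (a i j * ∑[ v ] (x i j v * Φ v))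
      ∑-Q* Φ = trans (∑-cong λ v → sym (∑-*ʳ (Φ v) (λ r → y r v)))
        (trans (∑-comm (λ v r → y r v * Φ v)) (∑-cong λ i →
          trans (∑-cong λ v → trans (cong (_* Φ v) (y≡∑ i v))
            (trans (sym (∑-*ʳ (Φ v) (λ s → a i s * x i s v))) (∑-cong λ s → ℚ.*-assoc (a i s) (x i s v) (Φ v))))
            (trans (∑-comm (λ v s → a i s * (x i s v * Φ v)))
              (∑-cong λ s → ∑-* (a i s) (λ v → x i s v * Φ v)))))

      -- The zero diagonal of `a` hides the pairs `i ≡ j`, for which the moments over a star take
      -- another form.
      off-diagonal : ∀ {F G : Fin N → Fin N → ℚ} → (∀ {i j} → i ≢ j → F i j ≡ G i j) → ∀ i j → a i j * F i j ≡
        a i j * G i j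
      off-diagonal {F} {G} h i j = by (i Fin.≟ j)
        where
        by : Dec (i ≡ j) → a i j * F i j ≡ a i j * G i j
        by (no i≢j) = cong (a i j *_) (h i≢j)
        by (yes e) = trans (vanish (F i j)) (sym (vanish (G i j)))
          where
          vanish : ∀ b → a i j * b ≡ 0ℚ
          vanish b = trans (cong (_* b) (trans (cong (a i) (sym e)) (a-diag i))) (ℚ.*-zeroˡ b)

      ∑QQ : ∑[ v ] (Q v * Q v) ≡ num 2 * (t₁ + t₂) * S₂
      ∑QQ = trans (∑-Q* Q) (trans
        (∑-cong λ i → trans (∑-cong λ j → trans (off-diagonal ∑xQ i j)
          (solve 2 (λ a c → a :* (c :* a) := c :* (a :* a)) refl (a i j) (num 2 * (t₁ + t₂))))
            (∑-* (num 2 * (t₁ + t₂)) (λ j → a i j * a i j)))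
        (∑-* (num 2 * (t₁ + t₂)) (λ i → R i i)))

      module _ {i j : Fin N} (i≢j : i ≢ j) where
        private
          L : List (Fin N × Fin N)
          L = (i , j) ∷ []

          unique-L : Unique (supp L)
          unique-L = (i≢j ∷ []) ∷ [] ∷ []

          d : ℚ
          d = a i j

          -- `first-moment` for the edges {i , j} and {r , s}: the two edges themselves, and with
          -- weight `t₃` all six pairs among the four endpoints.
          G : Fin N → Fin N → ℚ
          G r s = num 2 * (t₂ * (d + a r s) + t₃ * (d + a i r + a i s + a j r + a j s + a r s))

          ∑xxQ : ∀ {r s} → r ∉ i ∷ j ∷ [] → s ∉ r ∷ i ∷ j ∷ [] → ∑[ v ] (X ((r , s) ∷ L) v * Q v) ≡ G r s
          ∑xxQ {r} {s} r∉ s∉ = trans (first-moment {(r , s) ∷ L} m (unique-∷ unique-L r∉ s∉) (sym n≡3+m))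
            (trans (cong (λ z → (num 2 * a r s + (num 2 * d + 0ℚ)) * t₂ + t₃ * z) quadrupled)
                (solve 8 (λ t₂ t₃ d rs ir is jr js → (:# 2 :* rs :+ (:# 2 :* d :+ :0)) :* t₂ :+ t₃ :*
                  ((:0 :+ (rs :+ (ir :+ (jr :+ :0)))) :+
                  ((rs :+ (:0 :+ (is :+ (js :+ :0)))) :+
                  ((ir :+ (is :+ (:0 :+ (d :+ :0)))) :+ ((jr :+ (js :+ (d :+ (:0 :+ :0)))) :+ :0)))) := :# 2
                  :* (t₂ :* (d :+ rs) :+ t₃ :* (d :+ ir :+ is :+ jr :+ js :+ rs))) refl t₂ t₃ d (a r s)
                  (a i r) (a i s) (a j r) (a j s)))
            where
            row₄ : ∀ {p q r s p′ q′ r′ s′ : ℚ} → p ≡ p′ → q ≡ q′ → r ≡ r′ → s ≡ s′ → p + (q + (r + (s + 0ℚ)))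
              ≡ p′ + (q′ + (r′ + (s′ + 0ℚ)))
            row₄ refl refl refl refl = refl
            quadrupled :
              (a r r + (a r s + (a r i + (a r j + 0ℚ)))) +
                ((a s r + (a s s + (a s i + (a s j + 0ℚ)))) +
                ((a i r + (a i s + (a i i + (a i j + 0ℚ)))) +
                ((a j r + (a j s + (a j i + (a j j + 0ℚ)))) + 0ℚ)))
              ≡ (0ℚ + (a r s + (a i r + (a j r + 0ℚ)))) +
                ((a r s + (0ℚ + (a i s + (a j s + 0ℚ)))) +
                ((a i r + (a i s + (0ℚ + (d + 0ℚ)))) + ((a j r + (a j s + (d + (0ℚ + 0ℚ)))) + 0ℚ)))
            quadrupled = row₄
              (row₄ (a-diag r) (refl {x = a r s}) (a-sym r i) (a-sym r j))
                (row₄ (a-sym s r) (a-diag s) (a-sym s i) (a-sym s j))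
              (row₄ (refl {x = a i r}) (refl {x = a i s}) (a-diag i) (refl {x = d}))
                (row₄ (refl {x = a j r}) (refl {x = a j s}) (a-sym j i) (a-diag j))

          h : Fin N → Fin N → ℚ
          h r s = a r s * G r s

          ∑h : ∀ r → ∑ (h r) ≡ num 2 * (t₂ + t₃) * R r r + num 2 * t₃ * (R r i + R r j)
          ∑h r = trans (∑-cong λ s → solve 8 (λ t₂ t₃ d rs ir is jr js → rs :*
            (:# 2 :* (t₂ :* (d :+ rs) :+ t₃ :* (d :+ ir :+ is :+ jr :+ js :+ rs))) :=
            (:# 2 :* t₂ :* d :+ :# 2 :* t₃ :* (d :+ ir :+ jr)) :* rs :+ :# 2 :* (t₂ :+ t₃) :* (rs :* rs) :+ :#
            2 :* t₃ :* (rs :* is) :+ :# 2 :* t₃ :* (rs :* js)) refl t₂ t₃ d (a r s) (a i r) (a i s) (a j r)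
            (a j s))
            (trans (∑-lin₄ (num 2 * t₂ * d + num 2 * t₃ * (d + a i r + a j r)) (a r) (num 2 * (t₂ + t₃))
              (λ s → a r s * a r s) (num 2 * t₃) (λ s → a r s * a i s) (num 2 * t₃) (λ s → a r s * a j s))
              (trans (cong (λ z → (num 2 * t₂ * d + num 2 * t₃ * (d + a i r + a j r)) * z + num 2 * (t₂ + t₃)
                * R r r + num 2 * t₃ * R r i + num 2 * t₃ * R r j) (a-row r))
                  (solve 6 (λ t₂ t₃ c rr ri rj → c :* :0 :+ :# 2 :* (t₂ :+ t₃) :* rr :+ :# 2 :* t₃ :* ri :+ :#
                    2 :* t₃ :* rj := :# 2 :* (t₂ :+ t₃) :* rr :+ :# 2 :* t₃ :* (ri :+ rj)) refl t₂ t₃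
                    (num 2 * t₂ * d + num 2 * t₃ * (d + a i r + a j r)) (R r r) (R r i) (R r j))))

          -- A polynomial that makes sense for every `r`, although `∑xyQ` identifies it with a
          -- moment only for uncovered `r`. The sum can thus be completed to all vertices, and the
          -- values at `i` and `j` are subtracted afterwards.
          K : Fin N → ℚ
          K r = (num 2 * (t₂ + t₃) * R r r + num 2 * t₃ * R r i + num 2 * t₃ * R r j + - num 2 *
            (t₂ + num 2 * t₃) * d * a i r)
            + (- num 2 * (t₂ + num 2 * t₃) * (a i r * a i r) + - num 2 * (t₂ + num 2 * t₃) * d * a j r
              + - num 2 * (t₂ + num 2 * t₃) * (a j r * a j r) + - num 4 * t₃ * (a i r * a j r))

          ∑xyQ : ∀ {r} → r ∉ supp L → ∑[ v ] (X L v * y r v * Q v) ≡ K r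
          ∑xyQ {r} r∉ = begin
            ∑[ v ] (X L v * y r v * Q v)
              ≡⟨ expand unique-L r∉ Q ⟩
            ∑[ s ] (outsideOf (r ∷ supp L) s * (a r s * ∑[ v ] (X ((r , s) ∷ L) v * Q v)))
              ≡⟨ outside-cong {r ∷ supp L} (λ {s} s∉ → cong (a r s *_) (∑xxQ r∉ s∉)) ⟩
            ∑[ s ] (outsideOf (r ∷ supp L) s * h r s)
              ≡⟨ ∑-vanish (All.tabulate (λ {k} k∈ r≡k → r∉ (subst (_∈ supp L) (sym r≡k) k∈)) ∷ unique-L) (h r) ⟩
            ∑ (h r) - (h r r + (h r i + (h r j + 0ℚ)))
              ≡⟨ cong₂ _-_ (∑h r) (cong₂ _+_ (cong (_* G r r) (a-diag r))
                (cong₂ (λ p q → p + (q + 0ℚ)) h-i h-j)) ⟩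
            (num 2 * (t₂ + t₃) * R r r + num 2 * t₃ * (R r i + R r j)) -
              (0ℚ * G r r + (a i r * (num 2 * (t₂ * (d + a i r) + t₃ * (d + a i r + 0ℚ + a j r + d + a i r)))
                + (a j r * (num 2 * (t₂ * (d + a j r) + t₃ * (d + a i r + d + a j r + 0ℚ + a j r))) + 0ℚ)))
              ≡⟨ solve 9 (λ t₂ t₃ d b e rr ri rj g → (:# 2 :* (t₂ :+ t₃) :* rr :+ :# 2 :* t₃ :* (ri :+ rj)) :-
                (:0 :* g :+ (b :* (:# 2 :* (t₂ :* (d :+ b) :+ t₃ :* (d :+ b :+ :0 :+ e :+ d :+ b))) :+
                (e :* (:# 2 :* (t₂ :* (d :+ e) :+ t₃ :* (d :+ b :+ d :+ e :+ :0 :+ e))) :+ :0))) :=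
                (:# 2 :* (t₂ :+ t₃) :* rr :+ :# 2 :* t₃ :* ri :+ :# 2 :* t₃ :* rj :+ :- :# 2 :*
                (t₂ :+ :# 2 :* t₃) :* d :* b) :+ (:- :# 2 :* (t₂ :+ :# 2 :* t₃) :* (b :* b) :+ :- :# 2 :*
                (t₂ :+ :# 2 :* t₃) :* d :* e :+ :- :# 2 :* (t₂ :+ :# 2 :* t₃) :* (e :* e) :+ :- :# 4 :* t₃ :*
                (b :* e))) refl t₂ t₃ d (a i r) (a j r) (R r r) (R r i) (R r j) (G r r) ⟩
            K r ∎
            where
            open ≡-Reasoning
            h-cong : ∀ {rs rs′ is is′ js js′ : ℚ} → rs ≡ rs′ → is ≡ is′ → js ≡ js′ →
              rs * (num 2 * (t₂ * (d + rs) + t₃ * (d + a i r + is + a j r + js + rs))) ≡ rs′ *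
                (num 2 * (t₂ * (d + rs′) + t₃ * (d + a i r + is′ + a j r + js′ + rs′)))
            h-cong refl refl refl = refl
            h-i : h r i ≡ a i r * (num 2 * (t₂ * (d + a i r) + t₃ * (d + a i r + 0ℚ + a j r + d + a i r)))
            h-i = h-cong (a-sym r i) (a-diag i) (a-sym j i)
            h-j : h r j ≡ a j r * (num 2 * (t₂ * (d + a j r) + t₃ * (d + a i r + d + a j r + 0ℚ + a j r)))
            h-j = h-cong (a-sym r j) (refl {x = d}) (a-diag j)

          ∑K : ∑ K ≡ num 2 * (t₂ + t₃) * S₂ + - num 2 * (t₂ + num 2 * t₃) * (R i i + R j j) + - num 4 * t₃ * R
            i j
          ∑K = begin
            ∑ K
              ≡⟨ ∑-+ K₁ K₂ ⟩
            ∑ K₁ + ∑ K₂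
              ≡⟨ cong₂ _+_
                   (∑-lin₄ (num 2 * (t₂ + t₃)) (λ r → R r r) (num 2 * t₃) (λ r → R r i) (num 2 * t₃)
                     (λ r → R r j) (- num 2 * (t₂ + num 2 * t₃) * d) (a i))
                   (∑-lin₄ (- num 2 * (t₂ + num 2 * t₃)) (λ r → a i r * a i r)
                     (- num 2 * (t₂ + num 2 * t₃) * d) (a j) (- num 2 * (t₂ + num 2 * t₃))
                     (λ r → a j r * a j r) (- num 4 * t₃) (λ r → a i r * a j r)) ⟩
            (num 2 * (t₂ + t₃) * S₂ + num 2 * t₃ * (∑[ r ] R r i) + num 2 * t₃ * (∑[ r ] R r j) + - num 2 *
              (t₂ + num 2 * t₃) * d * ∑ (a i))
              + (- num 2 * (t₂ + num 2 * t₃) * R i i + - num 2 * (t₂ + num 2 * t₃) * d * ∑ (a j)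
              + - num 2 * (t₂ + num 2 * t₃) * R j j + - num 4 * t₃ * R i j)
              ≡⟨ zeros (∑R i) (∑R j) (a-row i) (a-row j) ⟩
            (num 2 * (t₂ + t₃) * S₂ + num 2 * t₃ * 0ℚ + num 2 * t₃ * 0ℚ + - num 2 * (t₂ + num 2 * t₃) * d * 0ℚ)
              + (- num 2 * (t₂ + num 2 * t₃) * R i i + - num 2 * (t₂ + num 2 * t₃) * d * 0ℚ
              + - num 2 * (t₂ + num 2 * t₃) * R j j + - num 4 * t₃ * R i j)
              ≡⟨ solve 7 (λ t₂ t₃ d S ii jj ij → (:# 2 :* (t₂ :+ t₃) :* S :+ :# 2 :* t₃ :* :0 :+ :# 2 :* t₃ :*
                :0 :+ :- :# 2 :* (t₂ :+ :# 2 :* t₃) :* d :* :0) :+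
                (:- :# 2 :* (t₂ :+ :# 2 :* t₃) :* ii :+ :- :# 2 :* (t₂ :+ :# 2 :* t₃) :* d :* :0 :+ :- :# 2 :*
                (t₂ :+ :# 2 :* t₃) :* jj :+ :- :# 4 :* t₃ :* ij) := :# 2 :* (t₂ :+ t₃) :* S :+ :- :# 2 :*
                (t₂ :+ :# 2 :* t₃) :* (ii :+ jj) :+ :- :# 4 :* t₃ :* ij) refl t₂ t₃ d S₂ (R i i) (R j j)
                (R i j) ⟩
            num 2 * (t₂ + t₃) * S₂ + - num 2 * (t₂ + num 2 * t₃) * (R i i + R j j) + - num 4 * t₃ * R i j ∎
            where
            open ≡-Reasoning
            K₁ K₂ : Fin N → ℚ
            K₁ r = num 2 * (t₂ + t₃) * R r r + num 2 * t₃ * R r i + num 2 * t₃ * R r j + - num 2 *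
              (t₂ + num 2 * t₃) * d * a i r
            K₂ r = - num 2 * (t₂ + num 2 * t₃) * (a i r * a i r) + - num 2 * (t₂ + num 2 * t₃) * d * a j r
              + - num 2 * (t₂ + num 2 * t₃) * (a j r * a j r) + - num 4 * t₃ * (a i r * a j r)
            zeros : ∀ {p q r s p′ q′ r′ s′ : ℚ} → p ≡ p′ → q ≡ q′ → r ≡ r′ → s ≡ s′ →
              (num 2 * (t₂ + t₃) * S₂ + num 2 * t₃ * p + num 2 * t₃ * q + - num 2 * (t₂ + num 2 * t₃) * d * r)
              + (- num 2 * (t₂ + num 2 * t₃) * R i i + - num 2 * (t₂ + num 2 * t₃) * d * s
              + - num 2 * (t₂ + num 2 * t₃) * R j j + - num 4 * t₃ * R i j) ≡
              (num 2 * (t₂ + t₃) * S₂ + num 2 * t₃ * p′ + num 2 * t₃ * q′ + - num 2 * (t₂ + num 2 * t₃) * d *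
                r′)
              + (- num 2 * (t₂ + num 2 * t₃) * R i i + - num 2 * (t₂ + num 2 * t₃) * d * s′
              + - num 2 * (t₂ + num 2 * t₃) * R j j + - num 4 * t₃ * R i j)
            zeros refl refl refl refl = refl

          K-cong : ∀ {rr ri rj b e rr′ ri′ rj′ b′ e′ : ℚ} → rr ≡ rr′ → ri ≡ ri′ → rj ≡ rj′ → b ≡ b′ → e ≡ e′ →
            (num 2 * (t₂ + t₃) * rr + num 2 * t₃ * ri + num 2 * t₃ * rj + - num 2 * (t₂ + num 2 * t₃) * d * b)
            + (- num 2 * (t₂ + num 2 * t₃) * (b * b) + - num 2 * (t₂ + num 2 * t₃) * d * e
            + - num 2 * (t₂ + num 2 * t₃) * (e * e) + - num 4 * t₃ * (b * e)) ≡
            (num 2 * (t₂ + t₃) * rr′ + num 2 * t₃ * ri′ + num 2 * t₃ * rj′ + - num 2 * (t₂ + num 2 * t₃) * d *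
              b′)
            + (- num 2 * (t₂ + num 2 * t₃) * (b′ * b′) + - num 2 * (t₂ + num 2 * t₃) * d * e′
            + - num 2 * (t₂ + num 2 * t₃) * (e′ * e′) + - num 4 * t₃ * (b′ * e′))
          K-cong refl refl refl refl refl = refl

        -- One factor `Q` is split: the two ends of {i , j} give `2 a i j` times `∑xQ`, and each
        -- uncovered `r` gives `K r`.
        ∑xQQ : ∑[ v ] (x i j v * (Q v * Q v)) ≡
          num 4 * (t₁ + num 3 * t₂ + num 4 * t₃) * (a i j * a i j) + num 2 * (t₂ + t₃) * S₂
          - num 4 * (t₂ + num 2 * t₃) * (R i i + R j j) - num 8 * t₃ * R i j
        ∑xQQ = begin
          ∑[ v ] (x i j v * (Q v * Q v))
            ≡⟨ ∑-cong (λ v → solve 2 (λ x Q → x :* (Q :* Q) := x :* :1 :* Q :* Q) refl (x i j v) (Q v)) ⟩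
          ∑[ v ] (X L v * Q v * Q v)
            ≡⟨ ∑-X*Q unique-L Q ⟩
          (num 2 * d + 0ℚ) * ∑[ v ] (X L v * Q v) + ∑[ r ] (outsideOf (supp L) r * ∑[ v ] (X L v * y r v * Q v))
            ≡⟨ cong₂ (λ p q → (num 2 * d + 0ℚ) * p + q)
                 (trans (∑-cong λ v → cong (_* Q v) (ℚ.*-identityʳ (x i j v))) (∑xQ i≢j))
                 (trans (outside-cong {supp L} ∑xyQ) (∑-vanish unique-L K)) ⟩
          (num 2 * d + 0ℚ) * (num 2 * (t₁ + t₂) * d) + (∑ K - (K i + (K j + 0ℚ)))
            ≡⟨ cong (λ z → (num 2 * d + 0ℚ) * (num 2 * (t₁ + t₂) * d) + z)
              (cong₂ _-_ ∑K (cong₂ (λ p q → p + (q + 0ℚ))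
                 (K-cong (refl {x = R i i}) (refl {x = R i i}) (refl {x = R i j}) (a-diag i) (a-sym j i))
                   (K-cong (refl {x = R j j}) (R-sym j i) (refl {x = R j j}) (refl {x = d}) (a-diag j)))) ⟩
          (num 2 * d + 0ℚ) * (num 2 * (t₁ + t₂) * d) +
            ((num 2 * (t₂ + t₃) * S₂ + - num 2 * (t₂ + num 2 * t₃) * (R i i + R j j) + - num 4 * t₃ * R i j) -
            (((num 2 * (t₂ + t₃) * R i i + num 2 * t₃ * R i i + num 2 * t₃ * R i j + - num 2 *
              (t₂ + num 2 * t₃) * d * 0ℚ)
            + (- num 2 * (t₂ + num 2 * t₃) * (0ℚ * 0ℚ) + - num 2 * (t₂ + num 2 * t₃) * d * d
            + - num 2 * (t₂ + num 2 * t₃) * (d * d) + - num 4 * t₃ * (0ℚ * d))) +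
            (((num 2 * (t₂ + t₃) * R j j + num 2 * t₃ * R i j + num 2 * t₃ * R j j + - num 2 *
              (t₂ + num 2 * t₃) * d * d)
            + (- num 2 * (t₂ + num 2 * t₃) * (d * d) + - num 2 * (t₂ + num 2 * t₃) * d * 0ℚ
            + - num 2 * (t₂ + num 2 * t₃) * (0ℚ * 0ℚ) + - num 4 * t₃ * (d * 0ℚ))) + 0ℚ)))
            ≡⟨ solve 8 (λ t₁ t₂ t₃ d S ii jj ij → (:# 2 :* d :+ :0) :* (:# 2 :* (t₁ :+ t₂) :* d) :+
              ((:# 2 :* (t₂ :+ t₃) :* S :+ :- :# 2 :* (t₂ :+ :# 2 :* t₃) :* (ii :+ jj) :+ :- :# 4 :* t₃ :* ij)
              :- (((:# 2 :* (t₂ :+ t₃) :* ii :+ :# 2 :* t₃ :* ii :+ :# 2 :* t₃ :* ij :+ :- :# 2 :*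
              (t₂ :+ :# 2 :* t₃) :* d :* :0) :+ (:- :# 2 :* (t₂ :+ :# 2 :* t₃) :* (:0 :* :0) :+ :- :# 2 :*
              (t₂ :+ :# 2 :* t₃) :* d :* d :+ :- :# 2 :* (t₂ :+ :# 2 :* t₃) :* (d :* d) :+ :- :# 4 :* t₃ :*
              (:0 :* d))) :+ (((:# 2 :* (t₂ :+ t₃) :* jj :+ :# 2 :* t₃ :* ij :+ :# 2 :* t₃ :* jj :+ :- :# 2 :*
              (t₂ :+ :# 2 :* t₃) :* d :* d) :+ (:- :# 2 :* (t₂ :+ :# 2 :* t₃) :* (d :* d) :+ :- :# 2 :*
              (t₂ :+ :# 2 :* t₃) :* d :* :0 :+ :- :# 2 :* (t₂ :+ :# 2 :* t₃) :* (:0 :* :0) :+ :- :# 4 :* t₃ :*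
              (d :* :0))) :+ :0))) := :# 4 :* (t₁ :+ :# 3 :* t₂ :+ :# 4 :* t₃) :* (d :* d) :+ :# 2 :*
              (t₂ :+ t₃) :* S :- :# 4 :* (t₂ :+ :# 2 :* t₃) :* (ii :+ jj) :- :# 8 :* t₃ :* ij) refl t₁ t₂ t₃ d
              S₂ (R i i) (R j j) (R i j) ⟩
          num 4 * (t₁ + num 3 * t₂ + num 4 * t₃) * (d * d) + num 2 * (t₂ + t₃) * S₂
            - num 4 * (t₂ + num 2 * t₃) * (R i i + R j j) - num 8 * t₃ * R i j ∎
          where
          open ≡-Reasoning

      -- In `∑xQQ` the terms `S₂`, `R i i` and `R j j` depend on at most one of `i` and `j`. After
      -- multiplication by `a i j` they cancel, since rows and columns sum to zero.
      ∑QQQ : ∑[ v ] (Q v * (Q v * Q v)) ≡ num 4 * (t₁ + num 3 * t₂ + num 4 * t₃) * S₃ - num 8 * t₃ * T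
      ∑QQQ = begin
        ∑[ v ] (Q v * (Q v * Q v))
          ≡⟨ ∑-Q* (λ v → Q v * Q v) ⟩
        ∑[ i ] ∑[ j ] (a i j * ∑[ v ] (x i j v * (Q v * Q v)))
          ≡⟨ ∑-cong (λ i → trans (∑-cong λ j → trans (off-diagonal ∑xQQ i j)
            (solve 8 (λ c₁ c₂ c₃ c₄ a ii jj ij → a :* (c₁ :* (a :* a) :+ c₂ :- c₃ :* (ii :+ jj) :- c₄ :* ij)
              := c₁ :* (a :* (a :* a)) :+ (c₂ :- c₃ :* ii) :* a :+ :- c₃ :* (a :* jj) :+ :- c₄ :* (a :* ij))
              refl (c₁) (c₂) c₃ (num 8 * t₃) (a i j) (R i i) (R j j) (R i j)))
               (trans (∑-lin₄ c₁ (λ j → a i j * (a i j * a i j)) (c₂ - c₃ * R i i) (a i) (- c₃)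
                 (λ j → a i j * R j j) (- (num 8 * t₃)) (λ j → a i j * R i j))
                 (trans (cong (λ z → c₁ * ∑[ j ] (a i j * (a i j * a i j)) + (c₂ - c₃ * R i i) * z + - c₃ * ∑[
                   j ] (a i j * R j j) + - (num 8 * t₃) * ∑[ j ] (a i j * R i j)) (a-row i))
                   (solve 4 (λ p q r s → p :+ q :* :0 :+ r :+ s := p :+ r :+ s) refl
                     (c₁ * ∑[ j ] (a i j * (a i j * a i j))) (c₂ - c₃ * R i i) (- c₃ * ∑[ j ] (a i j * R j j))
                     (- (num 8 * t₃) * ∑[ j ] (a i j * R i j)))))) ⟩
        ∑[ i ] (c₁ * ∑[ j ] (a i j * (a i j * a i j)) + - c₃ * ∑[ j ] (a i j * R j j) + - (num 8 * t₃) * ∑[ j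
          ] (a i j * R i j))
          ≡⟨ ∑-lin₃ c₁ (λ i → ∑[ j ] (a i j * (a i j * a i j))) (- c₃) (λ i → ∑[ j ] (a i j * R j j))
            (- (num 8 * t₃)) (λ i → ∑[ j ] (a i j * R i j)) ⟩
        c₁ * S₃ + - c₃ * ∑[ i ] ∑[ j ] (a i j * R j j) + - (num 8 * t₃) * T
          ≡⟨ cong (λ z → c₁ * S₃ + - c₃ * z + - (num 8 * t₃) * T)
            (trans (∑-comm (λ i j → a i j * R j j)) (∑-zero λ j →
               trans (∑-*ʳ (R j j) (λ i → a i j)) (trans (cong (_* R j j) (a-col j)) (ℚ.*-zeroˡ (R j j))))) ⟩
        c₁ * S₃ + - c₃ * 0ℚ + - (num 8 * t₃) * T
          ≡⟨ solve 4 (λ p c₃ c₄ T → p :+ :- c₃ :* :0 :+ :- c₄ :* T := p :- c₄ :* T) refl (c₁ * S₃) c₃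
            (num 8 * t₃) T ⟩
        c₁ * S₃ - num 8 * t₃ * T ∎
        where
        open ≡-Reasoning
        c₁ c₂ c₃ : ℚ
        c₁ = num 4 * (t₁ + num 3 * t₂ + num 4 * t₃)
        c₂ = num 2 * (t₂ + t₃) * S₂
        c₃ = num 4 * (t₂ + num 2 * t₃)

  0<# : ∀ {k} → 0 ℕ.< k → 0ℚ < # k
  0<# {suc k} _ = 0<#suc k

  oddFactorial>0 : ∀ m → 0 ℕ.< oddFactorial m
  oddFactorial>0 zero = ℕ.s≤s ℕ.z≤n
  oddFactorial>0 (suc m) = ℕ.*-mono-≤ {1} {2n-1[ suc m ]} {1} (ℕ.s≤s ℕ.z≤n) (oddFactorial>0 m)

  inverse : ∀ {q} → 0ℚ < q → ∃ λ r → r * q ≡ 1ℚ × 0ℚ < r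
  inverse {q} 0<q = ℚ.1/ q , ℚ.*-inverseˡ q , ℚ.positive⁻¹ (ℚ.1/ q) {{ℚ.1/pos⇒pos q}}
    where
    instance
      q⁺ : ℚ.Positive q
      q⁺ = ℚ.positive 0<q
      q≢0 : ℚ.NonZero q
      q≢0 = ℚ.pos⇒nonZero q

  #-suc^ : ∀ k l → # (k ℕ.+ l) ≡ # l + num k
  #-suc^ k l = trans (#-+ k l) (trans (cong (_+ # l) (#≡num k)) (ℚ.+-comm (num k) (# l)))

  -- The second moment equals `D` up to `W` and `θ D`, and the third moment is at least `D` up to
  -- similar errors. Their leading terms are `½ β t₁ S₂` and `½ β³ t₁ S₃`, so the comparison bounds
  -- `S₂ - S₃`. The quantities are bare rationals here, which keeps the polynomial identities free
  -- of sums.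
  third-moment-bound : ∀ h t₃ c η θ β S₂ S₃ T N →
    1ℚ ≤ h → 0ℚ < t₃ → 0ℚ ≤ c → 0ℚ ≤ η → 0ℚ ≤ θ → num 3 ≤ num 4 * β → β ≤ 1ℚ → 0ℚ ≤ S₂ → S₃ ≤ S₂ → - T ≤ N *
      S₂ → 0ℚ ≤ N →
    let t₂ = h * t₃; t₁ = (h + num 2) * t₂; D = c * t₁; W = η * D in
    ½ * β * t₁ * S₂ ≡ D - W - θ * D →
    D - (num 3 + c) * W ≤ num 3 * θ * (D - W) - num 2 * (θ * θ * D) + β * β * β *
      (½ * (t₁ + num 3 * t₂ + num 4 * t₃) * S₃ - t₃ * T) →
    (h + num 2) * h * (S₂ - S₃) ≤ num 8 * c *
      ((h + num 2) * h * ((num 2 + c) * η + num 2 * θ) + num 3 * h + num 4 + num 2 * N)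
  third-moment-bound h t₃ c η θ β S₂ S₃ T N 1≤h 0<t₃ 0≤c 0≤η 0≤θ ¾≤β β≤1 0≤S₂ S₃≤S₂ -T≤ 0≤N S₂≡ third =
    cancelˡ-≤ 0<t₃ (ℚ.≤-trans step₁ step₂)
    where
    0≤t₃ : 0ℚ ≤ t₃
    0≤t₃ = ℚ.<⇒≤ 0<t₃
    0≤h : 0ℚ ≤ h
    0≤h = ℚ.≤-trans (ℚ.nonNegative⁻¹ 1ℚ) 1≤h
    0≤½ : 0ℚ ≤ ½
    0≤½ = ℚ.nonNegative⁻¹ ½
    0≤β : 0ℚ ≤ β
    0≤β = cancelˡ-≤ {num 4} (ℚ.positive⁻¹ (num 4))
      (ℚ.≤-trans (ℚ.≤-reflexive (ℚ.*-zeroʳ (num 4))) (ℚ.≤-trans (num≥0 3) ¾≤β))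
    t₁ t₂ D W E : ℚ
    t₂ = h * t₃
    t₁ = (h + num 2) * t₂
    D = c * t₁
    W = η * D
    E = S₂ - S₃
    0≤t₂ : 0ℚ ≤ t₂
    0≤t₂ = 0≤h ⊗ 0≤t₃
    0≤t₁ : 0ℚ ≤ t₁
    0≤t₁ = (0≤h ⊕ num≥0 2) ⊗ 0≤t₂
    0≤D : 0ℚ ≤ D
    0≤D = 0≤c ⊗ 0≤t₁
    0≤W : 0ℚ ≤ W
    0≤W = 0≤η ⊗ 0≤D
    0≤E : 0ℚ ≤ E
    0≤E = gap S₃≤S₂
    0≤1-β² : 0ℚ ≤ 1ℚ - β * β
    0≤1-β² = subst (0ℚ ≤_) (solve 1 (λ β → (:1 :- β) :* (:1 :+ β) := :1 :- β :* β) refl β)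
      (gap β≤1 ⊗ (num≥0 1 ⊕ 0≤β))
    -- From `β ≥ ¾` follows `4 β³ ≥ 27/16`, so `8` times the leading coefficient `½ β³` is at least
    -- one.
    0≤4β³-1 : 0ℚ ≤ num 4 * (β * β * β) - 1ℚ
    0≤4β³-1 = cancelˡ-≤ {num 16} (ℚ.positive⁻¹ (num 16)) (certify
      (num≥0 11 ⊕ gap ¾≤β ⊗ (num≥0 9 ⊕ num≥0 12 ⊗ 0≤β ⊕ num≥0 16 ⊗ 0≤β ⊗ 0≤β))
        (solve 1 (λ β → :# 16 :* (:# 4 :* (β :* β :* β) :- :1) :- :# 16 :* :0 := :# 11 :+ (:# 4 :* β :- :# 3)
          :* (:# 9 :+ :# 12 :* β :+ :# 16 :* β :* β)) refl β))
    S₂-bound : ½ * β * t₁ * S₂ ≤ D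
    S₂-bound = certify (0≤W ⊕ 0≤θ ⊗ 0≤D) (trans (cong (λ z → D - z) S₂≡)
        (solve 3 (λ D W θD → D :- (D :- W :- θD) := W :+ θD) refl D W (θ * D)))
    0<t₁ : 0ℚ < t₁
    0<t₁ = ℚ.<-≤-trans 0<t₃ (certify (gap 1≤h ⊗ 0≤t₃ ⊗ (0≤h ⊕ num≥0 3) ⊕ num≥0 2 ⊗ 0≤t₃)
        (solve 2 (λ h t → (h :+ :# 2) :* (h :* t) :- t := (h :- :1) :* t :* (h :+ :# 3) :+ :# 2 :* t) refl h
          t₃))
    small : β * S₂ ≤ num 2 * c
    small = cancelˡ-≤ 0<t₁ (certify (num≥0 2 ⊗ gap S₂-bound)
        (solve 4 (λ t c β S → t :* (:# 2 :* c) :- t :* (β :* S) := :# 2 :* (c :* t :- :½ :* β :* t :* S)) refl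
          t₁ c β S₂))
    Y : ℚ
    Y = ½ * (num 3 * t₂ + num 4 * t₃) + t₃ * N
    -- `D` in `third` is rewritten by `S₂≡`. Since `β³ ≤ β`, what remains on the left is at least
    -- `½ β³ t₁ (S₂ - S₃)`; everything is then multiplied by 8, and `Y` collects the lower-order
    -- terms.
    step₁ : t₃ * ((h + num 2) * h * E) ≤ num 8 * ((num 2 + c) * W + num 2 * θ * D + β * S₂ * Y)
    step₁ = ℚ.≤-trans (ℚ.≤-reflexive
        (solve 3 (λ t h E → t :* ((h :+ :# 2) :* h :* E) := (h :+ :# 2) :* (h :* t) :* E) refl t₃ h E)) (certify
      (num≥0 8 ⊗ gap third
        ⊕ num≥0 24 ⊗ (0≤θ ⊗ 0≤W)
        ⊕ num≥0 16 ⊗ (0≤θ ⊗ 0≤θ ⊗ 0≤D)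
        ⊕ num≥0 8 ⊗ (0≤β³ ⊗ 0≤t₃ ⊗ gap -T≤)
        ⊕ 0≤4β³-1 ⊗ 0≤t₁ ⊗ 0≤E
        ⊕ num≥0 4 ⊗ 0≤β³ ⊗ (num≥0 3 ⊗ 0≤t₂ ⊕ num≥0 4 ⊗ 0≤t₃) ⊗ 0≤E
        ⊕ 0≤S₂ ⊗ 0≤β ⊗ 0≤1-β² ⊗ (num≥0 4 ⊗ 0≤t₁ ⊕ num≥0 12 ⊗ 0≤t₂ ⊕ num≥0 16 ⊗ 0≤t₃ ⊕ num≥0 8 ⊗ 0≤t₃ ⊗ 0≤N)
        ⊕ num≥0 8 ⊗ gap (ℚ.≤-reflexive S₂≡))
        (solve 12 (λ θ c W D β S₂ S₃ T N t₁ t₂ t₃ → :# 8 :*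
          ((:# 2 :+ c) :* W :+ :# 2 :* θ :* D :+ β :* S₂ :* (:½ :* (:# 3 :* t₂ :+ :# 4 :* t₃) :+ t₃ :* N)) :-
          t₁ :* (S₂ :- S₃) := :# 8 :* (:# 3 :* θ :* (D :- W) :- :# 2 :* (θ :* θ :* D) :+ β :* β :* β :*
          (:½ :* (t₁ :+ :# 3 :* t₂ :+ :# 4 :* t₃) :* S₃ :- t₃ :* T) :- (D :- (:# 3 :+ c) :* W)) :+ :# 24 :*
          (θ :* W) :+ :# 16 :* (θ :* θ :* D) :+ :# 8 :* (β :* β :* β :* t₃ :* (N :* S₂ :- :- T)) :+
          (:# 4 :* (β :* β :* β) :- :1) :* t₁ :* (S₂ :- S₃) :+ :# 4 :* (β :* β :* β) :*
          (:# 3 :* t₂ :+ :# 4 :* t₃) :* (S₂ :- S₃) :+ S₂ :* β :* (:1 :- β :* β) :*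
          (:# 4 :* t₁ :+ :# 12 :* t₂ :+ :# 16 :* t₃ :+ :# 8 :* t₃ :* N) :+ :# 8 :*
          (D :- W :- θ :* D :- :½ :* β :* t₁ :* S₂)) refl θ c W D β S₂ S₃ T N t₁ t₂ t₃))
      where
      0≤β³ : 0ℚ ≤ β * β * β
      0≤β³ = 0≤β ⊗ 0≤β ⊗ 0≤β
    step₂ : num 8 * ((num 2 + c) * W + num 2 * θ * D + β * S₂ * Y) ≤ t₃ *
      (num 8 * c * ((h + num 2) * h * ((num 2 + c) * η + num 2 * θ) + num 3 * h + num 4 + num 2 * N))
    step₂ = certify (num≥0 8 ⊗ gap small ⊗ (0≤½ ⊗ (num≥0 3 ⊗ 0≤t₂ ⊕ num≥0 4 ⊗ 0≤t₃) ⊕ 0≤t₃ ⊗ 0≤N))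
        (solve 8 (λ h t₃ c η θ β S₂ N → t₃ :*
          (:# 8 :* c :* ((h :+ :# 2) :* h :* ((:# 2 :+ c) :* η :+ :# 2 :* θ) :+ :# 3 :* h :+ :# 4 :+ :# 2 :*
          N)) :- :# 8 :* ((:# 2 :+ c) :* (η :* (c :* ((h :+ :# 2) :* (h :* t₃)))) :+ :# 2 :* θ :*
          (c :* ((h :+ :# 2) :* (h :* t₃))) :+ β :* S₂ :*
          (:½ :* (:# 3 :* (h :* t₃) :+ :# 4 :* t₃) :+ t₃ :* N)) := :# 8 :* (:# 2 :* c :- β :* S₂) :*
          (:½ :* (:# 3 :* (h :* t₃) :+ :# 4 :* t₃) :+ t₃ :* N)) refl h t₃ c η θ β S₂ N)

  -- Entries above ½

  opaque
    indicator : ∀ {P : Set} → Dec P → ℚ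
    indicator P? = if does P? then 1ℚ else 0ℚ

    indicator-yes : ∀ {P : Set} (P? : Dec P) → P → indicator P? ≡ 1ℚ
    indicator-yes (yes _) _ = refl
    indicator-yes (no ¬p) p = ⊥-elim (¬p p)

    indicator-no : ∀ {P : Set} (P? : Dec P) → ¬ P → indicator P? ≡ 0ℚ
    indicator-no (yes p) ¬p = ⊥-elim (¬p p)
    indicator-no (no _) _ = refl

  ∑ˡ-++ : ∀ {A : Set} (xs ys : List A) (F : A → ℚ) → ∑ˡ (xs ++ ys) F ≡ ∑ˡ xs F + ∑ˡ ys F
  ∑ˡ-++ [] ys F = sym (ℚ.+-identityˡ (∑ˡ ys F))
  ∑ˡ-++ (x ∷ xs) ys F = trans (cong (λ t → F x + t) (∑ˡ-++ xs ys F)) (sym (ℚ.+-assoc (F x) (∑ˡ xs F) (∑ˡ ys F)))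

  ∑ˡ-map : ∀ {A B : Set} (g : A → B) (xs : List A) (F : B → ℚ) → ∑ˡ (map g xs) F ≡ ∑ˡ xs (F ∘ g)
  ∑ˡ-map g [] F = refl
  ∑ˡ-map g (x ∷ xs) F = cong (λ t → F (g x) + t) (∑ˡ-map g xs F)

  ∑ˡ-cartesianProduct : ∀ {A B : Set} (xs : List A) (ys : List B) (F : A × B → ℚ) →
    ∑ˡ (cartesianProduct xs ys) F ≡ ∑ˡ xs (λ x → ∑ˡ ys (λ y → F (x , y)))
  ∑ˡ-cartesianProduct [] ys F = refl
  ∑ˡ-cartesianProduct (x ∷ xs) ys F = trans (∑ˡ-++ (map (x ,_) ys) (cartesianProduct xs ys) F)
    (cong₂ _+_ (∑ˡ-map (x ,_) ys F) (∑ˡ-cartesianProduct xs ys F))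

  ∑ˡ-tabulate : ∀ {A : Set} {k} (g : Fin k → A) (F : A → ℚ) → ∑ˡ (List.tabulate g) F ≡ ∑ (F ∘ g)
  ∑ˡ-tabulate {k = zero} g F = sym (∑-nil (F ∘ g))
  ∑ˡ-tabulate {k = suc k} g F = trans (cong (λ t → F (g zero) + t) (∑ˡ-tabulate (g ∘ suc) F))
    (sym (∑-cons (F ∘ g)))

  ∑ˡ-filter : ∀ {A : Set} {P : A → Set} (P? : ∀ x → Dec (P x)) (xs : List A) (F : A → ℚ) →
    ∑ˡ (filter P? xs) F ≡ ∑ˡ xs (λ x → indicator (P? x) * F x)
  ∑ˡ-filter P? [] F = refl
  ∑ˡ-filter P? (x ∷ xs) F with P? x
  ... | yes p = cong₂ _+_ (sym (trans (cong (_* F x) (indicator-yes (yes p) p)) (ℚ.*-identityˡ (F x))))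
    (∑ˡ-filter P? xs F)
  ... | no ¬p = trans (∑ˡ-filter P? xs F)
    (trans (sym (ℚ.+-identityˡ _)) (cong (λ t → t + ∑ˡ xs (λ x → indicator (P? x) * F x))
    (sym (trans (cong (_* F x) (indicator-no (no ¬p) ¬p)) (ℚ.*-zeroˡ (F x))))))

  ∑ˡ-1 : ∀ {A : Set} (xs : List A) → ∑ˡ xs (λ _ → 1ℚ) ≡ # (length xs)
  ∑ˡ-1 [] = sym (#≡num 0)
  ∑ˡ-1 (x ∷ xs) = trans (cong (λ t → 1ℚ + t) (∑ˡ-1 xs)) (sym (#-suc (length xs)))

  ∑ˡ-mono : ∀ {A : Set} {F G : A → ℚ} (xs : List A) → (∀ {x} → x ∈ xs → F x ≤ G x) → ∑ˡ xs F ≤ ∑ˡ xs G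
  ∑ˡ-mono [] h = ℚ.≤-refl
  ∑ˡ-mono (x ∷ xs) h = ℚ.+-mono-≤ (h (here refl)) (∑ˡ-mono xs (λ x∈ → h (there x∈)))

  module _ {N : ℕ} where
    lt : Fin N → Fin N → ℚ
    lt i j = indicator (i Fin.<? j)

    halve : ∀ (G : Fin N → Fin N → ℚ) → (∀ i j → G i j ≡ G j i) → (∀ i → G i i ≡ 0ℚ) → ∑[ i ] ∑[ j ] G i j ≡
      num 2 * ∑[ i ] ∑[ j ] (lt i j * G i j)
    halve G G-sym G-diag = trans (∑-cong λ i → trans (∑-cong λ j → pointwise i j)
      (∑-+ (λ j → lt i j * G i j) (λ j → lt j i * G j i)))
      (trans (∑-+ (λ i → ∑[ j ] (lt i j * G i j)) (λ i → ∑[ j ] (lt j i * G j i)))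
        (trans (cong (λ t → ∑[ i ] ∑[ j ] (lt i j * G i j) + t) (∑-comm (λ i j → lt j i * G j i)))
          (solve 1 (λ s → s :+ s := :# 2 :* s) refl (∑[ i ] ∑[ j ] (lt i j * G i j)))))
      where
      lt-yes : ∀ {i j} → i Fin.< j → lt i j ≡ 1ℚ
      lt-yes {i} {j} = indicator-yes (i Fin.<? j)
      lt-no : ∀ {i j} → ¬ i Fin.< j → lt i j ≡ 0ℚ
      lt-no {i} {j} = indicator-no (i Fin.<? j)
      pointwise : ∀ i j → G i j ≡ lt i j * G i j + lt j i * G j i
      pointwise i j with Fin.<-cmp i j
      ... | tri< i<j _ j≮i = trans (solve 1 (λ g → g := :1 :* g :+ :0 :* g) refl (G i j))
        (cong₂ _+_ (cong (_* G i j) (sym (lt-yes i<j))) (cong₂ _*_ (sym (lt-no j≮i)) (G-sym i j)))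
      ... | tri≈ _ refl _ = trans (G-diag i) (sym (trans (cong (λ z → lt i i * z + lt i i * z) (G-diag i))
          (solve 1 (λ b → b :* :0 :+ b :* :0 := :0) refl (lt i i))))
      ... | tri> i≮j _ j<i = trans (solve 1 (λ g → g := :0 :* g :+ :1 :* g) refl (G i j))
        (cong₂ _+_ (cong (_* G i j) (sym (lt-no i≮j))) (cong₂ _*_ (sym (lt-yes j<i)) (G-sym i j)))

  module LargeEntries {N : ℕ} (a : Fin N → Fin N → ℚ) (a-sym : ∀ i j → a i j ≡ a j i)
    (a-diag : ∀ i → a i i ≡ 0ℚ) (a≤1 : ∀ i j → a i j ≤ 1ℚ) where
    -- `g` is a²(1 - a), nonnegative as a ≤ 1 and small only where the entry is near 0 or 1.
    g sq : Fin N → Fin N → ℚ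
    g i j = a i j * a i j - a i j * (a i j * a i j)
    sq i j = a i j * a i j

    E S : ℚ
    E = ∑[ i ] ∑[ j ] g i j
    S = ∑[ i ] ∑[ j ] sq i j

    large? : (ij : Fin N × Fin N) → Dec (proj₁ ij Fin.< proj₂ ij × ½ < a (proj₁ ij) (proj₂ ij))
    large? (i , j) = (i Fin.<? j) ×-dec (½ ℚ.<? a i j)

    large : List (Fin N × Fin N)
    large = filter large? (cartesianProduct (allFin N) (allFin N))

    large-unique : Unique large
    large-unique = Unique.filter⁺ large? (Unique.cartesianProduct⁺ (Unique.allFin⁺ N) (Unique.allFin⁺ N))

    large-sound : ∀ {ij} → ij ∈ large → proj₁ ij Fin.< proj₂ ij × ½ < a (proj₁ ij) (proj₂ ij)
    large-sound ij∈ = proj₂ (∈-filter⁻ large? {xs = cartesianProduct (allFin N) (allFin N)} ij∈)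

    ∑-large : ∀ F → ∑ˡ large F ≡ ∑[ i ] ∑[ j ] (indicator (large? (i , j)) * F (i , j))
    ∑-large F = trans (∑ˡ-filter large? (cartesianProduct (allFin N) (allFin N)) F)
      (trans (∑ˡ-cartesianProduct (allFin N) (allFin N) (λ ij → indicator (large? ij) * F ij))
        (trans (∑ˡ-tabulate (λ i → i) (λ i → ∑ˡ (allFin N) (λ j → indicator (large? (i , j)) * F (i , j))))
          (∑-cong λ i → ∑ˡ-tabulate (λ j → j) (λ j → indicator (large? (i , j)) * F (i , j)))))

    g-sym : ∀ i j → g i j ≡ g j i
    g-sym i j = cong (λ z → z * z - z * (z * z)) (a-sym i j)

    sq-sym : ∀ i j → sq i j ≡ sq j i
    sq-sym i j = cong (λ z → z * z) (a-sym i j)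

    g-diag : ∀ i → g i i ≡ 0ℚ
    g-diag i = cong (λ z → z * z - z * (z * z)) (a-diag i)

    sq-diag : ∀ i → sq i i ≡ 0ℚ
    sq-diag i = cong (λ z → z * z) (a-diag i)

    0≤g : ∀ i j → 0ℚ ≤ g i j
    0≤g i j = ℚ.≤-trans (square≥0 (a i j) ⊗ gap (a≤1 i j)) (ℚ.≤-reflexive
        (solve 1 (λ a → a :* a :* (:1 :- a) := a :* a :- a :* (a :* a)) refl (a i j)))

    private
      0≤4a+2 : ∀ {a} → ½ < a → 0ℚ ≤ num 4 * a + num 2
      0≤4a+2 ½<a = num≥0 4 ⊗ ℚ.≤-trans (ℚ.nonNegative⁻¹ ½) (ℚ.<⇒≤ ½<a) ⊕ num≥0 2

      cases : ∀ i j → (½ < a i j × lt i j ≡ 1ℚ × indicator (large? (i , j)) ≡ 1ℚ) ⊎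
        (a i j ≤ ½ × lt i j ≡ 1ℚ × indicator (large? (i , j)) ≡ 0ℚ) ⊎
          (lt i j ≡ 0ℚ × indicator (large? (i , j)) ≡ 0ℚ)
      cases i j = by (i Fin.<? j) (½ ℚ.<? a i j)
        where
        by : Dec (i Fin.< j) → Dec (½ < a i j) → _
        by (yes i<j) (yes ½<a) = inj₁ (½<a , indicator-yes (i Fin.<? j) i<j , indicator-yes (large? (i , j))
          (i<j , ½<a))
        by (yes i<j) (no ½≮a) = inj₂ (inj₁ (ℚ.≮⇒≥ ½≮a , indicator-yes (i Fin.<? j) i<j , indicator-no
          (large? (i , j)) (λ q → ½≮a (proj₂ q))))
        by (no i≮j) _ = inj₂ (inj₂ (indicator-no (i Fin.<? j) i≮j , indicator-no (large? (i , j))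
          (λ q → i≮j (proj₁ q))))

      -- For a > ½ the factor 4a² exceeds one, so 1 - a ≤ 4a²(1 - a).
      deficit-pointwise : ∀ i j → indicator (large? (i , j)) * (1ℚ - a i j) ≤ num 4 * (lt i j * g i j)
      deficit-pointwise i j with cases i j
      ... | inj₁ (½<a , e , e′) = subst₂ (λ L I → I * (1ℚ - a i j) ≤ num 4 * (L * g i j)) (sym e) (sym e′)
        (certify (gap (a≤1 i j) ⊗ (gap (ℚ.<⇒≤ ½<a) ⊗ 0≤4a+2 ½<a))
          (solve 1 (λ a → :# 4 :* (:1 :* (a :* a :- a :* (a :* a))) :- :1 :* (:1 :- a) := (:1 :- a) :*
            ((a :- :½) :* (:# 4 :* a :+ :# 2))) refl (a i j)))
      ... | inj₂ (inj₁ (a≤½ , e , e′)) = subst₂ (λ L I → I * (1ℚ - a i j) ≤ num 4 * (L * g i j)) (sym e)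
        (sym e′) (certify (num≥0 4 ⊗ 0≤g i j)
          (solve 2 (λ g a → :# 4 :* (:1 :* g) :- :0 :* (:1 :- a) := :# 4 :* g) refl (g i j) (a i j)))
      ... | inj₂ (inj₂ (e , e′)) = subst₂ (λ L I → I * (1ℚ - a i j) ≤ num 4 * (L * g i j)) (sym e) (sym e′)
        (ℚ.≤-reflexive
          (solve 2 (λ g a → :0 :* (:1 :- a) := :# 4 :* (:0 :* g)) refl (g i j) (a i j)))

      -- An entry above ½ has square at most 1, and one up to ½ has a² ≤ 2a²(1 - a). Summed up, the
      -- number of large entries is at least `½ S - E`.
      square-pointwise : ∀ i j → lt i j * sq i j ≤ 1ℚ * (indicator (large? (i , j)) * 1ℚ) + num 2 *
        (lt i j * g i j)
      square-pointwise i j with cases i j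
      ... | inj₁ (½<a , e , e′) = subst₂ (λ L I → L * sq i j ≤ 1ℚ * (I * 1ℚ) + num 2 * (L * g i j)) (sym e)
        (sym e′) (certify (gap (a≤1 i j) ⊗ (num≥0 1 ⊕ ℚ.≤-trans (ℚ.nonNegative⁻¹ ½) (ℚ.<⇒≤ ½<a)) ⊕ num≥0 2 ⊗
        0≤g i j)
          (solve 1 (λ a → :1 :* (:1 :* :1) :+ :# 2 :* (:1 :* (a :* a :- a :* (a :* a))) :- :1 :* (a :* a) :=
            (:1 :- a) :* (:# 1 :+ a) :+ :# 2 :* (a :* a :- a :* (a :* a))) refl (a i j)))
      ... | inj₂ (inj₁ (a≤½ , e , e′)) = subst₂ (λ L I → L * sq i j ≤ 1ℚ * (I * 1ℚ) + num 2 * (L * g i j))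
        (sym e) (sym e′) (certify (square≥0 (a i j) ⊗ (num≥0 2 ⊗ gap (a≤½)))
          (solve 1 (λ a → :1 :* (:0 :* :1) :+ :# 2 :* (:1 :* (a :* a :- a :* (a :* a))) :- :1 :* (a :* a) := a
            :* a :* (:# 2 :* (:½ :- a))) refl (a i j)))
      ... | inj₂ (inj₂ (e , e′)) = subst₂ (λ L I → L * sq i j ≤ 1ℚ * (I * 1ℚ) + num 2 * (L * g i j)) (sym e)
        (sym e′) (ℚ.≤-reflexive
          (solve 2 (λ s g → :0 :* s := :1 :* (:0 :* :1) :+ :# 2 :* (:0 :* g)) refl (sq i j) (g i j)))

      -- A crude converse, 1 ≤ 4a² for a > ½. It keeps the number of stars of order c, which is
      -- needed before their overlaps can be estimated.
      count-pointwise : ∀ i j → indicator (large? (i , j)) * 1ℚ ≤ num 4 * (lt i j * sq i j)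
      count-pointwise i j with cases i j
      ... | inj₁ (½<a , e , e′) = subst₂ (λ L I → I * 1ℚ ≤ num 4 * (L * sq i j)) (sym e) (sym e′)
        (certify (gap (ℚ.<⇒≤ ½<a) ⊗ 0≤4a+2 ½<a)
          (solve 1 (λ a → :# 4 :* (:1 :* (a :* a)) :- :1 :* :1 := (a :- :½) :* (:# 4 :* a :+ :# 2)) refl
            (a i j)))
      ... | inj₂ (inj₁ (a≤½ , e , e′)) = subst₂ (λ L I → I * 1ℚ ≤ num 4 * (L * sq i j)) (sym e) (sym e′)
        (certify (num≥0 4 ⊗ square≥0 (a i j))
          (solve 1 (λ s → :# 4 :* (:1 :* s) :- :0 :* :1 := :# 4 :* s) refl (sq i j)))
      ... | inj₂ (inj₂ (e , e′)) = subst₂ (λ L I → I * 1ℚ ≤ num 4 * (L * sq i j)) (sym e) (sym e′)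
        (ℚ.≤-reflexive
          (solve 1 (λ s → :0 :* :1 := :# 4 :* (:0 :* s)) refl (sq i j)))

      ∑∑-* : ∀ c (F : Fin N → Fin N → ℚ) → ∑[ i ] ∑[ j ] (c * F i j) ≡ c * ∑[ i ] ∑[ j ] F i j
      ∑∑-* c F = trans (∑-cong λ i → ∑-* c (F i)) (∑-* c (λ i → ∑ (F i)))

      G S′ : ℚ
      G = ∑[ i ] ∑[ j ] (lt i j * g i j)
      S′ = ∑[ i ] ∑[ j ] (lt i j * sq i j)

      E≡ : E ≡ num 2 * G
      E≡ = halve g g-sym g-diag

      S≡ : S ≡ num 2 * S′
      S≡ = halve sq sq-sym sq-diag

    opaque
      large-deficit : ∑ˡ large (λ (i , j) → 1ℚ - a i j) ≤ num 2 * E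
      large-deficit = ℚ.≤-trans (ℚ.≤-reflexive (∑-large (λ (i , j) → 1ℚ - a i j)))
        (ℚ.≤-trans (∑-mono λ i → ∑-mono λ j → deficit-pointwise i j)
          (ℚ.≤-reflexive (trans (∑∑-* (num 4) (λ i j → lt i j * g i j)) (trans
            (solve 1 (λ s → :# 4 :* s := :# 2 :* (:# 2 :* s)) refl G) (cong (num 2 *_) (sym E≡))))))

      #large : # (length large) ≡ ∑[ i ] ∑[ j ] (indicator (large? (i , j)) * 1ℚ)
      #large = trans (sym (∑ˡ-1 large)) (∑-large (λ _ → 1ℚ))

      S≤ : S ≤ num 2 * # (length large) + num 2 * E
      S≤ = ℚ.≤-trans (ℚ.≤-reflexive S≡) (ℚ.≤-trans
        (monoˡ-≤ (num≥0 2) (∑-mono λ i → ∑-mono λ j → square-pointwise i j))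
        (ℚ.≤-reflexive (trans (cong (num 2 *_) (trans
            (∑-cong λ i → ∑-lin₂ 1ℚ (λ j → indicator (large? (i , j)) * 1ℚ) (num 2) (λ j → lt i j * g i j))
            (∑-lin₂ 1ℚ (λ i → ∑[ j ] (indicator (large? (i , j)) * 1ℚ)) (num 2)
              (λ i → ∑[ j ] (lt i j * g i j)))))
          (trans
            (solve 2 (λ m G → :# 2 :* (:1 :* m :+ :# 2 :* G) := :# 2 :* m :+ :# 2 :* (:# 2 :* G)) refl
              (∑[ i ] ∑[ j ] (indicator (large? (i , j)) * 1ℚ)) G)
              (cong₂ (λ p q → num 2 * p + num 2 * q) (sym #large) (sym E≡))))))

      #large≤ : # (length large) ≤ num 2 * S
      #large≤ = ℚ.≤-trans (ℚ.≤-reflexive #large) (ℚ.≤-trans (∑-mono λ i → ∑-mono λ j → count-pointwise i j)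
        (ℚ.≤-reflexive (trans (∑∑-* (num 4) (λ i j → lt i j * sq i j)) (trans
          (solve 1 (λ s → :# 4 :* s := :# 2 :* (:# 2 :* s)) refl S′) (cong (num 2 *_) (sym S≡))))))

  Ordered : ∀ {N} → Fin N × Fin N → Set
  Ordered (i , j) = i Fin.< j

  -- Constants for n ≥ 3, and unions of stars.

  module Stability (n m : ℕ) (n≡3+m : n ≡ suc (suc (suc m))) where
    open Moments n m n≡3+m public

    -- h = 2n-5, so that t₁ = (h + 2) h t₃ and N = h + 5.
    h τ β : ℚ
    h = # (suc (2 ℕ.* m))
    τ = ℤ.+ 1 / suc (4 ℕ.+ 2 ℕ.* m)
    β = (h + num 2) * (ℤ.+ 1 / suc (3 ℕ.+ 2 ℕ.* m))

    opaque
      0≤h : 0ℚ ≤ h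
      0≤h = 0≤# (suc (2 ℕ.* m))

      h₂ : # (suc (2 ℕ.* suc m)) ≡ h + num 2
      h₂ = trans (cong (λ t → # (suc t)) (ℕ.*-suc 2 m)) (#-suc^ 2 (suc (2 ℕ.* m)))

      h₄ : # (suc (2 ℕ.* suc (suc m))) ≡ h + num 4
      h₄ = trans (cong (λ t → # (suc t)) (trans (ℕ.*-suc 2 (suc m)) (cong (2 ℕ.+_) (ℕ.*-suc 2 m))))
        (#-suc^ 4 (suc (2 ℕ.* m)))

      #N : # N ≡ h + num 5
      #N = trans (cong (λ t → # (2 ℕ.* t)) n≡3+m)
        (trans (cong # (trans (ℕ.*-suc 2 (suc (suc m)))
          (cong (2 ℕ.+_) (trans (ℕ.*-suc 2 (suc m)) (cong (2 ℕ.+_) (ℕ.*-suc 2 m))))))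
          (#-suc^ 5 (suc (2 ℕ.* m))))

      t₂≡ : t₂ ≡ h * t₃
      t₂≡ = #-* (suc (2 ℕ.* m)) (oddFactorial m)

      t₁≡ : t₁ ≡ (h + num 2) * t₂
      t₁≡ = trans (#-* (suc (2 ℕ.* suc m)) (oddFactorial (suc m))) (cong (_* t₂) h₂)

      t₀≡ : ∑ {n = ∣V∣[ n ]} (λ _ → 1ℚ) ≡ (h + num 4) * t₁
      t₀≡ = trans (count (suc (suc (suc m))) [] [] (sym n≡3+m))
        (trans (#-* (suc (2 ℕ.* suc (suc m))) (oddFactorial (suc (suc m)))) (cong (_* t₁) h₄))

      0<t₁ : 0ℚ < t₁
      0<t₁ = 0<# (oddFactorial>0 (suc (suc m)))

      0<t₃ : 0ℚ < t₃
      0<t₃ = 0<# (oddFactorial>0 m)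

      τ≡ : τ * (h + num 4) ≡ 1ℚ
      τ≡ = trans (cong (τ *_) (sym (#-suc^ 4 (suc (2 ℕ.* m))))) (1/n*n≡1 (4 ℕ.+ 2 ℕ.* m))

      0≤τ : 0ℚ ≤ τ
      0≤τ = ℚ.<⇒≤ (0<1/suc (4 ℕ.+ 2 ℕ.* m))

      β≡ : β * (h + num 3) ≡ h + num 2
      β≡ = trans (ℚ.*-assoc (h + num 2) (ℤ.+ 1 / suc (3 ℕ.+ 2 ℕ.* m)) (h + num 3))
        (trans (cong (λ z → (h + num 2) * ((ℤ.+ 1 / suc (3 ℕ.+ 2 ℕ.* m)) * z)) (sym (#-suc^ 3 (suc (2 ℕ.* m)))))
          (trans (cong ((h + num 2) *_) (1/n*n≡1 (3 ℕ.+ 2 ℕ.* m))) (ℚ.*-identityʳ (h + num 2))))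

      0<3+h : 0ℚ < h + num 3
      0<3+h = subst (0ℚ <_) (#-suc^ 3 (suc (2 ℕ.* m))) (0<#suc (3 ℕ.+ 2 ℕ.* m))

      β≤1 : β ≤ 1ℚ
      β≤1 = cancelˡ-≤ 0<3+h (subst (_≤ (h + num 3) * 1ℚ) (trans (sym β≡) (ℚ.*-comm β (h + num 3)))
        (certify {h + num 2} {(h + num 3) * 1ℚ} {1ℚ} (ℚ.nonNegative⁻¹ 1ℚ)
          (solve 1 (λ h → (h :+ :# 3) :* :1 :- (h :+ :# 2) := :1) refl h)))

      ¾≤β : num 3 ≤ num 4 * β
      ¾≤β = cancelˡ-≤ 0<3+h (ℚ.≤-trans
        (certify {(h + num 3) * num 3} {num 4 * (h + num 2)} (gap 1≤h)
          (solve 1 (λ h → :# 4 :* (h :+ :# 2) :- (h :+ :# 3) :* :# 3 := h :- :1) refl h))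
        (ℚ.≤-reflexive (trans (cong (num 4 *_) (sym β≡))
          (solve 2 (λ β h → :# 4 :* (β :* h) := h :* (:# 4 :* β)) refl β (h + num 3)))))
        where
        1≤h : 1ℚ ≤ h
        1≤h = subst (_≤ h) (#≡num 1) (#-mono-≤ (ℕ.s≤s ℕ.z≤n))

      -- The equation that fixes `β`: with it, `½ β Q` has sum `t₁ a i j` over the star of {i , j},
      -- by `∑xQ`.
      β-t : β * (t₁ + t₂) ≡ t₁
      β-t = trans (cong (λ z → β * (z + t₂)) t₁≡) (trans
          (solve 3 (λ β h t → β :* ((h :+ :# 2) :* t :+ t) := β :* (h :+ :# 3) :* t) refl β h t₂)
            (trans (cong (_* t₂) β≡) (sym t₁≡)))

    opaque
      x-diag : ∀ i v → x i i v ≡ 0ℚ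
      x-diag i v = δ-≢ (mate≢ v i)

      x-sym : ∀ i j v → x i j v ≡ x j i v
      x-sym i j v = by (mate v i Fin.≟ j)
        where
        by : Dec (mate v i ≡ j) → x i j v ≡ x j i v
        by (yes refl) = trans (δ-refl (mate v i))
          (sym (trans (cong (λ t → δ t i) (mate-involutive v i)) (δ-refl i)))
        by (no ≢) = trans (δ-≢ ≢) (sym (δ-≢ λ e → ≢ (trans (cong (mate v) (sym e)) (mate-involutive v j))))

      0≤δ : ∀ {M} (i j : Fin M) → 0ℚ ≤ δ i j
      0≤δ i j = by (i Fin.≟ j)
        where
        by : Dec (i ≡ j) → 0ℚ ≤ δ i j
        by (yes refl) = subst (0ℚ ≤_) (sym (δ-refl i)) (ℚ.nonNegative⁻¹ 1ℚ)
        by (no ≢) = ℚ.≤-reflexive (sym (δ-≢ ≢))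

      ∑x : ∀ {i j} → i ≢ j → ∑ (x i j) ≡ t₁
      ∑x {i} {j} i≢j = trans (∑-cong λ v → sym (ℚ.*-identityʳ (x i j v)))
        (count (suc (suc m)) ((i , j) ∷ []) ((i≢j ∷ []) ∷ [] ∷ []) (sym n≡3+m))

    -- The indicator of a union of stars, written as a polynomial in their indicators so that it can
    -- enter ring identities.
    union : List (Fin N × Fin N) → V → ℚ
    union [] v = 0ℚ
    union ((i , j) ∷ P) v = x i j v + union P v - x i j v * union P v

    x-bool : ∀ i j v → x i j v ≡ 0ℚ ⊎ x i j v ≡ 1ℚ
    x-bool i j v = by (mate v i Fin.≟ j)
      where
      by : Dec (mate v i ≡ j) → x i j v ≡ 0ℚ ⊎ x i j v ≡ 1ℚ
      by (yes e) = inj₂ (trans (cong (λ k → δ k j) e) (δ-refl j))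
      by (no ≢) = inj₁ (δ-≢ ≢)

    union-bool : ∀ P v → union P v ≡ 0ℚ ⊎ union P v ≡ 1ℚ
    union-bool [] v = inj₁ refl
    union-bool ((i , j) ∷ P) v = by (x-bool i j v) (union-bool P v)
      where
      by : x i j v ≡ 0ℚ ⊎ x i j v ≡ 1ℚ → union P v ≡ 0ℚ ⊎ union P v ≡ 1ℚ → union ((i , j) ∷ P) v ≡ 0ℚ ⊎ union
        ((i , j) ∷ P) v ≡ 1ℚ
      by (inj₁ e) (inj₁ e′) = inj₁ (cong₂ (λ p q → p + q - p * q) e e′)
      by (inj₁ e) (inj₂ e′) = inj₂ (cong₂ (λ p q → p + q - p * q) e e′)
      by (inj₂ e) (inj₁ e′) = inj₂ (cong₂ (λ p q → p + q - p * q) e e′)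
      by (inj₂ e) (inj₂ e′) = inj₂ (cong₂ (λ p q → p + q - p * q) e e′)

    opaque
      0≤x : ∀ i j v → 0ℚ ≤ x i j v
      0≤x i j v = 0≤δ (mate v i) j

      0≤union : ∀ P v → 0ℚ ≤ union P v
      0≤union P v = by (union-bool P v)
        where
        by : union P v ≡ 0ℚ ⊎ union P v ≡ 1ℚ → 0ℚ ≤ union P v
        by (inj₁ e) = ℚ.≤-reflexive (sym e)
        by (inj₂ e) = subst (0ℚ ≤_) (sym e) (num≥0 1)

      union≤∑ : ∀ P v → union P v ≤ ∑ˡ P (λ (i , j) → x i j v)
      union≤∑ [] v = ℚ.≤-refl
      union≤∑ ((i , j) ∷ P) v = certify (gap (union≤∑ P v) ⊕ 0≤x i j v ⊗ 0≤union P v)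
          (solve 3 (λ x u s → (x :+ s) :- (x :+ u :- x :* u) := (s :- u) :+ x :* u) refl (x i j v) (union P v)
            (∑ˡ P (λ (i , j) → x i j v)))

      ∑ˡ-*ʳ : ∀ {A : Set} (F : A → ℚ) c (xs : List A) → ∑ˡ xs F * c ≡ ∑ˡ xs (λ x → F x * c)
      ∑ˡ-*ʳ F c [] = ℚ.*-zeroˡ c
      ∑ˡ-*ʳ F c (x ∷ xs) = trans (ℚ.*-distribʳ-+ c (F x) (∑ˡ xs F)) (cong (λ t → F x * c + t) (∑ˡ-*ʳ F c xs))

      ∑-union*≤ : ∀ P (w : V → ℚ) → (∀ v → 0ℚ ≤ w v) → ∑[ v ] (union P v * w v) ≤ ∑ˡ P
        (λ (i , j) → ∑[ v ] (x i j v * w v))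
      ∑-union*≤ P w 0≤w = ℚ.≤-trans (∑-mono λ v → ℚ.≤-trans
          (certify (gap (union≤∑ P v) ⊗ 0≤w v)
            (solve 3 (λ u s w → s :* w :- u :* w := (s :- u) :* w) refl (union P v)
            (∑ˡ P (λ (i , j) → x i j v)) (w v)))
          (ℚ.≤-reflexive (∑ˡ-*ʳ (λ (i , j) → x i j v) (w v) P)))
        (ℚ.≤-reflexive (∑-∑ˡ-comm (λ v (i , j) → x i j v * w v) P))

      0≤t₂ : 0ℚ ≤ t₂
      0≤t₂ = 0≤# _

      -- Two disjoint edges lie in exactly `t₂` common matchings. Two different edges sharing a
      -- vertex lie in none, since equal mates force them to coincide; in the crossed cases the
      -- ordering of the pairs gives the contradiction.
      codegree : ∀ {e e′} → Ordered e → Ordered e′ → e ≢ e′ →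
        ∑[ v ] (x (proj₁ e) (proj₂ e) v * x (proj₁ e′) (proj₂ e′) v) ≤ t₂
      codegree {i , j} {k , l} i<j k<l e≢e′ = by (i Fin.≟ k) (i Fin.≟ l) (j Fin.≟ k) (j Fin.≟ l)
        where
        L : List (Fin N × Fin N)
        L = (i , j) ∷ (k , l) ∷ []
        X≡ : ∀ v → x i j v * x k l v ≡ X L v
        X≡ v = cong (x i j v *_) (sym (ℚ.*-identityʳ (x k l v)))
        Bound : Set
        Bound = ∑[ v ] (x i j v * x k l v) ≤ t₂
        disjoint : (∀ v → mate v i ≡ j → mate v k ≡ l → ⊥) → Bound
        disjoint absurd = subst (_≤ t₂) (sym (∑-zero λ v → trans (X≡ v) (vanish v (X-cases v L)))) 0≤t₂
          where
          vanish : ∀ v → All (Matches v) L ⊎ X L v ≡ 0ℚ → X L v ≡ 0ℚ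
          vanish v (inj₁ (e ∷ e′ ∷ [])) = ⊥-elim (absurd v e e′)
          vanish v (inj₂ e) = e
        back : ∀ v {p q} → mate v p ≡ q → mate v q ≡ p
        back v {p} e = trans (cong (mate v) (sym e)) (mate-involutive v p)
        by : Dec (i ≡ k) → Dec (i ≡ l) → Dec (j ≡ k) → Dec (j ≡ l) → Bound
        by (yes i≡k) _ _ _ = disjoint λ v e e′ → e≢e′
          (cong₂ _,_ i≡k (trans (sym e) (trans (cong (mate v) i≡k) e′)))
        by (no _) (yes i≡l) _ _ = disjoint λ v e e′ → Fin.<-asym i<j
          (subst₂ Fin._<_ (trans (sym (back v e′)) (trans (cong (mate v) (sym i≡l)) e)) (sym i≡l) k<l)
        by (no _) (no _) (yes j≡k) _ = disjoint λ v e e′ → Fin.<-asym i<j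
          (subst₂ Fin._<_ (sym j≡k) (trans (sym e′) (trans (cong (mate v) (sym j≡k)) (back v e))) k<l)
        by (no i≢k) (no _) (no _) (yes j≡l) = disjoint λ v e e′ → i≢k
          (trans (sym (back v e)) (trans (cong (mate v) j≡l) (back v e′)))
        by (no i≢k) (no i≢l) (no j≢k) (no j≢l) = ℚ.≤-reflexive (trans (∑-cong X≡)
          (count (suc m) L ((Fin.<⇒≢ i<j ∷ i≢k ∷ i≢l ∷ []) ∷ (j≢k ∷ j≢l ∷ []) ∷ (Fin.<⇒≢ k<l ∷ []) ∷ [] ∷ [])
            (sym n≡3+m)))

      -- Bonferroni: a further star loses at most `t₂` to each of the l earlier ones. The simpler
      -- l²/2 replaces the binomial coefficient; its increment l + ½ leaves the spare `½ t₂`.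
      ∑-union≥ : ∀ P → Unique P → All Ordered P → # (length P) * t₁ - ½ * (# (length P) * # (length P)) * t₂ ≤
        ∑ (union P)
      ∑-union≥ [] _ _ = ℚ.≤-reflexive (trans (cong (λ z → z * t₁ - ½ * (z * z) * t₂) (#≡num 0)) (trans
          (solve 2 (λ t₁ t₂ → :0 :* t₁ :- :½ :* (:0 :* :0) :* t₂ := :0) refl t₁ t₂) (sym (∑-zero λ _ → refl))))
      ∑-union≥ ((i , j) ∷ P) (e∉ ∷ u) (i<j ∷ ord) = certify
        (gap (∑-union≥ P u ord) ⊕ gap doubled ⊕ ℚ.nonNegative⁻¹ ½ ⊗ 0≤t₂)
        (trans (cong₂ (λ q z → q - (z * t₁ - ½ * (z * z) * t₂)) expanded (#-suc (length P)))
            (solve 5 (λ l t₁ t₂ U X → (:1 :* t₁ :+ :1 :* U :+ :- :1 :* X) :-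
              ((:1 :+ l) :* t₁ :- :½ :* ((:1 :+ l) :* (:1 :+ l)) :* t₂) :=
              (U :- (l :* t₁ :- :½ :* (l :* l) :* t₂)) :+ (l :* t₂ :- X) :+ :½ :* t₂) refl (# (length P)) t₁
              t₂ (∑ (union P)) (∑[ v ] (union P v * x i j v))))
        where
        expanded : ∑ (union ((i , j) ∷ P)) ≡ 1ℚ * t₁ + 1ℚ * ∑ (union P) + - 1ℚ * ∑[ v ] (union P v * x i j v)
        expanded = trans (∑-cong λ v → solve 2
          (λ x u → x :+ u :- x :* u := :1 :* x :+ :1 :* u :+ :- :1 :* (u :* x)) refl (x i j v) (union P v))
          (trans (∑-lin₃ 1ℚ (x i j) 1ℚ (union P) (- 1ℚ) (λ v → union P v * x i j v))
          (cong (λ z → 1ℚ * z + 1ℚ * ∑ (union P) + - 1ℚ * ∑[ v ] (union P v * x i j v)) (∑x (Fin.<⇒≢ i<j))))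
        doubled : ∑[ v ] (union P v * x i j v) ≤ # (length P) * t₂
        doubled = ℚ.≤-trans (∑-union*≤ P (x i j) (0≤x i j)) (ℚ.≤-trans
          (∑ˡ-mono P λ {e} e∈ → codegree (All.lookup ord e∈) i<j λ e≡ → All.lookup e∉ e∈ (sym e≡))
          (ℚ.≤-reflexive (trans (trans (∑ˡ-cong P λ _ → sym (ℚ.*-identityˡ t₂)) (sym (∑ˡ-*ʳ (λ _ → 1ℚ) t₂ P)))
            (cong (_* t₂) (∑ˡ-1 P)))))

    -- A set of matchings, its densities in the stars and its projection.

    module Density (f : V → ℚ) (f-bool : ∀ v → f v ≡ 0ℚ ⊎ f v ≡ 1ℚ) (c : ℚ) (∑f : ∑ f ≡ c * t₁) (0<c : 0ℚ < c)
      (c≤ : c * num 2 ≤ h + num 4) where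
      0≤c : 0ℚ ≤ c
      0≤c = ℚ.<⇒≤ 0<c

      private
        inverse-t₁ : ∃ λ r → r * t₁ ≡ 1ℚ × 0ℚ < r
        inverse-t₁ = inverse 0<t₁

      D⁻¹ : ℚ
      D⁻¹ = proj₁ inverse-t₁

      θ : ℚ
      θ = c * τ

      -- d i j is the density of f in the star of {i , j}; a is d, centred so that
      -- its rows sum to zero.
      d a : Fin N → Fin N → ℚ
      d i j = D⁻¹ * ∑[ v ] (f v * x i j v)
      a i j = d i j - θ * (1ℚ - δ i j)

      opaque
        D⁻¹≡ : D⁻¹ * t₁ ≡ 1ℚ
        D⁻¹≡ = proj₁ (proj₂ inverse-t₁)

        0≤D⁻¹ : 0ℚ ≤ D⁻¹
        0≤D⁻¹ = ℚ.<⇒≤ (proj₂ (proj₂ inverse-t₁))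

        0≤θ : 0ℚ ≤ θ
        0≤θ = 0≤c ⊗ 0≤τ

        2θ≤1 : num 2 * θ ≤ 1ℚ
        2θ≤1 = ℚ.≤-trans (certify (gap c≤ ⊗ 0≤τ)
            (solve 3 (λ c τ h → τ :* (h :+ :# 4) :- :# 2 :* (c :* τ) := (h :+ :# 4 :- c :* :# 2) :* τ) refl c
              τ h)) (ℚ.≤-reflexive τ≡)

        0≤f : ∀ v → 0ℚ ≤ f v
        0≤f v = by (f-bool v)
          where
          by : f v ≡ 0ℚ ⊎ f v ≡ 1ℚ → 0ℚ ≤ f v
          by (inj₁ e) = ℚ.≤-reflexive (sym e)
          by (inj₂ e) = subst (0ℚ ≤_) (sym e) (ℚ.nonNegative⁻¹ 1ℚ)

        fx≤x : ∀ i j v → f v * x i j v ≤ x i j v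
        fx≤x i j v = by (f-bool v)
          where
          by : f v ≡ 0ℚ ⊎ f v ≡ 1ℚ → f v * x i j v ≤ x i j v
          by (inj₁ e) = subst (_≤ x i j v) (sym (trans (cong (_* x i j v) e) (ℚ.*-zeroˡ (x i j v))))
            (0≤δ (mate v i) j)
          by (inj₂ e) = ℚ.≤-reflexive (trans (cong (_* x i j v) e) (ℚ.*-identityˡ (x i j v)))

        ∑fx : ∀ i j → ∑[ v ] (f v * x i j v) ≡ t₁ * d i j
        ∑fx i j = sym (trans (solve 3 (λ t D s → t :* (D :* s) := D :* t :* s) refl t₁ D⁻¹
          (∑[ v ] (f v * x i j v))) (trans (cong (_* ∑[ v ] (f v * x i j v)) D⁻¹≡) (ℚ.*-identityˡ _)))

        0≤d : ∀ i j → 0ℚ ≤ d i j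
        0≤d i j = 0≤D⁻¹ ⊗ ∑-nonneg (λ v → 0≤f v ⊗ 0≤δ (mate v i) j)

        d-diag : ∀ i → d i i ≡ 0ℚ
        d-diag i = trans (cong (D⁻¹ *_) (∑-zero λ v → trans (cong (f v *_) (x-diag i v)) (ℚ.*-zeroʳ (f v))))
          (ℚ.*-zeroʳ D⁻¹)

        d-sym : ∀ i j → d i j ≡ d j i
        d-sym i j = cong (D⁻¹ *_) (∑-cong λ v → cong (f v *_) (x-sym i j v))

        d≤1 : ∀ i j → d i j ≤ 1ℚ
        d≤1 i j = by (i Fin.≟ j)
          where
          by : Dec (i ≡ j) → d i j ≤ 1ℚ
          by (yes e) = ℚ.≤-trans (ℚ.≤-reflexive (trans (cong (d i) (sym e)) (d-diag i))) (ℚ.nonNegative⁻¹ 1ℚ)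
          by (no i≢j) = certify {s = D⁻¹ * (t₁ - ∑[ v ] (f v * x i j v))}
            (0≤D⁻¹ ⊗ gap (subst (∑[ v ] (f v * x i j v) ≤_) (∑x i≢j) (∑-mono (fx≤x i j))))
            (trans (cong (_- d i j) (sym D⁻¹≡)) (solve 3 (λ D t s → D :* t :- D :* s := D :* (t :- s)) refl
              D⁻¹ t₁ (∑[ v ] (f v * x i j v))))

        -- Every matching has exactly one edge at `i`, so the stars at `i` partition it all and the
        -- densities add up to `∑ f` divided by `t₁`.
        d-row : ∀ i → ∑ (d i) ≡ c
        d-row i = begin
          ∑ (d i)
            ≡⟨ ∑-* D⁻¹ (λ j → ∑[ v ] (f v * x i j v)) ⟩
          D⁻¹ * ∑[ j ] ∑[ v ] (f v * x i j v)
            ≡⟨ cong (D⁻¹ *_) (trans (∑-comm (λ j v → f v * x i j v)) (∑-cong λ v →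
                 trans (∑-* (f v) (λ j → x i j v)) (trans (cong (f v *_) (∑-x i v)) (ℚ.*-identityʳ (f v))))) ⟩
          D⁻¹ * ∑ f
            ≡⟨ trans (cong (D⁻¹ *_) ∑f) (solve 3 (λ D c t → D :* (c :* t) := D :* t :* c) refl D⁻¹ c t₁) ⟩
          D⁻¹ * t₁ * c
            ≡⟨ trans (cong (_* c) D⁻¹≡) (ℚ.*-identityˡ c) ⟩
          c ∎
          where
          open ≡-Reasoning

        a-sym : ∀ i j → a i j ≡ a j i
        a-sym i j = cong₂ (λ p q → p - θ * (1ℚ - q)) (d-sym i j) (δ-sym i j)

        a-diag : ∀ i → a i i ≡ 0ℚ
        a-diag i = trans (cong₂ (λ p q → p - θ * (1ℚ - q)) (d-diag i) (δ-refl i))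
            (solve 1 (λ θ → :0 :- θ :* (:1 :- :1) := :0) refl θ)

        a-≢ : ∀ {i j} → i ≢ j → a i j ≡ d i j - θ
        a-≢ {i} {j} i≢j = trans (cong (λ z → d i j - θ * (1ℚ - z)) (δ-≢ i≢j))
            (solve 2 (λ d θ → d :- θ :* (:1 :- :0) := d :- θ) refl (d i j) θ)

        -- The row sum c of `d` is spread evenly over the `h + 4` other vertices, that is 2n-1 of
        -- them, by `θ`.
        a-row : ∀ i → ∑ (a i) ≡ 0ℚ
        a-row i = begin
          ∑ (a i)
            ≡⟨ trans (∑-cong λ j → solve 3 (λ d θ δ → d :- θ :* (:1 :- δ) := :1 :* d :+ :- θ :* :1 :+ θ :* δ)
              refl (d i j) θ (δ i j)) (∑-lin₃ 1ℚ (d i) (- θ) (λ _ → 1ℚ) θ (λ j → δ i j)) ⟩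
          1ℚ * ∑ (d i) + - θ * ∑ {n = N} (λ _ → 1ℚ) + θ * ∑ (δ i)
            ≡⟨ cong₂ _+_ (cong₂ (λ p q → 1ℚ * p + - θ * q) (d-row i) (trans (∑-const N 1ℚ) (cong (_* 1ℚ) #N)))
                 (cong (θ *_) (trans (∑-cong λ j → sym (ℚ.*-identityʳ (δ i j))) (∑-δ i (λ _ → 1ℚ)))) ⟩
          1ℚ * c + - θ * ((h + num 5) * 1ℚ) + θ * 1ℚ
            ≡⟨ solve 3 (λ c τ h → :1 :* c :+ :- (c :* τ) :* ((h :+ :# 5) :* :1) :+ c :* τ :* :1 := c :*
              (:1 :- τ :* (h :+ :# 4))) refl c τ h ⟩
          c * (1ℚ - τ * (h + num 4))
            ≡⟨ trans (cong (λ z → c * (1ℚ - z)) τ≡) (solve 1 (λ c → c :* (:1 :- :1) := :0) refl c) ⟩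
          0ℚ ∎
          where
          open ≡-Reasoning

        δ≤1 : ∀ {M} (i j : Fin M) → δ i j ≤ 1ℚ
        δ≤1 i j = by (i Fin.≟ j)
          where
          by : Dec (i ≡ j) → δ i j ≤ 1ℚ
          by (yes refl) = ℚ.≤-reflexive (δ-refl i)
          by (no ≢) = subst (_≤ 1ℚ) (sym (δ-≢ ≢)) (ℚ.nonNegative⁻¹ 1ℚ)

        -θ≤a : ∀ i j → - θ ≤ a i j
        -θ≤a i j = certify (0≤d i j ⊕ 0≤θ ⊗ 0≤δ i j)
            (solve 3 (λ d θ δ → d :- θ :* (:1 :- δ) :- :- θ := d :+ θ :* δ) refl (d i j) θ (δ i j))

        a≤d : ∀ i j → a i j ≤ d i j
        a≤d i j = certify (0≤θ ⊗ gap (δ≤1 i j))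
            (solve 3 (λ d θ δ → d :- (d :- θ :* (:1 :- δ)) := θ :* (:1 :- δ)) refl (d i j) θ (δ i j))

        a≤1 : ∀ i j → a i j ≤ 1ℚ
        a≤1 i j = ℚ.≤-trans (a≤d i j) (d≤1 i j)

        -1≤a : ∀ i j → - 1ℚ ≤ a i j
        -1≤a i j = ℚ.≤-trans (certify (gap 2θ≤1 ⊕ 0≤θ)
            (solve 1 (λ θ → :- θ :- :- :1 := (:1 :- :# 2 :* θ) :+ θ) refl θ)) (-θ≤a i j)

      open WithMatrix a a-sym a-diag a-row public

      -- The projection of f. The factor ½ is there because Q counts every edge twice.
      p : V → ℚ
      p v = θ + ½ * β * Q v

      W : ℚ
      W = ∑[ v ] ((f v - p v) * (f v - p v))

      opaque
        θt₀ : θ * ((h + num 4) * t₁) ≡ c * t₁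
        θt₀ = trans
            (solve 4 (λ c τ h t → c :* τ :* ((h :+ :# 4) :* t) := c :* (τ :* (h :+ :# 4)) :* t) refl c τ h t₁)
              (trans (cong (λ z → c * z * t₁) τ≡) (cong (_* t₁) (ℚ.*-identityʳ c)))

        ∑const : ∀ w → ∑ {n = ∣V∣[ n ]} (λ _ → w) ≡ w * ((h + num 4) * t₁)
        ∑const w = trans (∑-cong λ _ → sym (ℚ.*-identityʳ w)) (trans (∑-* w (λ _ → 1ℚ)) (cong (w *_) t₀≡))

        -- On this star `f` sums to `t₁ d i j`, the constant to `t₁ θ`, and `½ β Q` to
        -- `t₁ (d i j - θ)` by the choice of `β`.
        f-p⊥x : ∀ i j → ∑[ v ] ((f v - p v) * x i j v) ≡ 0ℚ
        f-p⊥x i j = by (i Fin.≟ j)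
          where
          by : Dec (i ≡ j) → ∑[ v ] ((f v - p v) * x i j v) ≡ 0ℚ
          by (yes refl) = ∑-zero λ v → trans (cong ((f v - p v) *_) (x-diag i v)) (ℚ.*-zeroʳ (f v - p v))
          by (no i≢j) = begin
            ∑[ v ] ((f v - p v) * x i j v)
              ≡⟨ trans (∑-cong λ v → solve 5 (λ f θ b Q x → (f :- (θ :+ b :* Q)) :* x := :1 :* (f :* x) :+ :-
                θ :* x :+ :- b :* (x :* Q)) refl (f v) θ (½ * β) (Q v) (x i j v))
                (∑-lin₃ 1ℚ (λ v → f v * x i j v) (- θ) (x i j) (- (½ * β)) (λ v → x i j v * Q v)) ⟩
            1ℚ * ∑[ v ] (f v * x i j v) + - θ * ∑ (x i j) + - (½ * β) * ∑[ v ] (x i j v * Q v)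
              ≡⟨ cong₂ _+_ (cong₂ (λ p q → 1ℚ * p + - θ * q) (∑fx i j) (∑x i≢j))
                (cong (- (½ * β) *_) (trans (∑xQ i≢j) (cong (num 2 * (t₁ + t₂) *_) (a-≢ i≢j)))) ⟩
            1ℚ * (t₁ * d i j) + - θ * t₁ + - (½ * β) * (num 2 * (t₁ + t₂) * (d i j - θ))
              ≡⟨ solve 5 (λ t d θ β s → :1 :* (t :* d) :+ :- θ :* t :+ :- (:½ :* β) :* (:# 2 :* s :* (d :- θ))
                := (t :- β :* s) :* (d :- θ)) refl t₁ (d i j) θ β (t₁ + t₂) ⟩
            (t₁ - β * (t₁ + t₂)) * (d i j - θ)
              ≡⟨ cong (λ z → (t₁ - z) * (d i j - θ)) β-t ⟩
            (t₁ - t₁) * (d i j - θ)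
              ≡⟨ solve 2 (λ t b → (t :- t) :* b := :0) refl t₁ (d i j - θ) ⟩
            0ℚ ∎
            where
            open ≡-Reasoning

        f-p⊥1 : ∑[ v ] (f v - p v) ≡ 0ℚ
        f-p⊥1 = begin
          ∑[ v ] (f v - p v)
            ≡⟨ trans (∑-cong λ v → solve 4 (λ f θ b Q → f :- (θ :+ b :* Q) := :1 :* f :+ :- :1 :* θ :+ :- b :*
              Q) refl (f v) θ (½ * β) (Q v)) (∑-lin₃ 1ℚ f (- 1ℚ) (λ _ → θ) (- (½ * β)) Q) ⟩
          1ℚ * ∑ f + - 1ℚ * ∑ {n = ∣V∣[ n ]} (λ _ → θ) + - (½ * β) * ∑ Q
            ≡⟨ cong₂ _+_ (cong₂ (λ p q → 1ℚ * p + - 1ℚ * q) ∑f (trans (∑const θ) θt₀))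
              (cong (- (½ * β) *_) ∑Q) ⟩
          1ℚ * (c * t₁) + - 1ℚ * (c * t₁) + - (½ * β) * 0ℚ
            ≡⟨ solve 2 (λ C β → :1 :* C :+ :- :1 :* C :+ :- (:½ :* β) :* :0 := :0) refl (c * t₁) β ⟩
          0ℚ ∎
          where
          open ≡-Reasoning

        f-p⊥Q : ∑[ v ] ((f v - p v) * Q v) ≡ 0ℚ
        f-p⊥Q = trans (∑-cong λ v → ℚ.*-comm (f v - p v) (Q v)) (trans (∑-Q* (λ v → f v - p v))
          (∑-zero λ i → ∑-zero λ j → trans (cong (a i j *_)
            (trans (∑-cong λ v → ℚ.*-comm (x i j v) (f v - p v)) (f-p⊥x i j))) (ℚ.*-zeroʳ (a i j))))

        f-p⊥p : ∑[ v ] ((f v - p v) * p v) ≡ 0ℚ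
        f-p⊥p = trans (∑-cong λ v → solve 4 (λ g θ b Q → g :* (θ :+ b :* Q) := θ :* g :+ b :* (g :* Q)) refl
          (f v - p v) θ (½ * β) (Q v)) (trans (∑-lin₂ θ (λ v → f v - p v) (½ * β) (λ v → (f v - p v) * Q v))
          (trans (cong₂ (λ p q → θ * p + ½ * β * q) f-p⊥1 f-p⊥Q)
            (solve 2 (λ θ b → θ :* :0 :+ b :* :0 := :0) refl θ (½ * β))))

        -- Pythagoras: the difference of the two sides is the sum of the squares of `p - u`, as
        -- `f - p` is orthogonal to both `p` and `u`.
        best-approximation : ∀ (u : V → ℚ) → ∑[ v ] ((f v - p v) * u v) ≡ 0ℚ → W ≤ ∑[ v ]
          ((f v - u v) * (f v - u v))
        best-approximation u ⊥u = certify (∑-nonneg λ v → square≥0 (p v - u v)) (begin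
          ∑[ v ] ((f v - u v) * (f v - u v)) - W
            ≡⟨ sym (∑-- (λ v → (f v - u v) * (f v - u v)) (λ v → (f v - p v) * (f v - p v))) ⟩
          ∑[ v ] ((f v - u v) * (f v - u v) - (f v - p v) * (f v - p v))
            ≡⟨ trans (∑-cong λ v → solve 3 (λ f p u → (f :- u) :* (f :- u) :- (f :- p) :* (f :- p) := :1 :*
              ((p :- u) :* (p :- u)) :+ :# 2 :* ((f :- p) :* p) :+ :- :# 2 :* ((f :- p) :* u)) refl (f v)
              (p v) (u v)) (∑-lin₃ 1ℚ (λ v → (p v - u v) * (p v - u v)) (num 2) (λ v → (f v - p v) * p v)
              (- num 2) (λ v → (f v - p v) * u v)) ⟩
          1ℚ * ∑[ v ] ((p v - u v) * (p v - u v)) + num 2 * ∑[ v ] ((f v - p v) * p v) + - num 2 * ∑[ v ]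
            ((f v - p v) * u v)
            ≡⟨ cong₂ (λ q r → 1ℚ * ∑[ v ] ((p v - u v) * (p v - u v)) + num 2 * q + - num 2 * r) f-p⊥p ⊥u ⟩
          1ℚ * ∑[ v ] ((p v - u v) * (p v - u v)) + num 2 * 0ℚ + - num 2 * 0ℚ
            ≡⟨ solve 1 (λ s → :1 :* s :+ :# 2 :* :0 :+ :- :# 2 :* :0 := s) refl
              (∑[ v ] ((p v - u v) * (p v - u v))) ⟩
          ∑[ v ] ((p v - u v) * (p v - u v)) ∎)
          where
          open ≡-Reasoning

        f-idem : ∀ v → f v * f v ≡ f v
        f-idem v = by (f-bool v)
          where
          by : f v ≡ 0ℚ ⊎ f v ≡ 1ℚ → f v * f v ≡ f v
          by (inj₁ e) = trans (cong (_* f v) e) (trans (ℚ.*-zeroˡ (f v)) (sym e))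
          by (inj₂ e) = trans (cong (_* f v) e) (ℚ.*-identityˡ (f v))

        -- `f` is its own square, so its squared length is `∑ f`, and the orthogonal part `f - p`
        -- accounts for `W`.
        ∑fp : ∑[ v ] (f v * p v) ≡ c * t₁ - W
        ∑fp = begin
          ∑[ v ] (f v * p v)
            ≡⟨ trans (∑-cong λ v → trans
              (solve 2 (λ f p → f :* p := :1 :* (f :* f) :+ :- :1 :* ((f :- p) :* (f :- p)) :+ :- :1 :*
                ((f :- p) :* p)) refl (f v) (p v)) (cong
                (λ z → 1ℚ * z + - 1ℚ * ((f v - p v) * (f v - p v)) + - 1ℚ * ((f v - p v) * p v)) (f-idem v)))
                 (∑-lin₃ 1ℚ f (- 1ℚ) (λ v → (f v - p v) * (f v - p v)) (- 1ℚ) (λ v → (f v - p v) * p v)) ⟩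
          1ℚ * ∑ f + - 1ℚ * W + - 1ℚ * ∑[ v ] ((f v - p v) * p v)
            ≡⟨ cong₂ (λ q r → 1ℚ * q + - 1ℚ * W + - 1ℚ * r) ∑f f-p⊥p ⟩
          1ℚ * (c * t₁) + - 1ℚ * W + - 1ℚ * 0ℚ
            ≡⟨ solve 2 (λ C W → :1 :* C :+ :- :1 :* W :+ :- :1 :* :0 := C :- W) refl (c * t₁) W ⟩
          c * t₁ - W ∎
          where
          open ≡-Reasoning

        ∑pp : ∑[ v ] (p v * p v) ≡ c * t₁ - W
        ∑pp = trans (∑-cong λ v → solve 2 (λ f p → p :* p := :1 :* (f :* p) :+ :- :1 :* ((f :- p) :* p)) refl
          (f v) (p v)) (trans (∑-lin₂ 1ℚ (λ v → f v * p v) (- 1ℚ) (λ v → (f v - p v) * p v))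
          (trans (cong₂ (λ q r → 1ℚ * q + - 1ℚ * r) ∑fp f-p⊥p)
            (solve 1 (λ C → :1 :* C :+ :- :1 :* :0 := C) refl (c * t₁ - W))))

        -- Both sides are the second moment of `p` about its mean `θ`: once from `∑pp`, once from
        -- `∑QQ` with one factor `β` used up by `β-t`.
        S₂-identity : ½ * β * t₁ * S₂ ≡ c * t₁ - W - θ * (c * t₁)
        S₂-identity = sym (begin
          c * t₁ - W - θ * (c * t₁)
            ≡⟨ cong (λ z → z - θ * (c * t₁)) (sym ∑pp) ⟩
          ∑[ v ] (p v * p v) - θ * (c * t₁)
            ≡⟨ cong₂ (λ q r → q - θ * r) (trans (∑-cong λ v → solve 3
              (λ θ b Q → (θ :+ b :* Q) :* (θ :+ b :* Q) := θ :* θ :+ :# 2 :* θ :* b :* Q :+ b :* b :*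
              (Q :* Q)) refl θ (½ * β) (Q v)) (∑-lin₃ θ (λ _ → θ) (num 2 * θ * (½ * β)) Q (½ * β * (½ * β))
              (λ v → Q v * Q v))) (sym θt₀) ⟩
          θ * ∑ {n = ∣V∣[ n ]} (λ _ → θ) + num 2 * θ * (½ * β) * ∑ Q + ½ * β * (½ * β) * ∑[ v ] (Q v * Q v) -
            θ * (θ * ((h + num 4) * t₁))
            ≡⟨ cong₂ (λ q r → q + r - θ * (θ * ((h + num 4) * t₁)))
              (cong₂ (λ q r → θ * q + num 2 * θ * (½ * β) * r) (∑const θ) ∑Q) (cong (½ * β * (½ * β) *_) ∑QQ) ⟩
          θ * (θ * ((h + num 4) * t₁)) + num 2 * θ * (½ * β) * 0ℚ + ½ * β * (½ * β) * (num 2 * (t₁ + t₂) * S₂)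
            - θ * (θ * ((h + num 4) * t₁))
            ≡⟨ solve 5 (λ C θ β t S → C :+ :# 2 :* θ :* (:½ :* β) :* :0 :+ :½ :* β :* (:½ :* β) :*
              (:# 2 :* t :* S) :- C := :½ :* β :* (β :* t) :* S) refl (θ * (θ * ((h + num 4) * t₁))) θ β
              (t₁ + t₂) S₂ ⟩
          ½ * β * (β * (t₁ + t₂)) * S₂
            ≡⟨ cong (λ z → ½ * β * z * S₂) β-t ⟩
          ½ * β * t₁ * S₂ ∎)
          where
          open ≡-Reasoning

        -- Every vertex contributes at least `- θ` to `Q`. As `θ` is c divided by `N - 1`, half of
        -- `N θ` is at most c.
        -c≤p : ∀ v → - c ≤ p v
        -c≤p v = ℚ.≤-trans (certify (gap θN≤ ⊕ 0≤θ ⊕ 0≤½ ⊗ 0≤β ⊗ gap Q≥ ⊕ 0≤½ ⊗ gap β≤1 ⊗ (0≤θ ⊗ 0≤#N))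
            (solve 5 (λ c θ β Q N → θ :+ :½ :* β :* Q :- :- c := (c :- :½ :* (θ :* N)) :+ θ :+ :½ :* β :*
              (Q :- N :* (:- θ)) :+ :½ :* (:1 :- β) :* (θ :* N)) refl c θ β (Q v) (# N))) ℚ.≤-refl
          where
          0≤½ : 0ℚ ≤ ½
          0≤½ = ℚ.nonNegative⁻¹ ½
          0≤#N : 0ℚ ≤ # N
          0≤#N = 0≤# N
          0≤β : 0ℚ ≤ β
          0≤β = cancelˡ-≤ {num 4} (ℚ.positive⁻¹ (num 4))
            (ℚ.≤-trans (ℚ.≤-reflexive (ℚ.*-zeroʳ (num 4))) (ℚ.≤-trans (ℚ.nonNegative⁻¹ (num 3)) ¾≤β))
          Q≥ : # N * (- θ) ≤ Q v
          Q≥ = subst (_≤ Q v) (∑-const N (- θ)) (∑-mono λ r → -θ≤a r (mate v r))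
          θN≤ : ½ * (θ * # N) ≤ c
          θN≤ = certify {s = ½ * (c * τ * (h + num 3))} (0≤½ ⊗ (0≤c ⊗ 0≤τ ⊗ (0≤h ⊕ ℚ.nonNegative⁻¹ (num 3))))
            (trans (cong₂ (λ p q → p - ½ * (θ * q)) (trans (sym (ℚ.*-identityʳ c)) (cong (c *_) (sym τ≡))) #N)
              (solve 3 (λ c τ h → c :* (τ :* (h :+ :# 4)) :- :½ :* (c :* τ :* (h :+ :# 5)) := :½ :*
                (c :* τ :* (h :+ :# 3))) refl c τ h))

        -- Summed over v this is ∑ p³ ≥ ∑ f (2p - 1) - (1 + c) W, as (f - p) ⊥ p. Indeed
        -- p³ = f p² + (p - f) p + (p - f)² (p + f - 1) as f² = f, and p ≥ -c.
        cube : ∀ v → f v * (num 2 * p v - 1ℚ) - (f v - p v) * p v - (1ℚ + c) * ((f v - p v) * (f v - p v)) ≤ p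
          v * (p v * p v)
        cube v = by (f-bool v)
          where
          P : ℚ
          P = p v
          0≤P+c : 0ℚ ≤ P - - c
          0≤P+c = gap (-c≤p v)
          by : f v ≡ 0ℚ ⊎ f v ≡ 1ℚ → f v * (num 2 * P - 1ℚ) - (f v - P) * P - (1ℚ + c) *
            ((f v - P) * (f v - P)) ≤ P * (P * P)
          by (inj₁ e) = subst (λ F → F * (num 2 * P - 1ℚ) - (F - P) * P - (1ℚ + c) * ((F - P) * (F - P)) ≤ P *
            (P * P)) (sym e)
            (certify (square≥0 P ⊗ 0≤P+c)
              (solve 2 (λ P c → P :* (P :* P) :- (:0 :* (:# 2 :* P :- :1) :- (:0 :- P) :* P :- (:1 :+ c) :*
                ((:0 :- P) :* (:0 :- P))) := P :* P :* (P :- :- c)) refl P c))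
          by (inj₂ e) = subst (λ F → F * (num 2 * P - 1ℚ) - (F - P) * P - (1ℚ + c) * ((F - P) * (F - P)) ≤ P *
            (P * P)) (sym e)
            (certify (square≥0 (P - 1ℚ) ⊗ (0≤P+c ⊕ ℚ.nonNegative⁻¹ (num 2)))
              (solve 2 (λ P c → P :* (P :* P) :- (:1 :* (:# 2 :* P :- :1) :- (:1 :- P) :* P :- (:1 :+ c) :*
                ((:1 :- P) :* (:1 :- P))) := (P :- :1) :* (P :- :1) :* ((P :- :- c) :+ :# 2)) refl P c))

        ∑ppp≥ : c * t₁ - (num 3 + c) * W ≤ ∑[ v ] (p v * (p v * p v))
        ∑ppp≥ = ℚ.≤-trans (ℚ.≤-reflexive (sym (begin
          ∑[ v ] (f v * (num 2 * p v - 1ℚ) - (f v - p v) * p v - (1ℚ + c) * ((f v - p v) * (f v - p v)))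
            ≡⟨ trans (∑-cong λ v → solve 3 (λ c f p → f :* (:# 2 :* p :- :1) :- (f :- p) :* p :- (:1 :+ c) :*
              ((f :- p) :* (f :- p)) := :# 2 :* (f :* p) :+ :- :1 :* f :+ :- :1 :* ((f :- p) :* p) :+ :-
              (:1 :+ c) :* ((f :- p) :* (f :- p))) refl c (f v) (p v))
              (∑-lin₄ (num 2) (λ v → f v * p v) (- 1ℚ) f (- 1ℚ) (λ v → (f v - p v) * p v) (- (1ℚ + c))
              (λ v → (f v - p v) * (f v - p v))) ⟩
          num 2 * ∑[ v ] (f v * p v) + - 1ℚ * ∑ f + - 1ℚ * ∑[ v ] ((f v - p v) * p v) + - (1ℚ + c) * W
            ≡⟨ cong₂ (λ q r → q + - 1ℚ * r + - (1ℚ + c) * W) (cong₂ (λ q r → num 2 * q + - 1ℚ * r) ∑fp ∑f)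
              f-p⊥p ⟩
          num 2 * (c * t₁ - W) + - 1ℚ * (c * t₁) + - 1ℚ * 0ℚ + - (1ℚ + c) * W
            ≡⟨ solve 3 (λ c C W → :# 2 :* (C :- W) :+ :- :1 :* C :+ :- :1 :* :0 :+ :- (:1 :+ c) :* W := C :-
              (:# 3 :+ c) :* W) refl c (c * t₁) W ⟩
          c * t₁ - (num 3 + c) * W ∎))) (∑-mono cube)
          where
          open ≡-Reasoning

        -- The cube is arranged as 3θp² - 2θ³ - 3θ²q + q³ with q = `½ β Q`, so that the known sum of
        -- p² is reused and only the third moment of `Q` is new.
        ∑ppp : ∑[ v ] (p v * (p v * p v)) ≡ num 3 * θ * (c * t₁ - W) - num 2 * (θ * θ * (c * t₁)) + β * β * β
          * (½ * (t₁ + num 3 * t₂ + num 4 * t₃) * S₃ - t₃ * T)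
        ∑ppp = begin
          ∑[ v ] (p v * (p v * p v))
            ≡⟨ trans (∑-cong λ v → solve 3 (λ θ b Q → (θ :+ b :* Q) :* ((θ :+ b :* Q) :* (θ :+ b :* Q)) := :#
              3 :* θ :* ((θ :+ b :* Q) :* (θ :+ b :* Q)) :+ :- (:# 2 :* θ :* θ) :* θ :+ :-
              (:# 3 :* θ :* θ :* b) :* Q :+ b :* b :* b :* (Q :* (Q :* Q))) refl θ (½ * β) (Q v))
              (∑-lin₄ (num 3 * θ) (λ v → p v * p v) (- (num 2 * θ * θ)) (λ _ → θ)
              (- (num 3 * θ * θ * (½ * β))) Q (½ * β * (½ * β) * (½ * β)) (λ v → Q v * (Q v * Q v))) ⟩
          num 3 * θ * ∑[ v ] (p v * p v) + - (num 2 * θ * θ) * ∑ {n = ∣V∣[ n ]} (λ _ → θ) + -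
            (num 3 * θ * θ * (½ * β)) * ∑ Q + ½ * β * (½ * β) * (½ * β) * ∑[ v ] (Q v * (Q v * Q v))
            ≡⟨ cong₂ _+_ (cong₂ _+_ (cong₂ (λ q r → num 3 * θ * q + - (num 2 * θ * θ) * r) ∑pp
              (trans (∑const θ) θt₀)) (cong (- (num 3 * θ * θ * (½ * β)) *_) ∑Q))
                 (cong (½ * β * (½ * β) * (½ * β) *_) ∑QQQ) ⟩
          num 3 * θ * (c * t₁ - W) + - (num 2 * θ * θ) * (c * t₁) + - (num 3 * θ * θ * (½ * β)) * 0ℚ + ½ * β *
            (½ * β) * (½ * β) * (num 4 * (t₁ + num 3 * t₂ + num 4 * t₃) * S₃ - num 8 * t₃ * T)
            ≡⟨ solve 8 (λ θ C W β k S t T → :# 3 :* θ :* (C :- W) :+ :- (:# 2 :* θ :* θ) :* C :+ :-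
              (:# 3 :* θ :* θ :* (:½ :* β)) :* :0 :+ :½ :* β :* (:½ :* β) :* (:½ :* β) :*
              (:# 4 :* k :* S :- :# 8 :* t :* T) := :# 3 :* θ :* (C :- W) :- :# 2 :* (θ :* θ :* C) :+ β :* β
              :* β :* (:½ :* k :* S :- t :* T)) refl θ (c * t₁) W β (t₁ + num 3 * t₂ + num 4 * t₃) S₃ t₃ T ⟩
          num 3 * θ * (c * t₁ - W) - num 2 * (θ * θ * (c * t₁)) + β * β * β *
            (½ * (t₁ + num 3 * t₂ + num 4 * t₃) * S₃ - t₃ * T) ∎
          where
          open ≡-Reasoning

      opaque
        1≤h : 1ℚ ≤ h
        1≤h = subst (_≤ h) (#≡num 1) (#-mono-≤ (ℕ.s≤s ℕ.z≤n))

        S₂-S₃ : S₂ - S₃ ≡ ∑[ i ] ∑[ j ] (a i j * a i j - a i j * (a i j * a i j))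
        S₂-S₃ = sym (trans (∑-cong λ i → ∑-- (λ j → a i j * a i j) (λ j → a i j * (a i j * a i j)))
          (∑-- (λ i → R i i) (λ i → ∑[ j ] (a i j * (a i j * a i j)))))

        0≤g : ∀ i j → 0ℚ ≤ a i j * a i j - a i j * (a i j * a i j)
        0≤g i j = ℚ.≤-trans (square≥0 (a i j) ⊗ gap (a≤1 i j)) (ℚ.≤-reflexive
            (solve 1 (λ a → a :* a :* (:1 :- a) := a :* a :- a :* (a :* a)) refl (a i j)))

        0≤E : 0ℚ ≤ S₂ - S₃
        0≤E = subst (0ℚ ≤_) (sym S₂-S₃) (∑-nonneg λ i → ∑-nonneg λ j → 0≤g i j)

        0≤S₂ : 0ℚ ≤ S₂
        0≤S₂ = ∑-nonneg λ i → ∑-nonneg λ j → square≥0 (a i j)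

        S₃≤S₂ : S₃ ≤ S₂
        S₃≤S₂ = certify 0≤E refl

        -- As entries lie between -1 and 1, each product of three is at least minus half the sum of
        -- two of the squares. The factor `N` is harmless: `T` carries the weight `t₃`, smaller than
        -- `t₁` by `(h + 2) h`.
        -T≤ : - T ≤ # N * S₂
        -T≤ = ℚ.≤-trans (ℚ.≤-reflexive (trans (sym (∑-neg (λ i → ∑[ j ] (a i j * R i j))))
          (∑-cong λ i → sym (∑-neg (λ j → a i j * R i j)))))
          (ℚ.≤-trans (∑-mono λ i → ∑-mono λ j → pointwise i j) (ℚ.≤-reflexive total))
          where
          pointwise : ∀ i j → - (a i j * R i j) ≤ ½ * R i i + ½ * R j j
          pointwise i j = ℚ.≤-trans (ℚ.≤-reflexive
            (trans (solve 2 (λ a r → :- (a :* r) := :- a :* r) refl (a i j) (R i j))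
            (sym (∑-* (- a i j) (λ s → a i s * a j s)))))
            (ℚ.≤-trans (∑-mono λ s → certify
              (square≥0 (a i s + a i j * a j s) ⊗ 0≤½ ⊕ square≥0 (a j s) ⊗ (gap (a≤1 i j) ⊗ gap (-1≤a i j)) ⊗
                0≤½)
                (solve 3 (λ a u w → :½ :* (u :* u) :+ :½ :* (w :* w) :- :- a :* (u :* w) := (u :+ a :* w) :*
                  (u :+ a :* w) :* :½ :+ w :* w :* ((:1 :- a) :* (a :- :- :1)) :* :½) refl (a i j) (a i s)
                  (a j s)))
              (ℚ.≤-reflexive (∑-lin₂ ½ (λ s → a i s * a i s) ½ (λ s → a j s * a j s))))
            where
            0≤½ : 0ℚ ≤ ½
            0≤½ = ℚ.nonNegative⁻¹ ½
          total : ∑[ i ] ∑[ j ] (½ * R i i + ½ * R j j) ≡ # N * S₂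
          total = trans (∑-cong λ i → trans (∑-lin₂ ½ (λ _ → R i i) ½ (λ j → R j j))
            (cong (λ z → ½ * z + ½ * S₂) (∑-const N (R i i))))
            (trans (∑-+ (λ i → ½ * (# N * R i i)) (λ _ → ½ * S₂)) (trans
              (cong₂ _+_ (trans (∑-* ½ (λ i → # N * R i i)) (cong (½ *_) (∑-* (# N) (λ i → R i i))))
                (∑-const N (½ * S₂)))
              (solve 2 (λ N S → :½ :* (N :* S) :+ N :* (:½ :* S) := N :* S) refl (# N) S₂)))

      -- Estimates in terms of the relative error `η`.

      module _ (η : ℚ) (0≤η : 0ℚ ≤ η) (W≡ : W ≡ η * (c * t₁)) where
        opaque
          t₁≡′ : t₁ ≡ (h + num 2) * (h * t₃)
          t₁≡′ = trans t₁≡ (cong ((h + num 2) *_) t₂≡)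

          S₂-value : ½ * β * S₂ ≡ c * (1ℚ - η - θ)
          S₂-value = cancelˡ-≡ 0<t₁ (trans
              (solve 3 (λ t β S → t :* (:½ :* β :* S) := :½ :* β :* t :* S) refl t₁ β S₂)
                (trans S₂-identity (trans (cong (λ w → c * t₁ - w - θ * (c * t₁)) W≡)
                (solve 4 (λ t c η θ → c :* t :- η :* (c :* t) :- θ :* (c :* t) := t :* (c :* (:1 :- η :- θ)))
                  refl t₁ c η θ))))

          S₂-lower : num 2 * (c * (1ℚ - η - θ)) ≤ S₂
          S₂-lower = ℚ.≤-trans (ℚ.≤-reflexive (cong (num 2 *_) (sym S₂-value))) (certify (gap β≤1 ⊗ 0≤S₂)
              (solve 2 (λ β S → S :- :# 2 :* (:½ :* β :* S) := (:1 :- β) :* S) refl β S₂))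

          S₂-upper : S₂ ≤ num 3 * c
          S₂-upper = cancelˡ-≤ {num 3} (ℚ.positive⁻¹ (num 3)) (ℚ.≤-trans
            (certify (gap ¾≤β ⊗ 0≤S₂)
              (solve 2 (λ β S → :# 8 :* (:½ :* β :* S) :- :# 3 :* S := (:# 4 :* β :- :# 3) :* S) refl β S₂))
            (ℚ.≤-trans (ℚ.≤-reflexive (cong (num 8 *_) S₂-value)) (certify (num≥0 8 ⊗ (0≤c ⊗ (0≤η ⊕ 0≤θ)) ⊕ 0≤c)
              (solve 3 (λ c η θ → :# 3 :* (:# 3 :* c) :- :# 8 :* (c :* (:1 :- η :- θ)) := :# 8 :*
                (c :* (η :+ θ)) :+ c) refl c η θ))))

          -- `third-moment-bound` divided by `(h + 2) h`. The lower-order terms `5 h + 14` are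
          -- swallowed by `10 τ (h + 2) h`, that is, (h + 4)(5h + 14) ≤ 10 h (h + 2), which holds
          -- for h ≥ 10.
          E-bound : num 10 ≤ h → S₂ - S₃ ≤ num 8 * c * ((num 2 + c) * η + (num 2 * c + num 10) * τ)
          E-bound 10≤h = cancelˡ-≤ (ℚ.<-≤-trans (ℚ.positive⁻¹ 1ℚ)
            (certify {1ℚ} {(h + num 2) * h} (0≤h ⊗ 0≤h ⊕ gap 1≤h ⊕ 0≤h)
              (solve 1 (λ h → (h :+ :# 2) :* h :- :1 := h :* h :+ (h :- :1) :+ h) refl h)))
            (ℚ.≤-trans
              (third-moment-bound h t₃ c η θ β S₂ S₃ T (# N) 1≤h 0<t₃ 0≤c 0≤η 0≤θ ¾≤β β≤1 0≤S₂ S₃≤S₂ -T≤ (0≤# N)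
                (subst (λ t → ½ * β * t * S₂ ≡ c * t - η * (c * t) - θ * (c * t)) t₁≡′
                  (trans S₂-identity (cong (λ w → c * t₁ - w - θ * (c * t₁)) W≡)))
                (subst₂ (λ t s → c * t - (num 3 + c) * (η * (c * t)) ≤ num 3 * θ * (c * t - η * (c * t)) - num
                  2 * (θ * θ * (c * t)) + β * β * β * (½ * (t + num 3 * s + num 4 * t₃) * S₃ - t₃ * T)) t₁≡′ t₂≡
                  (subst (λ w → c * t₁ - (num 3 + c) * w ≤ num 3 * θ * (c * t₁ - w) - num 2 *
                    (θ * θ * (c * t₁)) + β * β * β * (½ * (t₁ + num 3 * t₂ + num 4 * t₃) * S₃ - t₃ * T)) W≡
                    (ℚ.≤-trans ∑ppp≥ (ℚ.≤-reflexive ∑ppp)))))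
              (ℚ.≤-trans (ℚ.≤-reflexive (trans (cong
                (λ z → num 8 * c * ((h + num 2) * h * ((num 2 + c) * η + num 2 * θ) + num 3 * h + num 4 + num
                2 * z)) #N)
                     (solve 4 (λ h c η τ → :# 8 :* c :* ((h :+ :# 2) :* h :*
                       ((:# 2 :+ c) :* η :+ :# 2 :* (c :* τ)) :+ :# 3 :* h :+ :# 4 :+ :# 2 :* (h :+ :# 5)) :=
                       :# 8 :* c :* ((h :+ :# 2) :* h :* ((:# 2 :+ c) :* η :+ :# 2 :* (c :* τ)) :+ :1 :*
                       (:# 5 :* h :+ :# 14))) refl h c η τ)))
                (certify (num≥0 8 ⊗ 0≤c ⊗ 0≤τ ⊗ (gap 10≤h ⊗ (num≥0 5 ⊗ 0≤h ⊕ num≥0 36) ⊕ num≥0 304))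
                  (trans (cong (λ z → (h + num 2) * h *
                    (num 8 * c * ((num 2 + c) * η + (num 2 * c + num 10) * τ)) -
                    (num 8 * c * ((h + num 2) * h * ((num 2 + c) * η + num 2 * (c * τ)) + z *
                    (num 5 * h + num 14)))) (sym τ≡))
                      (solve 4 (λ h c η τ → (h :+ :# 2) :* h :*
                        (:# 8 :* c :* ((:# 2 :+ c) :* η :+ (:# 2 :* c :+ :# 10) :* τ)) :-
                        (:# 8 :* c :* ((h :+ :# 2) :* h :* ((:# 2 :+ c) :* η :+ :# 2 :* (c :* τ)) :+ τ :*
                        (h :+ :# 4) :* (:# 5 :* h :+ :# 14))) := :# 8 :* c :* τ :*
                        ((h :- :# 10) :* (:# 5 :* h :+ :# 36) :+ :# 304)) refl h c η τ)))))

      open LargeEntries a a-sym a-diag a≤1 using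
        (E; S; large; large-unique; large-sound; large-deficit; S≤; #large≤) public

      M : ℚ
      M = # (length large)

      U : V → ℚ
      U = union large

      dist : (V → ℚ) → ℚ
      dist u = ∑[ v ] (f v + u v - num 2 * (f v * u v))

      module _ (η : ℚ) (0≤η : 0ℚ ≤ η) (W≡ : W ≡ η * (c * t₁))
        (η-small : num 100 * η ≤ 1ℚ) (cη-small : num 100 * (c * (η + τ)) ≤ 1ℚ) (τ-small : num 160 * τ ≤ 1ℚ)
          where

        -- The scale of the claimed error; all estimates below are multiples of it.
        z : ℚ
        z = c * c * (η + τ)

        opaque
          10≤h : num 10 ≤ h
          10≤h = ℚ.≤-trans (certify {s = (1ℚ - num 160 * τ) * (h + num 4) + num 146}
            (gap τ-small ⊗ (0≤h ⊕ num≥0 4) ⊕ num≥0 146)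
              (trans
                (solve 1 (λ h → h :- :# 10 := (h :+ :# 4) :- :# 160 :* :1 :+ :# 146) refl h)
                  (trans (cong (λ z → (h + num 4) - num 160 * z + num 146) (sym τ≡))
                  (solve 2 (λ h τ → (h :+ :# 4) :- :# 160 :* (τ :* (h :+ :# 4)) :+ :# 146 :=
                    (:1 :- :# 160 :* τ) :* (h :+ :# 4) :+ :# 146) refl h τ)))) ℚ.≤-refl

          E≤ : E ≤ num 8 * c * ((num 2 + c) * η + (num 2 * c + num 10) * τ)
          E≤ = subst (_≤ num 8 * c * ((num 2 + c) * η + (num 2 * c + num 10) * τ)) S₂-S₃ (E-bound η 0≤η W≡ 10≤h)

          -- Without large entries S ≤ 2E. But the smallness conditions give E below 0.83 c and S at
          -- least 1.96 c, a contradiction.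
          large-nonempty : large ≢ []
          large-nonempty e = ℚ.<-irrefl refl (ℚ.<-≤-trans 0<c
            (cancelˡ-≤ (ℚ.positive⁻¹ (num 16)) (certify {num 16 * c} {num 16 * 0ℚ}
            (num≥0 50 ⊗ gap (S₂-lower η 0≤η W≡) ⊕ num≥0 50 ⊗ gap
              (subst (λ l → S ≤ num 2 * l + num 2 * E) (trans (cong (λ L → # (length L)) e) (#≡num 0)) S≤) ⊕
              num≥0 100 ⊗ gap E≤
              ⊕ num≥0 17 ⊗ (0≤c ⊗ gap η-small) ⊕ num≥0 17 ⊗ (0≤c ⊗ gap cη-small) ⊕ num≥0 50 ⊗
                (0≤c ⊗ gap τ-small) ⊕ num≥0 900 ⊗ (0≤c ⊗ 0≤c ⊗ 0≤η))
              (solve 5 (λ c η τ S E → :# 16 :* :0 :- :# 16 :* c := :# 50 :*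
                (S :- :# 2 :* (c :* (:1 :- η :- c :* τ))) :+ :# 50 :* (:# 2 :* :0 :+ :# 2 :* E :- S) :+ :# 100
                :* (:# 8 :* c :* ((:# 2 :+ c) :* η :+ (:# 2 :* c :+ :# 10) :* τ) :- E) :+ :# 17 :*
                (c :* (:1 :- :# 100 :* η)) :+ :# 17 :* (c :* (:1 :- :# 100 :* (c :* (η :+ τ)))) :+ :# 50 :*
                (c :* (:1 :- :# 160 :* τ)) :+ :# 900 :* (c :* c :* η)) refl c η τ S E))))

          -- A large entry is at most a density, and a density is at most its row sum c. From here
          -- on c ≤ 2c², so bounds linear in c become multiples of `z`.
          ½≤c : ½ ≤ c
          ½≤c = by large refl
            where
            by : ∀ L → large ≡ L → ½ ≤ c
            by [] e = ⊥-elim (large-nonempty e)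
            by ((i , j) ∷ L) e = ℚ.≤-trans (ℚ.<⇒≤
              (proj₂ (large-sound (subst ((i , j) ∈_) (sym e) (here refl)))))
              (ℚ.≤-trans (a≤d i j) (ℚ.≤-trans (term≤∑ (0≤d i) j) (ℚ.≤-reflexive (d-row i))))

          0≤2c-1 : 0ℚ ≤ num 2 * c - 1ℚ
          0≤2c-1 = ℚ.≤-trans (num≥0 2 ⊗ gap ½≤c) (ℚ.≤-reflexive
              (solve 1 (λ c → :# 2 :* (c :- :½) := :# 2 :* c :- :1) refl c))

          -- The worst coefficient is that of τ: 16 from the term in c², and 160 from `80 c τ` with
          -- c ≤ 2c².
          E≤176z : E ≤ num 176 * z
          E≤176z = ℚ.≤-trans E≤ (certify
            (0≤c ⊗ (num≥0 8 ⊗ 0≤η ⊗ (num≥0 2 ⊗ 0≤2c-1 ⊕ num≥0 17 ⊗ 0≤c) ⊕ num≥0 80 ⊗ 0≤τ ⊗ 0≤2c-1))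
              (solve 3 (λ c η τ → :# 176 :* (c :* c :* (η :+ τ)) :- :# 8 :* c :*
                ((:# 2 :+ c) :* η :+ (:# 2 :* c :+ :# 10) :* τ) := c :*
                (:# 8 :* η :* (:# 2 :* (:# 2 :* c :- :1) :+ :# 17 :* c) :+ :# 80 :* τ :* (:# 2 :* c :- :1)))
                refl c η τ))

          -- `S` is at least `2 c (1 - η - θ)` and at most `2 M + 2 E`; the two extra units beyond
          -- 176 pay for `c η` and `c θ`.
          c-M≤ : c - M ≤ num 178 * z
          c-M≤ = certify (ℚ.nonNegative⁻¹ ½ ⊗ gap (S₂-lower η 0≤η W≡) ⊕ ℚ.nonNegative⁻¹ ½ ⊗ gap S≤ ⊕ gap
            E≤176z ⊕ 0≤c ⊗ 0≤2c-1 ⊗ 0≤η ⊕ 0≤c ⊗ 0≤c ⊗ 0≤τ)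
              (solve 6 (λ c η τ S E M → :# 178 :* (c :* c :* (η :+ τ)) :- (c :- M) := :½ :*
                (S :- :# 2 :* (c :* (:1 :- η :- c :* τ))) :+ :½ :* (:# 2 :* M :+ :# 2 :* E :- S) :+
                (:# 176 :* (c :* c :* (η :+ τ)) :- E) :+ c :* (:# 2 :* c :- :1) :* η :+ c :* c :* τ) refl c η
                τ S E M)

          0≤M : 0ℚ ≤ M
          0≤M = 0≤# (length large)

          0≤t₁ : 0ℚ ≤ t₁
          0≤t₁ = ℚ.<⇒≤ 0<t₁

          M≤6c : M ≤ num 6 * c
          M≤6c = ℚ.≤-trans #large≤ (certify (num≥0 2 ⊗ gap (S₂-upper η 0≤η W≡))
              (solve 2 (λ c S → :# 6 :* c :- :# 2 :* S := :# 2 :* (:# 3 :* c :- S)) refl c S))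

          t₂≤2τt₁ : t₂ ≤ num 2 * τ * t₁
          t₂≤2τt₁ = certify {s = t₂ * (τ * h)} (0≤t₂ ⊗ (0≤τ ⊗ 0≤h))
            (trans (cong₂ (λ p q → num 2 * τ * p - q) t₁≡
            (trans (sym (ℚ.*-identityʳ t₂)) (cong (t₂ *_) (sym τ≡))))
              (solve 3 (λ τ h t → :# 2 :* τ :* ((h :+ :# 2) :* t) :- t :* (τ :* (h :+ :# 4)) := t :* (τ :* h))
                refl τ h t₂))

          -- The overlap term of `∑-union≥`: M ≤ 6c gives 18 c² t₂, and t₂ ≤ 2τt₁ doubles the 18.
          overcount : ½ * (M * M) * t₂ ≤ num 36 * z * t₁
          overcount = ℚ.≤-trans
            (certify (ℚ.nonNegative⁻¹ ½ ⊗ (gap M≤6c ⊗ (0≤M ⊕ num≥0 6 ⊗ 0≤c)) ⊗ 0≤t₂)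
              (solve 3 (λ c M t → :# 18 :* (c :* c) :* t :- :½ :* (M :* M) :* t := :½ :*
                ((:# 6 :* c :- M) :* (M :+ :# 6 :* c)) :* t) refl c M t₂))
            (certify (num≥0 18 ⊗ (0≤c ⊗ 0≤c) ⊗ gap t₂≤2τt₁ ⊕ num≥0 36 ⊗ (0≤c ⊗ 0≤c ⊗ 0≤η) ⊗ 0≤t₁)
              (solve 5 (λ c η τ t₁ t₂ → :# 36 :* (c :* c :* (η :+ τ)) :* t₁ :- :# 18 :* (c :* c) :* t₂ := :#
                18 :* (c :* c) :* (:# 2 :* τ :* t₁ :- t₂) :+ :# 36 :* (c :* c :* η) :* t₁) refl c η τ t₁ t₂))

          0≤1-f : ∀ v → 0ℚ ≤ 1ℚ - f v
          0≤1-f v = by (f-bool v)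
            where
            by : f v ≡ 0ℚ ⊎ f v ≡ 1ℚ → 0ℚ ≤ 1ℚ - f v
            by (inj₁ e) = ℚ.≤-trans (num≥0 1) (ℚ.≤-reflexive (cong (λ t → 1ℚ - t) (sym e)))
            by (inj₂ e) = ℚ.≤-reflexive (cong (λ t → 1ℚ - t) (sym e))

          -- The star of a large entry misses the set in a proportion of at most 1 - a, and these
          -- deficits sum to at most 2E.
          outlying : ∑[ v ] (U v * (1ℚ - f v)) ≤ num 352 * z * t₁
          outlying = ℚ.≤-trans (∑-union*≤ large (λ v → 1ℚ - f v) 0≤1-f)
            (ℚ.≤-trans (∑ˡ-mono large each) (ℚ.≤-trans (ℚ.≤-reflexive (∑ˡ-* t₁ (λ (i , j) → 1ℚ - a i j) large))
              (ℚ.≤-trans (monoˡ-≤ 0≤t₁ large-deficit) (certify (0≤t₁ ⊗ (num≥0 2 ⊗ gap E≤176z))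
                (solve 3 (λ z t E → :# 352 :* z :* t :- t :* (:# 2 :* E) := t :* (:# 2 :* (:# 176 :* z :- E)))
                  refl z t₁ E)))))
            where
            each : ∀ {e} → e ∈ large → ∑[ v ] (x (proj₁ e) (proj₂ e) v * (1ℚ - f v)) ≤ t₁ *
              (1ℚ - a (proj₁ e) (proj₂ e))
            each {i , j} e∈ = ℚ.≤-trans (ℚ.≤-reflexive
              (trans (∑-cong λ v → solve 2 (λ x f → x :* (:1 :- f) := :1 :* x :+ :- :1 :* (f :* x)) refl
              (x i j v) (f v))
              (trans (∑-lin₂ 1ℚ (x i j) (- 1ℚ) (λ v → f v * x i j v))
                (trans (cong₂ (λ p q → 1ℚ * p + - 1ℚ * q) (∑x (Fin.<⇒≢ (proj₁ (large-sound e∈)))) (∑fx i j))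
                (solve 2 (λ t d → :1 :* t :+ :- :1 :* (t :* d) := t :* (:1 :- d)) refl t₁ (d i j))))))
              (certify (0≤t₁ ⊗ gap (a≤d i j))
                (solve 3 (λ t a d → t :* (:1 :- a) :- t :* (:1 :- d) := t :* (d :- a)) refl t₁ (a i j) (d i j)))

          ∑U≥ : M * t₁ - ½ * (M * M) * t₂ ≤ ∑ U
          ∑U≥ = ∑-union≥ large large-unique (All.tabulate (λ e∈ → proj₁ (large-sound e∈)))

          -- The symmetric difference is f - U + 2U(1 - f), whence 918 = 178 + 36 + 2 · 352.
          dist≤ : dist U ≤ num 918 * z * t₁
          dist≤ = ℚ.≤-trans (ℚ.≤-reflexive (trans
            (∑-cong λ v → solve 2 (λ f u → f :+ u :- :# 2 :* (f :* u) := :1 :* f :+ :- :1 :* u :+ :# 2 :*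
            (u :* (:1 :- f))) refl (f v) (U v)) (trans (∑-lin₃ 1ℚ f (- 1ℚ) U (num 2) (λ v → U v * (1ℚ - f v)))
              (cong (λ q → 1ℚ * q + - 1ℚ * ∑ U + num 2 * ∑[ v ] (U v * (1ℚ - f v))) ∑f))))
            (certify (gap ∑U≥ ⊕ gap overcount ⊕ num≥0 2 ⊗ gap outlying ⊕ gap c-M≤ ⊗ 0≤t₁)
              (solve 7 (λ c M z t o U X → :# 918 :* z :* t :- (:1 :* (c :* t) :+ :- :1 :* U :+ :# 2 :* X) :=
                (U :- (M :* t :- o)) :+ (:# 36 :* z :* t :- o) :+ :# 2 :* (:# 352 :* z :* t :- X) :+
                (:# 178 :* z :- (c :- M)) :* t) refl c M z t₁ (½ * (M * M) * t₂) (∑ U)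
                (∑[ v ] (U v * (1ℚ - f v)))))

          -- The union has at least M t₁ - 36 z t₁ members, and at most c t₁ of them lie in the set
          -- and 352 z t₁ outside; 388 = 36 + 352.
          M-c≤ : M - c ≤ num 388 * z
          M-c≤ = cancelˡ-≤ 0<t₁ (certify (gap ∑U≥ ⊕ gap overcount ⊕ gap outlying ⊕ gap U≤)
              (solve 7 (λ c M z t o U X → t :* (:# 388 :* z) :- t :* (M :- c) := (U :- (M :* t :- o)) :+
                (:# 36 :* z :* t :- o) :+ (:# 352 :* z :* t :- X) :+ (c :* t :+ X :- U)) refl c M z t₁
                (½ * (M * M) * t₂) (∑ U) (∑[ v ] (U v * (1ℚ - f v)))))
            where
            0≤1-U : ∀ v → 0ℚ ≤ 1ℚ - U v
            0≤1-U v = by (union-bool large v)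
              where
              by : U v ≡ 0ℚ ⊎ U v ≡ 1ℚ → 0ℚ ≤ 1ℚ - U v
              by (inj₁ e) = ℚ.≤-trans (num≥0 1) (ℚ.≤-reflexive (cong (λ t → 1ℚ - t) (sym e)))
              by (inj₂ e) = ℚ.≤-reflexive (cong (λ t → 1ℚ - t) (sym e))
            U≤ : ∑ U ≤ c * t₁ + ∑[ v ] (U v * (1ℚ - f v))
            U≤ = ℚ.≤-trans (∑-mono λ v → certify (0≤f v ⊗ 0≤1-U v)
              (solve 2 (λ f u → f :+ u :* (:1 :- f) :- u := f :* (:1 :- u)) refl (f v) (U v)))
              (ℚ.≤-reflexive (trans (∑-+ f (λ v → U v * (1ℚ - f v)))
                (cong (λ q → q + ∑[ v ] (U v * (1ℚ - f v))) ∑f)))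

  -- Sets of matchings

  bit : Bool → ℚ
  bit b = if b then 1ℚ else 0ℚ

  𝟏 : ∀ {k} → Subset k → Fin k → ℚ
  𝟏 A v = bit (lookup A v)

  bit-bool : ∀ b → bit b ≡ 0ℚ ⊎ bit b ≡ 1ℚ
  bit-bool false = inj₁ refl
  bit-bool true = inj₂ refl

  0≤bit : ∀ b → 0ℚ ≤ bit b
  0≤bit false = ℚ.≤-refl
  0≤bit true = num≥0 1

  bit≤1 : ∀ b → bit b ≤ 1ℚ
  bit≤1 false = num≥0 1
  bit≤1 true = ℚ.≤-refl

  #∣_∣ : ∀ {k} (A : Subset k) → # ∣ A ∣ ≡ ∑ (𝟏 A)
  #∣ [] ∣ = trans (#≡num 0) (sym (∑-nil (𝟏 [])))
  #∣ true ∷ A ∣ = trans (#-suc ∣ A ∣) (trans (cong (λ t → 1ℚ + t) #∣ A ∣) (sym (∑-cons (𝟏 (true ∷ A)))))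
  #∣ false ∷ A ∣ = trans #∣ A ∣ (trans (sym (ℚ.+-identityˡ (∑ (𝟏 A)))) (sym (∑-cons (𝟏 (false ∷ A)))))

  𝟏-∪ : ∀ {k} (A B : Subset k) v → 𝟏 (A ∪ B) v ≡ 𝟏 A v + 𝟏 B v - 𝟏 A v * 𝟏 B v
  𝟏-∪ A B v = trans (cong bit (Vec.lookup-zipWith _∨_ v A B)) (by (lookup A v) (lookup B v))
    where
    by : ∀ a b → bit (a ∨ b) ≡ bit a + bit b - bit a * bit b
    by false false = refl
    by false true = refl
    by true false = refl
    by true true = refl

  𝟏-─ : ∀ {k} (A B : Subset k) v → 𝟏 (A ─ B) v ≡ 𝟏 A v - 𝟏 A v * 𝟏 B v
  𝟏-─ (a ∷ A) (true ∷ B) zero = by a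
    where
    by : ∀ a → 0ℚ ≡ bit a - bit a * 1ℚ
    by false = refl
    by true = refl
  𝟏-─ (a ∷ A) (false ∷ B) zero = by a
    where
    by : ∀ a → bit a ≡ bit a - bit a * 0ℚ
    by false = refl
    by true = refl
  𝟏-─ (a ∷ A) (true ∷ B) (suc v) = 𝟏-─ A B v
  𝟏-─ (a ∷ A) (false ∷ B) (suc v) = 𝟏-─ A B v

  𝟏-△ : ∀ {k} (A B : Subset k) v → 𝟏 (A △ B) v ≡ 𝟏 A v + 𝟏 B v - num 2 * (𝟏 A v * 𝟏 B v)
  𝟏-△ A B v = trans (𝟏-∪ (A ─ B) (B ─ A) v)
    (trans (cong₂ (λ p q → p + q - p * q) (𝟏-─ A B v) (𝟏-─ B A v)) (by (lookup A v) (lookup B v)))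
    where
    by : ∀ a b → (bit a - bit a * bit b) + (bit b - bit b * bit a) - (bit a - bit a * bit b) *
      (bit b - bit b * bit a) ≡ bit a + bit b - num 2 * (bit a * bit b)
    by false false = refl
    by false true = refl
    by true false = refl
    by true true = refl

  𝟏-⊥ : ∀ {k} (v : Fin k) → 𝟏 (Subset.⊥ {k}) v ≡ 0ℚ
  𝟏-⊥ zero = refl
  𝟏-⊥ (suc v) = 𝟏-⊥ v

  #∣A△B∣ : ∀ {k} (A B : Subset k) → # ∣ A △ B ∣ ≡ ∑[ v ] (𝟏 A v + 𝟏 B v - num 2 * (𝟏 A v * 𝟏 B v))
  #∣A△B∣ A B = trans #∣ A △ B ∣ (∑-cong (𝟏-△ A B))

  module _ {k : ℕ} (A S B : Subset k) where
    private
      D : Subset k → Fin k → ℚ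
      D B v = 𝟏 A v + 𝟏 B v - num 2 * (𝟏 A v * 𝟏 B v)

    △-insert : # ∣ A △ (S ∪ B) ∣ ≤ # ∣ A △ B ∣ + # ∣ S ∣
    △-insert = ℚ.≤-trans (ℚ.≤-reflexive (#∣A△B∣ A (S ∪ B))) (ℚ.≤-trans
      (∑-mono λ v → ℚ.≤-trans (ℚ.≤-reflexive (cong (λ t → 𝟏 A v + t - num 2 * (𝟏 A v * t)) (𝟏-∪ S B v)))
        (certify (0≤bit (lookup S v) ⊗ 0≤bit (lookup B v) ⊕ num≥0 2 ⊗
          (0≤bit (lookup A v) ⊗ 0≤bit (lookup S v)) ⊗ gap (bit≤1 (lookup B v)))
          (solve 3 (λ a s b → (a :+ b :- :# 2 :* (a :* b)) :+ s :-
            (a :+ (s :+ b :- s :* b) :- :# 2 :* (a :* (s :+ b :- s :* b))) := s :* b :+ :# 2 :* (a :* s) :*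
            (:1 :- b)) refl (𝟏 A v) (𝟏 S v) (𝟏 B v))))
      (ℚ.≤-reflexive (trans (∑-+ (D B) (𝟏 S)) (cong₂ _+_ (sym (#∣A△B∣ A B)) (sym #∣ S ∣)))))

    △-remove : # ∣ A △ B ∣ ≤ # ∣ A △ (S ∪ B) ∣ + # ∣ S ∣
    △-remove = ℚ.≤-trans (ℚ.≤-reflexive (#∣A△B∣ A B)) (ℚ.≤-trans
      (∑-mono λ v → ℚ.≤-trans
        (certify (0≤bit (lookup S v) ⊗ (0≤bit (lookup B v) ⊕ num≥0 2 ⊗
          (gap (bit≤1 (lookup A v)) ⊗ gap (bit≤1 (lookup B v)))))
          (solve 3 (λ a s b → (a :+ (s :+ b :- s :* b) :- :# 2 :* (a :* (s :+ b :- s :* b))) :+ s :-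
            (a :+ b :- :# 2 :* (a :* b)) := s :* (b :+ :# 2 :* ((:1 :- a) :* (:1 :- b)))) refl (𝟏 A v) (𝟏 S v)
            (𝟏 B v)))
        (ℚ.≤-reflexive (cong (λ t → 𝟏 A v + t - num 2 * (𝟏 A v * t) + 𝟏 S v) (sym (𝟏-∪ S B v)))))
      (ℚ.≤-reflexive (trans (∑-+ (D (S ∪ B)) (𝟏 S)) (cong₂ _+_ (sym (#∣A△B∣ A (S ∪ B))) (sym #∣ S ∣)))))

  module _ {k : ℕ} where
    _≟ˢ_ : (S T : Subset k) → Dec (S ≡ T)
    _≟ˢ_ = Vec.≡-dec Bool._≟_

    open DecMembership _≟ˢ_ using (_∈?_)

    -- Pigeonhole: if all of the repetition-free `𝒫` occurred in `𝒮`, its positions would inject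
    -- into the fewer positions of `𝒮`.
    new-element : ∀ (𝒮 𝒫 : List (Subset k)) → Unique 𝒫 → length 𝒮 ℕ.< length 𝒫 → ∃ λ S → S ∈ 𝒫 × S ∉ 𝒮
    new-element 𝒮 𝒫 u h = by (All.all? (_∈? 𝒮) 𝒫)
      where
      by : Dec (All (_∈ 𝒮) 𝒫) → ∃ λ S → S ∈ 𝒫 × S ∉ 𝒮
      by (no ¬all) with find (All.¬All⇒Any¬ (_∈? 𝒮) 𝒫 ¬all)
      ... | S , S∈ , S∉ = S , S∈ , S∉
      by (yes all) = ⊥-elim (ℕ.<⇒≱ h (Fin.injective⇒≤ {f = λ i → Any.index (∈𝒮 i)} λ {i} {j} e →
        lookup-injective u (Membershipₛ.index-injective (setoid (Subset k)) (∈𝒮 i) (∈𝒮 j) e)))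
        where
        ∈𝒮 : ∀ i → List.lookup 𝒫 i ∈ 𝒮
        ∈𝒮 i = All.lookup all (∈-lookup {xs = 𝒫} i)

    -- Adjusts the number of sets in a union. Each set added from the pool `𝒫` or dropped from the
    -- list costs at most its size `D` in the distance to `A`.
    module Resize (Good : Subset k → Set) (D : ℚ) (size : ∀ {S} → Good S → # ∣ S ∣ ≡ D) (0≤D : 0ℚ ≤ D)
      (𝒫 : List (Subset k)) (𝒫-unique : Unique 𝒫) (𝒫-good : All Good 𝒫) (A : Subset k) where

      Resized : ℕ → ℚ → Set
      Resized r e = ∃ λ 𝒮 → Unique 𝒮 × All Good 𝒮 × length 𝒮 ≡ r × # ∣ A △ ⋃ 𝒮 ∣ ≤ e

      private

        more : ∀ {e} j → e + # j * D + D ≡ e + # (suc j) * D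
        more {e} j = trans (solve 3 (λ e j D → e :+ j :* D :+ D := e :+ (:1 :+ j) :* D) refl e (# j) D)
          (cong (λ t → e + t * D) (sym (#-suc j)))

        none : ∀ e → e ≤ e + # 0 * D
        none e = ℚ.≤-reflexive (sym (trans (cong (λ t → e + t * D) (#≡num 0))
          (trans (cong (λ t → e + t) (ℚ.*-zeroˡ D)) (ℚ.+-identityʳ e))))

      grow : ∀ {e} j l → Resized l e → j ℕ.+ l ℕ.≤ length 𝒫 → Resized (j ℕ.+ l) (e + # j * D)
      grow {e} zero l (𝒮 , u , g , len , h) _ = 𝒮 , u , g , len , ℚ.≤-trans h (none e)
      grow {e} (suc j) l R h = step (grow j l R (ℕ.≤-trans (ℕ.n≤1+n _) h))
        where
        step : Resized (j ℕ.+ l) (e + # j * D) → Resized (suc j ℕ.+ l) (e + # (suc j) * D)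
        step (𝒮 , u , g , len , h′) = add (new-element 𝒮 𝒫 𝒫-unique (subst (ℕ._< length 𝒫) (sym len) h))
          where
          add : (∃ λ S → S ∈ 𝒫 × S ∉ 𝒮) → Resized (suc j ℕ.+ l) (e + # (suc j) * D)
          add (S , S∈ , S∉) = S ∷ 𝒮 , All.tabulate (λ {T} T∈ S≡T → S∉ (subst (_∈ 𝒮) (sym S≡T) T∈)) ∷ u ,
            All.lookup 𝒫-good S∈ ∷ g , cong suc len
            , ℚ.≤-trans (△-insert A S (⋃ 𝒮)) (ℚ.≤-trans
              (ℚ.+-mono-≤ h′ (ℚ.≤-reflexive (size (All.lookup 𝒫-good S∈)))) (ℚ.≤-reflexive (more {e} j)))

      shrink : ∀ {e} j l → Resized (j ℕ.+ l) e → Resized l (e + # j * D)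
      shrink {e} zero l (𝒮 , u , g , len , h) = 𝒮 , u , g , len , ℚ.≤-trans h (none e)
      shrink {e} (suc j) l (S ∷ 𝒮 , _ ∷ u , Sg ∷ g , len , h) = weaken
        (shrink {e + D} j l (𝒮 , u , g , ℕ.suc-injective len ,
          ℚ.≤-trans (△-remove A S (⋃ 𝒮)) (ℚ.+-mono-≤ h (ℚ.≤-reflexive (size Sg)))))
        where
        weaken : Resized l (e + D + # j * D) → Resized l (e + # (suc j) * D)
        weaken (𝒮 , u , g , len , h) = 𝒮 , u , g , len , ℚ.≤-trans h (ℚ.≤-reflexive (trans
          (solve 3 (λ e j D → e :+ D :+ j :* D := e :+ (:1 :+ j) :* D) refl e (# j) D)
            (cong (λ t → e + t * D) (sym (#-suc j)))))

      resize : ∀ {e} l r → Resized l e → r ℕ.≤ length 𝒫 → ∀ δ → # l - # r ≤ δ → # r - # l ≤ δ → Resized r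
        (e + δ * D)
      resize {e} l r R r≤ δ l-r≤ r-l≤ = by (ℕ.≤-total l r)
        where
        loosen : ∀ {e′} → e′ ≤ e + δ * D → Resized r e′ → Resized r (e + δ * D)
        loosen e′≤ (𝒮 , u , g , len , h) = 𝒮 , u , g , len , ℚ.≤-trans h e′≤
        bound : ∀ {j} → # j ≤ δ → e + # j * D ≤ e + δ * D
        bound {j} h = certify (gap h ⊗ 0≤D)
          (solve 4 (λ e δ j D → e :+ δ :* D :- (e :+ j :* D) := (δ :- j) :* D) refl e δ (# j) D)
        #-∸ : ∀ {p q} → p ℕ.≤ q → # (q ℕ.∸ p) ≡ # q - # p
        #-∸ {p} {q} p≤q = trans (solve 2 (λ a b → a := a :+ b :- b) refl (# (q ℕ.∸ p)) (# p))
          (cong (_- # p) (trans (sym (#-+ (q ℕ.∸ p) p)) (cong # (ℕ.m∸n+n≡m p≤q))))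
        by : l ℕ.≤ r ⊎ r ℕ.≤ l → Resized r (e + δ * D)
        by (inj₁ l≤r) = loosen (bound {r ℕ.∸ l} (subst (_≤ δ) (sym (#-∸ l≤r)) r-l≤))
          (subst (λ t → Resized t (e + # (r ℕ.∸ l) * D)) (ℕ.m∸n+n≡m l≤r)
            (grow (r ℕ.∸ l) l R (subst (ℕ._≤ length 𝒫) (sym (ℕ.m∸n+n≡m l≤r)) r≤)))
        by (inj₂ r≤l) = loosen (bound {l ℕ.∸ r} (subst (_≤ δ) (sym (#-∸ r≤l)) l-r≤))
          (shrink (l ℕ.∸ r) r (subst (λ t → Resized t e) (sym (ℕ.m∸n+n≡m r≤l)) R))

  unique-map : ∀ {A B : Set} {f : A → B} {xs : List A} → Unique xs →
    (∀ {x y} → x ∈ xs → y ∈ xs → f x ≡ f y → x ≡ y) → Unique (map f xs)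
  unique-map [] _ = []
  unique-map {xs = x ∷ xs} (x∉ ∷ u) inj =
    All.map⁺ (All.tabulate (λ y∈ e → All.lookup x∉ y∈ (inj (here refl) (there y∈) e))) ∷ unique-map u
      (λ x∈ y∈ → inj (there x∈) (there y∈))

  edges-at-first : ∀ {N k} → N ≡ suc k → Fin k → Edge N
  edges-at-first refl j = edge zero (suc j) (ℕ.s≤s ℕ.z≤n)

  edges-at-first-lo : ∀ {N k} (e : N ≡ suc k) j j′ → lo (edges-at-first e j) ≡ lo (edges-at-first e j′)
  edges-at-first-lo refl j j′ = refl

  edges-at-first-hi : ∀ {N k} (e : N ≡ suc k) {j j′} → hi (edges-at-first e j) ≡ hi (edges-at-first e j′) → j
    ≡ j′
  edges-at-first-hi refl refl = refl

  module Stars (n n′ : ℕ) (n≡1+n′ : n ≡ suc n′) where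
    open Counting n public

    starOf : Fin N × Fin N → Subset ∣V∣[ n ]
    starOf (i , j) = tabulate λ v → does (mate v i Fin.≟ j)

    star≡starOf : ∀ e → star n e ≡ starOf (lo e , hi e)
    star≡starOf e = Vec.tabulate-cong λ v → does-⇔ (mk⇔ (∈-mate v (lo e)) (λ { refl → mate-∈ v (lo e) }))
      (e ∈ᴱ? ⟦_⟧ {n} v) (mate v (lo e) Fin.≟ hi e)

    𝟏-starOf : ∀ i j v → 𝟏 (starOf (i , j)) v ≡ x i j v
    𝟏-starOf i j v = trans (cong bit (Vec.lookup∘tabulate (λ v → does (mate v i Fin.≟ j)) v))
      (by (mate v i Fin.≟ j))
      where
      by : (d : Dec (mate v i ≡ j)) → bit (does d) ≡ x i j v
      by (yes e) = sym (trans (cong (λ k → δ k j) e) (δ-refl j))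
      by (no ≢) = sym (δ-≢ ≢)

    D : ℚ
    D = # (oddFactorial n′)

    0<D : 0ℚ < D
    0<D = 0<# (oddFactorial>0 n′)

    #starOf : ∀ {i j} → i ≢ j → # ∣ starOf (i , j) ∣ ≡ D
    #starOf {i} {j} i≢j = trans #∣ starOf (i , j) ∣
      (trans (∑-cong λ v → trans (𝟏-starOf i j v) (sym (ℚ.*-identityʳ (x i j v))))
      (count n′ ((i , j) ∷ []) ((i≢j ∷ []) ∷ [] ∷ []) (sym n≡1+n′)))

    edge≢ : ∀ (e : Edge N) → lo e ≢ hi e
    edge≢ (edge i j i<j) = Fin.<⇒≢ (recompute (i Fin.<? j) i<j)

    #star : ∀ {S} → IsStar n S → # ∣ S ∣ ≡ D
    #star (e , refl) = trans (cong (λ T → # ∣ T ∣) (star≡starOf e)) (#starOf (edge≢ e))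

    -- Stars of two different edges at `i` are disjoint, and no star is empty. A common vertex
    -- matters: for n = 2 two disjoint edges have the same star.
    starOf-injective-hi : ∀ {i j j′} → i ≢ j → starOf (i , j) ≡ starOf (i , j′) → j ≡ j′
    starOf-injective-hi {i} {j} {j′} i≢j e = by (j Fin.≟ j′)
      where
      by : Dec (j ≡ j′) → j ≡ j′
      by (yes q) = q
      by (no j≢j′) = ⊥-elim (ℚ.<-irrefl (sym
        (trans (sym (#starOf i≢j)) (trans #∣ starOf (i , j) ∣ (∑-zero vanish)))) 0<D)
        where
        vanish : ∀ v → 𝟏 (starOf (i , j)) v ≡ 0ℚ
        vanish v = by′ (mate v i Fin.≟ j)
          where
          by′ : Dec (mate v i ≡ j) → 𝟏 (starOf (i , j)) v ≡ 0ℚ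
          by′ (no ≢) = trans (𝟏-starOf i j v) (δ-≢ ≢)
          by′ (yes q) = trans (cong (λ S → 𝟏 S v) e)
            (trans (𝟏-starOf i j′ v) (δ-≢ λ q′ → j≢j′ (trans (sym q) q′)))

    N≡ : N ≡ suc (suc (2 ℕ.* n′))
    N≡ = trans (cong (2 ℕ.*_) n≡1+n′) (ℕ.*-suc 2 n′)

    -- The stars at one fixed vertex, 2n-1 different ones for every n. As c ≤ (2n-1)/2, this supply
    -- is enough for round(c) stars.
    pool : List (Subset ∣V∣[ n ])
    pool = List.tabulate (λ j → star n (edges-at-first N≡ j))

    length-pool : length pool ≡ suc (2 ℕ.* n′)
    length-pool = length-tabulate (λ j → star n (edges-at-first N≡ j))

    pool-stars : All (IsStar n) pool
    pool-stars = All.tabulate⁺ λ j → edges-at-first N≡ j , refl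

    pool-unique : Unique pool
    pool-unique = Unique.tabulate⁺ λ {j} {j′} e → edges-at-first-hi N≡
      (starOf-injective-hi (edge≢ (edges-at-first N≡ j))
      (trans (sym (star≡starOf (edges-at-first N≡ j))) (trans e (trans (star≡starOf (edges-at-first N≡ j′))
        (cong (λ i → starOf (i , hi (edges-at-first N≡ j′))) (edges-at-first-lo N≡ j′ j))))))

  -- Rounding

  floor-spec : ∀ q → 0ℚ ≤ q → ∃ λ r → ℚ.floor q ≡ ℤ.+ r × # r ≤ q × q ≤ # r + 1ℚ
  floor-spec (mkℚ ℤ.-[1+ a ] d _) (*≤* ())
  floor-spec q@(mkℚ (ℤ.+ a) d _) _ = r , ℤ.*-identityˡ (ℤ.+ r) , r≤q , q≤r+1
    where
    r : ℕ
    r = a ℕ./ suc d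
    q*d : # (suc d) * q ≡ # a
    q*d = trans (cong (λ t → # (suc d) * t) (sym (ℚ.↥p/↧p≡p q)))
      (trans (ℚ.*-comm (# (suc d)) (ℤ.+ a / suc d)) (a/n*n≡a a d))
    a≡ : # a ≡ # (a ℕ.% suc d) + # r * # (suc d)
    a≡ = trans (cong # (ℕ.m≡m%n+[m/n]*n a (suc d)))
      (trans (#-+ (a ℕ.% suc d) (r ℕ.* suc d)) (cong (λ t → # (a ℕ.% suc d) + t) (#-* r (suc d))))
    r≤q : # r ≤ q
    r≤q = cancelˡ-≤ (0<#suc d) (certify (0≤# (a ℕ.% suc d)) (trans (cong (_- # (suc d) * # r) (trans q*d a≡))
        (solve 3 (λ e r d → e :+ r :* d :- d :* r := e) refl (# (a ℕ.% suc d)) (# r) (# (suc d)))))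
    q≤r+1 : q ≤ # r + 1ℚ
    q≤r+1 = cancelˡ-≤ (0<#suc d) (certify (gap (#-mono-≤ (ℕ.<⇒≤ (ℕ.m%n<n a (suc d)))))
      (trans (cong (λ t → # (suc d) * (# r + 1ℚ) - t) (trans q*d a≡))
        (solve 3 (λ e r d → d :* (r :+ :1) :- (e :+ r :* d) := d :- e) refl (# (a ℕ.% suc d)) (# r)
          (# (suc d)))))

  round-spec : ∀ c → 0ℚ ≤ c → ∃ λ r → ℚ.round c ≡ ℤ.+ r × # r ≤ c + ½ × c ≤ # r + ½
  round-spec c 0≤c with c ℚ.≤ᵇ 0ℚ in eq
  -- `ℚ.round` takes the ceiling of c - ½ when c ≤ 0; here c is zero, and -½ is rounded up to 0.
  ... | true = 0 , trans (cong (λ t → ℚ.ceiling (t - ½)) c≡0) refl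
      , ℚ.≤-trans (ℚ.≤-reflexive (#≡num 0)) (0≤c ⊕ ℚ.nonNegative⁻¹ ½)
      , ℚ.≤-trans (ℚ.≤-reflexive c≡0) (0≤# 0 ⊕ ℚ.nonNegative⁻¹ ½)
    where
    c≡0 : c ≡ 0ℚ
    c≡0 = ℚ.≤-antisym (ℚ.≤ᵇ⇒≤ (subst Bool.T (sym eq) _)) 0≤c
  ... | false = proj₁ spec , proj₁ (proj₂ spec) , proj₁ (proj₂ (proj₂ spec))
      , certify (gap (proj₂ (proj₂ (proj₂ spec))))
        (solve 2 (λ c r → r :+ :½ :- c := r :+ :1 :- (c :+ :½)) refl c (# (proj₁ spec)))
    where
    spec : ∃ λ r → ℚ.floor (c + ½) ≡ ℤ.+ r × # r ≤ c + ½ × c + ½ ≤ # r + 1ℚ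
    spec = floor-spec (c + ½) (0≤c ⊕ ℚ.nonNegative⁻¹ ½)

  -- A closest integer is no further from c than any other, so the bound for the number of large
  -- entries passes to round(c). If k < r, for instance, then r - c ≤ ½ ≤ c - k.
  nearest : ∀ c r k → # r ≤ c + ½ → c ≤ # r + ½ → ∀ e → c - # k ≤ e → # k - c ≤ e → c - # r ≤ e × # r - c ≤ e
  nearest c r k r≤ ≤r e c-k k-c = by (ℕ.<-cmp k r)
    where
    step : ∀ {i j} → i ℕ.< j → # i + 1ℚ ≤ # j
    step {i} {j} i<j = ℚ.≤-trans (ℚ.≤-reflexive (trans (ℚ.+-comm (# i) 1ℚ) (sym (#-suc i)))) (#-mono-≤ i<j)
    by : Tri (k ℕ.< r) (k ≡ r) (r ℕ.< k) → c - # r ≤ e × # r - c ≤ e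
    by (tri≈ _ refl _) = c-k , k-c
    by (tri< k<r _ _) = certify (gap c-k ⊕ gap (step k<r) ⊕ num≥0 1)
        (solve 4 (λ c k r e → e :- (c :- r) := (e :- (c :- k)) :+ (r :- (k :+ :1)) :+ :1) refl c (# k) (# r)
          e) , certify (gap c-k ⊕ gap r≤ ⊕ gap r≤ ⊕ gap (step k<r))
          (solve 4 (λ c k r e → e :- (r :- c) := (e :- (c :- k)) :+ (c :+ :½ :- r) :+ (c :+ :½ :- r) :+
            (r :- (k :+ :1))) refl c (# k) (# r) e)
    by (tri> _ _ r<k) = certify (gap k-c ⊕ gap ≤r ⊕ gap ≤r ⊕ gap (step r<k))
        (solve 4 (λ c k r e → e :- (c :- r) := (e :- (k :- c)) :+ (r :+ :½ :- c) :+ (r :+ :½ :- c) :+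
          (k :- (r :+ :1))) refl c (# k) (# r) e) , certify (gap k-c ⊕ gap (step r<k) ⊕ num≥0 1)
          (solve 4 (λ c k r e → e :- (r :- c) := (e :- (k :- c)) :+ (k :- (r :+ :1)) :+ :1) refl c (# k) (# r)
            e)

  -- For r ≥ 1, c ≥ r - ½ ≥ r/2.
  round≤2c : ∀ c r → 0ℚ ≤ c → # r ≤ c + ½ → # r ≤ num 2 * c
  round≤2c c zero 0≤c _ = ℚ.≤-trans (ℚ.≤-reflexive (#≡num 0)) (num≥0 2 ⊗ 0≤c)
  round≤2c c (suc r) 0≤c h = certify (gap h ⊕ gap h ⊕ 0≤# r)
    (trans (cong (λ t → num 2 * c - t) (#-suc r)) (trans
      (solve 2 (λ c r → :# 2 :* c :- (:1 :+ r) := (c :+ :½ :- (:1 :+ r)) :+ (c :+ :½ :- (:1 :+ r)) :+ r) refl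
        c (# r)) (cong (λ t → (c + ½ - t) + (c + ½ - t) + # r) (sym (#-suc r)))))

  oddFactorial-mono : ∀ {k l} → k ℕ.≤ l → oddFactorial k ℕ.≤ oddFactorial l
  oddFactorial-mono {zero} {l} _ = oddFactorial>0 l
  oddFactorial-mono {suc k} {suc l} (ℕ.s≤s h) = ℕ.*-mono-≤ (ℕ.s≤s (ℕ.*-monoʳ-≤ 2 h)) (oddFactorial-mono h)

  opaque
    -- Beyond this, 160/(2n-1) ≤ 1.
    threshold : ℕ
    threshold = 80

    threshold≡80 : threshold ≡ 80
    threshold≡80 = refl

    -- Sets of at least one matching have c ≥ 1/(2n-3)!!, which settles small n.
    K : ℚ
    K = # (oddFactorial threshold)

    oddFactorial≤K : ∀ {k} → k ℕ.≤ threshold → # (oddFactorial k) ≤ K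
    oddFactorial≤K h = #-mono-≤ (oddFactorial-mono h)

    1≤K : 1ℚ ≤ K
    1≤K = subst (_≤ K) (#≡num 1) (#-mono-≤ (oddFactorial>0 threshold))

    C : ℚ
    C = num 2000 * K

    C≡ : C ≡ num 2000 * K
    C≡ = refl

    2000≤C : num 2000 ≤ C
    2000≤C = certify (num≥0 2000 ⊗ gap 1≤K)
        (solve 1 (λ K → :# 2000 :* K :- :# 2000 := :# 2000 :* (K :- :1)) refl K)

  -- From approximate families of stars to exactly round(c) stars.

  module Conclusion (n n′ : ℕ) (n≡1+n′ : n ≡ suc n′) (A : Subset ∣V∣[ n ]) (c : ℚ)
    (#A : # ∣ A ∣ ≡ c * # (oddFactorial n′)) (0≤c : 0ℚ ≤ c) (c≤ : c * num 2 ≤ # (suc (2 ℕ.* n′))) where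
    open Stars n n′ n≡1+n′ public
    open Resize (IsStar n) D #star (ℚ.<⇒≤ 0<D) pool pool-unique pool-stars A public

    τ₀ : ℚ
    τ₀ = ℤ.+ 1 / suc (2 ℕ.* n′)

    0≤τ₀ : 0ℚ ≤ τ₀
    0≤τ₀ = ℚ.<⇒≤ (0<1/suc (2 ℕ.* n′))

    -- The conclusion of the theorem with a rational `κ` in place of √ε; the two inequalities on `c`
    -- and `r` bound the absolute value.
    record Outcome (κ : ℚ) : Set where
      field
        r       : ℕ
        round≡  : ℚ.round c ≡ ℤ.+ r
        stars   : Resized r (C * (c * c) * D * (κ + τ₀))
        c-r     : c - # r ≤ C * (c * c) * (κ + τ₀)
        r-c     : # r - c ≤ C * (c * c) * (κ + τ₀)

    private
      spec : ∃ λ r → ℚ.round c ≡ ℤ.+ r × # r ≤ c + ½ × c ≤ # r + ½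
      spec = round-spec c 0≤c

      r : ℕ
      r = proj₁ spec

      r≤ : # r ≤ c + ½
      r≤ = proj₁ (proj₂ (proj₂ spec))

      r≤pool : r ℕ.≤ length pool
      r≤pool = subst (r ℕ.≤_) (sym length-pool) (#-cancel-≤ {r} (cancelˡ-≤ (ℚ.positive⁻¹ (num 2)) (certify
        (num≥0 2 ⊗ gap r≤ ⊕ gap c≤ ⊕ 0≤# (2 ℕ.* n′))
          (trans (cong (λ t → num 2 * t - num 2 * # r) (#-suc (2 ℕ.* n′)))
          (trans
            (solve 3 (λ c r N → :# 2 :* (:1 :+ N) :- :# 2 :* r := :# 2 :* (c :+ :½ :- r) :+
              (:1 :+ N :- c :* :# 2) :+ N) refl c (# r) (# (2 ℕ.* n′)))
              (cong (λ t → num 2 * (c + ½ - # r) + (t - c * num 2) + # (2 ℕ.* n′))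
              (sym (#-suc (2 ℕ.* n′)))))))))

      A△∅ : # ∣ A △ ⋃ [] ∣ ≤ c * D
      A△∅ = ℚ.≤-reflexive (trans (#∣A△B∣ A Subset.⊥)
        (trans (∑-cong λ v → trans (cong (λ t → 𝟏 A v + t - num 2 * (𝟏 A v * t)) (𝟏-⊥ v))
          (solve 1 (λ a → a :+ :0 :- :# 2 :* (a :* :0) := a) refl (𝟏 A v))) (trans (sym #∣ A ∣) #A)))

      weaken : ∀ {r e e′} → e ≤ e′ → Resized r e → Resized r e′
      weaken h (𝒮 , u , g , len , k) = 𝒮 , u , g , len , ℚ.≤-trans k h

    -- If the permitted error is this large, any `r` stars will do: `A` has `c D` members, and `r`
    -- stars have at most `2 c D`, since r ≤ 2c.
    trivial : ∀ {κ} → num 3 * c ≤ C * (c * c) * (κ + τ₀) → Outcome κ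
    trivial {κ} 3c≤ = record
      { r = r
      ; round≡ = proj₁ (proj₂ spec)
      ; stars = weaken bound (resize 0 r ([] , [] , [] , refl , A△∅) r≤pool (num 2 * c)
          (certify (num≥0 2 ⊗ 0≤c ⊕ 0≤# r) (trans (cong (λ t → num 2 * c - (t - # r)) (#≡num 0))
            (solve 2 (λ c r → :# 2 :* c :- (:0 :- r) := :# 2 :* c :+ r) refl c (# r))))
          (ℚ.≤-trans (ℚ.≤-reflexive (trans (cong (λ t → # r - t) (#≡num 0))
            (solve 1 (λ r → r :- :0 := r) refl (# r)))) (round≤2c c r 0≤c r≤)))
      ; c-r = certify (gap 3c≤ ⊕ num≥0 2 ⊗ 0≤c ⊕ 0≤# r)
        (solve 3 (λ c r X → X :- (c :- r) := (X :- :# 3 :* c) :+ :# 2 :* c :+ r) refl c (# r)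
          (C * (c * c) * (κ + τ₀)))
      ; r-c = certify (gap 3c≤ ⊕ gap (round≤2c c r 0≤c r≤) ⊕ num≥0 2 ⊗ 0≤c)
        (solve 3 (λ c r X → X :- (r :- c) := (X :- :# 3 :* c) :+ (:# 2 :* c :- r) :+ :# 2 :* c) refl c (# r)
          (C * (c * c) * (κ + τ₀)))
      }
      where
      bound : c * D + num 2 * c * D ≤ C * (c * c) * D * (κ + τ₀)
      bound = certify (ℚ.<⇒≤ 0<D ⊗ gap 3c≤)
          (solve 4 (λ c D C k → C :* (c :* c) :* D :* k :- (c :* D :+ :# 2 :* c :* D) := D :*
            (C :* (c :* c) :* k :- :# 3 :* c)) refl c D C (κ + τ₀))

    c≡0⇒outcome : c ≡ 0ℚ → Outcome 0ℚ
    c≡0⇒outcome c≡0 = trivial (ℚ.≤-reflexive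
      (trans (cong (num 3 *_) c≡0) (sym (trans (cong (λ c → C * (c * c) * (0ℚ + τ₀)) c≡0)
        (solve 2 (λ C t → C :* (:0 :* :0) :* (:0 :+ t) := :# 3 :* :0) refl C τ₀)))))

    -- A nonempty `A` has c at least 1/(2n-3)!!, so `c K ≥ 1` and the factor `K` of `C` removes one
    -- power of c. With 2n-1 ≤ 161, `2000 c τ₀` exceeds `3 c`.
    small-n : n′ ℕ.≤ threshold → Outcome 0ℚ
    small-n n′≤ = by ∣ A ∣ refl
      where
      by : ∀ k → ∣ A ∣ ≡ k → Outcome 0ℚ
      by zero e = c≡0⇒outcome (cancelˡ-≡ 0<D
        (trans (ℚ.*-comm D c) (trans (sym #A) (trans (cong # e) (trans (#≡num 0) (sym (ℚ.*-zeroʳ D)))))))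
      by (suc k) e = trivial (certify
        (num≥0 2000 ⊗ (0≤c ⊗ 0≤τ₀ ⊗ gap 1≤cK) ⊕ num≥0 10 ⊗ (0≤c ⊗ (0≤τ₀ ⊗ gap N≤161 ⊕ num≥0 38 ⊗ 0≤τ₀)) ⊕
          num≥0 7 ⊗ 0≤c)
        (trans (cong (λ C → C * (c * c) * (0ℚ + τ₀) - num 3 * c) C≡) (trans
          (solve 3 (λ c τ K → :# 2000 :* K :* (c :* c) :* (:0 :+ τ) :- :# 3 :* c := :# 2000 :*
            (c :* τ :* (c :* K :- :1)) :+ (:# 2000 :* (c :* τ) :- :# 10 :* c :* :1) :+ :# 7 :* c) refl c τ₀ K)
            (trans (cong (λ t → num 2000 * (c * τ₀ * (c * K - 1ℚ)) + (num 2000 * (c * τ₀) - num 10 * c * t) +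
            num 7 * c) (sym (1/n*n≡1 (2 ℕ.* n′))))
            (solve 4 (λ c τ K N → :# 2000 :* (c :* τ :* (c :* K :- :1)) :+
              (:# 2000 :* (c :* τ) :- :# 10 :* c :* (τ :* N)) :+ :# 7 :* c := :# 2000 :*
              (c :* τ :* (c :* K :- :1)) :+ :# 10 :* (c :* (τ :* (:# 162 :- N) :+ :# 38 :* τ)) :+ :# 7 :* c)
              refl c τ₀ K (# (suc (2 ℕ.* n′))))))))
        where
        1≤cK : 1ℚ ≤ c * K
        1≤cK = ℚ.≤-trans (ℚ.≤-trans (ℚ.≤-trans (ℚ.≤-reflexive (sym (#≡num 1)))
          (#-mono-≤ {1} {suc k} (ℕ.s≤s ℕ.z≤n))) (ℚ.≤-reflexive (trans (cong # (sym e)) #A)))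
          (monoˡ-≤ 0≤c (oddFactorial≤K n′≤))
        N≤161 : # (suc (2 ℕ.* n′)) ≤ num 162
        N≤161 = ℚ.≤-trans (#-mono-≤ {suc (2 ℕ.* n′)} {162}
          (ℕ.≤-trans (ℕ.s≤s (ℕ.*-monoʳ-≤ 2 (subst (n′ ℕ.≤_) threshold≡80 n′≤))) (ℕ.n≤1+n 161)))
          (ℚ.≤-reflexive (#≡num 162))

    -- Both the list length and `r` are within 388z of c, so at most 776z stars are added or
    -- dropped. The total 918 + 776 stays below 2000, which is where that factor of `C` comes from.
    from-list : ∀ {κ} (P : List (Fin N × Fin N)) → Unique (map starOf P) → All Ordered P → ∀ z → z ≡ c * c *
      (κ + τ₀) → 0ℚ ≤ z →
      # ∣ A △ ⋃ (map starOf P) ∣ ≤ num 918 * z * D → c - # (length P) ≤ num 388 * z → # (length P) - c ≤ num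
        388 * z → Outcome κ
    from-list {κ} P u ord z z≡ 0≤z dist c-M M-c = record
      { r = r
      ; round≡ = proj₁ (proj₂ spec)
      ; stars = weaken bound (resize {num 918 * z * D} (length P) r
        (map starOf P , u , good , length-map starOf P , dist) r≤pool (num 776 * z)
          (certify (gap M-c ⊕ gap (proj₁ near))
            (solve 4 (λ c M r z → :# 776 :* z :- (M :- r) := (:# 388 :* z :- (M :- c)) :+
              (:# 388 :* z :- (c :- r))) refl c (# (length P)) (# r) z))
          (certify (gap c-M ⊕ gap (proj₂ near))
            (solve 4 (λ c M r z → :# 776 :* z :- (r :- M) := (:# 388 :* z :- (c :- M)) :+
              (:# 388 :* z :- (r :- c))) refl c (# (length P)) (# r) z)))
      ; c-r = ℚ.≤-trans (proj₁ near) bound′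
      ; r-c = ℚ.≤-trans (proj₂ near) bound′
      }
      where
      good : All (IsStar n) (map starOf P)
      good = All.map⁺ (All.map (λ {(i , j)} i<j → edge i j i<j , sym (star≡starOf (edge i j i<j))) ord)
      near : c - # r ≤ num 388 * z × # r - c ≤ num 388 * z
      near = nearest c r (length P) r≤ (proj₂ (proj₂ (proj₂ spec))) (num 388 * z) c-M M-c
      bound : num 918 * z * D + num 776 * z * D ≤ C * (c * c) * D * (κ + τ₀)
      bound = ℚ.≤-trans (certify (gap 2000≤C ⊗ (0≤z ⊗ ℚ.<⇒≤ 0<D) ⊕ num≥0 306 ⊗ (0≤z ⊗ ℚ.<⇒≤ 0<D))
          (solve 3 (λ C z D → C :* z :* D :- (:# 918 :* z :* D :+ :# 776 :* z :* D) := (C :- :# 2000) :*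
            (z :* D) :+ :# 306 :* (z :* D)) refl C z D)) (ℚ.≤-reflexive (trans (cong (λ z → C * z * D) z≡)
            (solve 4 (λ C c D k → C :* (c :* k) :* D := C :* c :* D :* k) refl C (c * c) D (κ + τ₀))))
      bound′ : num 388 * z ≤ C * (c * c) * (κ + τ₀)
      bound′ = ℚ.≤-trans (certify (gap 2000≤C ⊗ 0≤z ⊕ num≥0 1612 ⊗ 0≤z)
          (solve 2 (λ C z → C :* z :- :# 388 :* z := (C :- :# 2000) :* z :+ :# 1612 :* z) refl C z))
            (ℚ.≤-reflexive (trans (cong (C *_) z≡) (sym (ℚ.*-assoc C (c * c) (κ + τ₀)))))

  module Large (n m : ℕ) (n≡3+m : n ≡ suc (suc (suc m))) (m-large : threshold ℕ.≤ suc (suc m))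
    (A : Subset ∣V∣[ n ]) (c : ℚ)
    (#A : # ∣ A ∣ ≡ c * # (oddFactorial (suc (suc m)))) (0<c : 0ℚ < c)
      (c≤ : c * num 2 ≤ # (suc (2 ℕ.* suc (suc m)))) where
    open Conclusion n (suc (suc m)) n≡3+m A c #A (ℚ.<⇒≤ 0<c) c≤
    private module S = Stability n m n≡3+m

    ∑𝟏A : ∑ (𝟏 A) ≡ c * S.t₁
    ∑𝟏A = trans (sym #∣ A ∣) #A

    module M = S.Density (𝟏 A) (λ v → bit-bool (lookup A v)) c ∑𝟏A 0<c (ℚ.≤-trans c≤ (ℚ.≤-reflexive S.h₄))

    τ≡τ₀ : S.τ ≡ τ₀
    τ≡τ₀ = cong (λ t → ℤ.+ 1 / suc t) (sym (trans (ℕ.*-suc 2 (suc m)) (cong (2 ℕ.+_) (ℕ.*-suc 2 m))))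

    τ-small : num 160 * S.τ ≤ 1ℚ
    τ-small = ℚ.≤-trans (certify (gap 160≤ ⊗ S.0≤τ)
        (solve 2 (λ τ N → τ :* N :- :# 160 :* τ := (N :- :# 160) :* τ) refl S.τ (S.h + num 4)))
          (ℚ.≤-reflexive S.τ≡)
      where
      160≤ : num 160 ≤ S.h + num 4
      160≤ = ℚ.≤-trans (ℚ.≤-reflexive (sym (#≡num 160))) (ℚ.≤-trans
        (#-mono-≤ {160} {suc (2 ℕ.* suc (suc m))}
          (ℕ.m≤n⇒m≤1+n (ℕ.*-monoʳ-≤ 2 (subst (ℕ._≤ suc (suc m)) threshold≡80 m-large))))
        (ℚ.≤-reflexive S.h₄))

    module _ (η : ℚ) (0≤η : 0ℚ ≤ η) (W≡ : M.W ≡ η * (c * S.t₁)) (η-small : num 100 * η ≤ 1ℚ) where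

      -- Here `C c² (η + τ)` is at least 20c, so the trivial choice of stars is good enough.
      far : 1ℚ ≤ num 100 * (c * (η + S.τ)) → Outcome η
      far h = trivial (subst (λ t → num 3 * c ≤ C * (c * c) * (η + t)) τ≡τ₀ (certify
        (gap 2000≤C ⊗ (M.0≤c ⊗ M.0≤c ⊗ (0≤η ⊕ S.0≤τ)) ⊕ num≥0 20 ⊗ (M.0≤c ⊗ gap h) ⊕ num≥0 17 ⊗ M.0≤c)
          (solve 3 (λ C c k → C :* (c :* c) :* k :- :# 3 :* c := (C :- :# 2000) :* (c :* c :* k) :+ :# 20 :*
            (c :* (:# 100 :* (c :* k) :- :1)) :+ :# 17 :* c) refl C c (η + S.τ))))

      near : num 100 * (c * (η + S.τ)) ≤ 1ℚ → Outcome η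
      near h = from-list M.large stars-unique (All.tabulate (λ e∈ → proj₁ (M.large-sound e∈)))
        (c * c * (η + S.τ)) (cong (λ t → c * c * (η + t)) τ≡τ₀) (M.0≤c ⊗ M.0≤c ⊗ (0≤η ⊕ S.0≤τ))
        (ℚ.≤-trans (ℚ.≤-reflexive (trans (#∣A△B∣ A (⋃ (map starOf M.large)))
          (∑-cong λ v → cong (λ t → 𝟏 A v + t - num 2 * (𝟏 A v * t)) (𝟏-⋃ M.large v))))
          (M.dist≤ η 0≤η W≡ η-small h τ-small))
        (ℚ.≤-trans (M.c-M≤ η 0≤η W≡ η-small h τ-small) (certify (num≥0 210 ⊗ (M.0≤c ⊗ M.0≤c ⊗ (0≤η ⊕ S.0≤τ)))
          (solve 1 (λ z → :# 388 :* z :- :# 178 :* z := :# 210 :* z) refl (c * c * (η + S.τ)))))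
        (M.M-c≤ η 0≤η W≡ η-small h τ-small)
        where
        𝟏-⋃ : ∀ P v → 𝟏 (⋃ (map starOf P)) v ≡ S.union P v
        𝟏-⋃ [] v = 𝟏-⊥ v
        𝟏-⋃ ((i , j) ∷ P) v = trans (𝟏-∪ (starOf (i , j)) (⋃ (map starOf P)) v)
          (cong₂ (λ s t → s + t - s * t) (𝟏-starOf i j v) (𝟏-⋃ P v))
        ordered : ∀ {e} → e ∈ M.large → Ordered e
        ordered e∈ = proj₁ (M.large-sound e∈)
        -- If two different edges had the same star, its `t₁` members would all contain both edges,
        -- so `t₁ ≤ t₂`. But `t₂ ≤ 2 τ t₁ ≤ t₁/80`.
        stars-unique : Unique (map starOf M.large)
        stars-unique = unique-map M.large-unique λ {e} {e′} e∈ e′∈ same → by e∈ e′∈ same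
          (≡-dec Fin._≟_ Fin._≟_ e e′)
          where
          by : ∀ {e e′} → e ∈ M.large → e′ ∈ M.large → starOf e ≡ starOf e′ → Dec (e ≡ e′) → e ≡ e′
          by _ _ _ (yes q) = q
          by {i , j} {k , l} e∈ e′∈ same (no e≢e′) = ⊥-elim
            (ℚ.<-irrefl refl (ℚ.<-≤-trans S.0<t₁
            (cancelˡ-≤ (ℚ.positive⁻¹ (num 79)) (certify {num 79 * S.t₁} {num 79 * 0ℚ}
              (num≥0 80 ⊗ gap t₁≤t₂ ⊕ num≥0 80 ⊗ gap (M.t₂≤2τt₁ η 0≤η W≡ η-small h τ-small) ⊕ gap τ-small ⊗
                M.0≤t₁ η 0≤η W≡ η-small h τ-small)
                (solve 3 (λ t₁ t₂ τ → :# 79 :* :0 :- :# 79 :* t₁ := :# 80 :* (t₂ :- t₁) :+ :# 80 :*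
                  (:# 2 :* τ :* t₁ :- t₂) :+ (:1 :- :# 160 :* τ) :* t₁) refl S.t₁ S.t₂ S.τ)))))
            where
            t₁≤t₂ : S.t₁ ≤ S.t₂
            t₁≤t₂ = ℚ.≤-trans (ℚ.≤-reflexive (trans (sym (S.∑x (Fin.<⇒≢ (ordered e∈))))
              (∑-cong λ v → trans (idem v (S.x-bool i j v))
                (cong (S.x i j v *_) (trans (sym (𝟏-starOf i j v))
                  (trans (cong (λ T → 𝟏 T v) same) (𝟏-starOf k l v)))))))
              (S.codegree (ordered e∈) (ordered e′∈) e≢e′)
              where
              idem : ∀ v → S.x i j v ≡ 0ℚ ⊎ S.x i j v ≡ 1ℚ → S.x i j v ≡ S.x i j v * S.x i j v
              idem v (inj₁ q) = trans q (sym (cong (λ t → t * t) q))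
              idem v (inj₂ q) = trans q (sym (cong (λ t → t * t) q))

      outcome : Outcome η
      outcome = by (ℚ.≤-total (num 100 * (c * (η + S.τ))) 1ℚ)
        where
        by : num 100 * (c * (η + S.τ)) ≤ 1ℚ ⊎ 1ℚ ≤ num 100 * (c * (η + S.τ)) → Outcome η
        by (inj₁ h) = near h
        by (inj₂ h) = far h

  -- Real numbers

  Eventually : (ℕ → Set) → Set
  Eventually P = ∃ λ K → ∀ k → K ℕ.≤ k → P k

  both : ∀ {P Q R : ℕ → Set} → (∀ k → P k → Q k → R k) → Eventually P → Eventually Q → Eventually R
  both f (K , p) (L , q) = K ℕ.⊔ L , λ k h → f k (p k (ℕ.m⊔n≤o⇒m≤o K L h)) (q k (ℕ.m⊔n≤o⇒n≤o K L h))

  eventually-all : ∀ {l} {P : Fin l → ℕ → Set} → (∀ v → Eventually (P v)) → Eventually (λ k → ∀ v → P v k)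
  eventually-all {zero} h = 0 , λ _ _ ()
  eventually-all {suc l} {P} h = both (λ k p q → λ { zero → p ; (suc v) → q v }) (h zero)
    (eventually-all {l} {λ v → P (suc v)} (λ v → h (suc v)))

  ∣q∣≤⇒≤ : ∀ {q e} → ℚ.∣ q ∣ ≤ e → q ≤ e × - q ≤ e
  ∣q∣≤⇒≤ {q} {e} h = upper q h , upper (- q) (subst (_≤ e) (sym (ℚ.∣-p∣≡∣p∣ q)) h)
    where
    upper : ∀ p → ℚ.∣ p ∣ ≤ e → p ≤ e
    upper p h with ℚ.≤-total 0ℚ p
    ... | inj₁ 0≤p = subst (_≤ e) (ℚ.0≤p⇒∣p∣≡p 0≤p) h
    ... | inj₂ p≤0 = ℚ.≤-trans p≤0 (ℚ.≤-trans (ℚ.0≤∣p∣ p) h)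

  0<* : ∀ {p q} → 0ℚ < p → 0ℚ < q → 0ℚ < p * q
  0<* {p} {q} 0<p 0<q = subst (_< p * q) (ℚ.*-zeroʳ p) (ℚ.*-monoʳ-<-pos p {{ℚ.positive 0<p}} 0<q)

  scale : ∀ B {t} → 0ℚ ≤ B → 0ℚ < t → ∃ λ δ → 0ℚ < δ × δ ≤ 1ℚ × B * δ ≤ t
  scale B {t} 0≤B 0<t = go (inverse {B + 1ℚ + t} 0<M)
    where
    M : ℚ
    M = B + 1ℚ + t
    0≤t : 0ℚ ≤ t
    0≤t = ℚ.<⇒≤ 0<t
    0<M : 0ℚ < M
    0<M = ℚ.<-≤-trans 0<t (certify (0≤B ⊕ num≥0 1) (solve 2 (λ B t → B :+ :1 :+ t :- t := B :+ :1) refl B t))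
    go : (∃ λ r → r * M ≡ 1ℚ × 0ℚ < r) → ∃ λ δ → 0ℚ < δ × δ ≤ 1ℚ × B * δ ≤ t
    -- The witness is t/(B + 1 + t): the 1 makes the denominator exceed `B`, and the summand `t`
    -- keeps the quotient at most 1.
    go (r , rM , 0<r) = r * t , 0<* 0<r 0<t
      , certify (ℚ.<⇒≤ 0<r ⊗ (0≤B ⊕ num≥0 1)) (trans (cong (_- r * t) (sym rM))
        (solve 3 (λ r t B → r :* (B :+ :1 :+ t) :- r :* t := r :* (B :+ :1)) refl r t B))
      , certify (ℚ.<⇒≤ 0<r ⊗ (0≤t ⊗ (num≥0 1 ⊕ 0≤t)))
        (trans (cong (_- B * (r * t)) (trans (sym (ℚ.*-identityʳ t)) (cong (t *_) (sym rM))))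
        (solve 3 (λ r t B → t :* (r :* (B :+ :1 :+ t)) :- B :* (r :* t) := r :* (t :* (:1 :+ t))) refl r t B))

  sum-seq : ∀ {l} (f : ℝ[ l ]) k → seq (sum f) k ≡ ∑[ v ] seq (f v) k
  sum-seq {zero} f k = sym (∑-nil (λ v → seq (f v) k))
  sum-seq {suc l} f k = trans (cong (λ t → seq (f zero) k + t) (sum-seq (λ v → f (suc v)) k))
    (sym (∑-cons (λ v → seq (f v) k)))

  mean-seq : ∀ {l} (f : ℝ[ l ]) k → # l * seq (mean f) k ≡ ∑[ v ] seq (f v) k
  mean-seq {zero} f k = trans (cong (_* 0ℚ) (#≡num 0)) (sym (∑-nil (λ v → seq (f v) k)))
  mean-seq {suc l} f k = trans (solve 3 (λ l r s → l :* (r :* s) := r :* l :* s) refl (# (suc l))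
    (ℤ.+ 1 / suc l) (seq (sum f) k))
    (trans (cong (_* seq (sum f) k) (1/n*n≡1 l)) (trans (ℚ.*-identityˡ (seq (sum f) k)) (sum-seq f k)))

  𝟙-seq : ∀ {l} (A : Subset l) v k → seq (𝟙 A v) k ≡ 𝟏 A v
  𝟙-seq A v k = by (lookup A v)
    where
    by : ∀ b → seq (if b then ℝ.1ℝ else ℝ.0ℝ) k ≡ bit b
    by false = refl
    by true = refl

  -- The mixed term 2(f - u)(P - u) is at most δ((f - u)² + 1). The error is thus relative to (f -
  -- u)², and no bound on `u` is required.
  perturb : ∀ f P u δ → ℚ.∣ P - u ∣ ≤ δ → (1ℚ - δ) * ((f - u) * (f - u)) ≤ (f - P) * (f - P) + δ
  perturb f P u δ h = certify
    (ℚ.nonNegative⁻¹ ½ ⊗ ((gap (proj₁ (∣q∣≤⇒≤ h)) ⊗ square≥0 (f - u + 1ℚ)) ⊕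
      (gap (proj₂ (∣q∣≤⇒≤ h)) ⊗ square≥0 (f - u - 1ℚ))) ⊕ square≥0 (P - u))
      (solve 4 (λ f P u δ → (f :- P) :* (f :- P) :+ δ :- (:1 :- δ) :* ((f :- u) :* (f :- u)) := :½ :*
        ((δ :- (P :- u)) :* ((f :- u :+ :1) :* (f :- u :+ :1)) :+ (δ :- :- (P :- u)) :*
        ((f :- u :- :1) :* (f :- u :- :1))) :+ (P :- u) :* (P :- u)) refl f P u δ)

  fromℚ-≤ : ∀ {p q} → ℝ.fromℚ p ℝ.≤ ℝ.fromℚ q → p ≤ q
  fromℚ-≤ {p} {q} h = ℚ.≮⇒≥ λ q<p → absurd q<p (h (½ * (p - q)) (0<½ q<p))
    where
    0<½ : q < p → 0ℚ < ½ * (p - q)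
    0<½ q<p = 0<* (ℚ.positive⁻¹ ½) (subst (_< p - q) (ℚ.+-inverseʳ q) (ℚ.+-monoˡ-< (- q) q<p))
    absurd : q < p → (∃ λ N → ∀ n → N ℕ.≤ n → p ≤ q + ½ * (p - q)) → ⊥
    absurd q<p (N , k) = ℚ.<-irrefl {q} {q} refl (ℚ.<-≤-trans q<p (certify (num≥0 2 ⊗ gap (k N ℕ.≤-refl))
        (solve 2 (λ p q → q :- p := :# 2 :* (q :+ :½ :* (p :- q) :- p)) refl p q)))

  ≤ℝ-trans : ∀ {x y z} → x ℝ.≤ y → y ℝ.≤ z → x ℝ.≤ z
  ≤ℝ-trans {x} {y} {z} x≤y y≤z δ 0<δ = both (λ k p q → certify (gap p ⊕ gap q)
      (solve 4 (λ x y z δ → z :+ δ :- x := (y :+ :½ :* δ :- x) :+ (z :+ :½ :* δ :- y)) refl (seq x k)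
        (seq y k) (seq z k) δ))
    (x≤y (½ * δ) (0<* (ℚ.positive⁻¹ ½) 0<δ)) (y≤z (½ * δ) (0<* (ℚ.positive⁻¹ ½) 0<δ))

  -- Up to the error allowed, η ≤ s² ≤ s for s between 0 and 1, and η ≤ 1 covers s ≥ 1. The cases
  -- are distinguished on the rational approximations, where the order is decidable; an
  -- approximation may dip slightly below 0, and then s² ≤ - s is tiny.
  below-√ : ∀ {η ε s} → η ≤ 1ℚ → ℝ.fromℚ η ℝ.≤ ε → ℝ.IsSqrt ε s → ℝ.fromℚ η ℝ.≤ s
  below-√ {η} {ε} {s} η≤1 η≤ε (0≤s , s²≃ε) δ 0<δ = both
    (λ k (a , b) (p , q) → conclude (seq s k) (seq ε k) a b p q)
      (both (λ k a b → a , b) (η≤ε δ₃ 0<δ₃) (s²≃ε δ₃ 0<δ₃))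
        (both (λ k p q → p , q) (0≤s δ₃ 0<δ₃) (0≤s 1ℚ (ℚ.positive⁻¹ 1ℚ)))
    where
    δ₃ : ℚ
    δ₃ = (ℤ.+ 1 / 4) * δ
    0<δ₃ : 0ℚ < δ₃
    0<δ₃ = 0<* (ℚ.positive⁻¹ (ℤ.+ 1 / 4)) 0<δ
    conclude : ∀ s ε → η ≤ ε + δ₃ → ℚ.∣ s * s - ε ∣ ≤ δ₃ → 0ℚ ≤ s + δ₃ → 0ℚ ≤ s + 1ℚ → η ≤ s + δ
    conclude s ε η≤ close s≥ s≥-1 with ℚ.≤-total 1ℚ s | ℚ.≤-total 0ℚ s
    ... | inj₁ 1≤s | _ = certify (gap η≤1 ⊕ gap 1≤s ⊕ ℚ.<⇒≤ 0<δ)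
        (solve 3 (λ η s δ → s :+ δ :- η := (:1 :- η) :+ (s :- :1) :+ δ) refl η s δ)
    ... | inj₂ s≤1 | inj₁ 0≤s = certify (gap η≤ ⊕ gap (proj₂ (∣q∣≤⇒≤ close)) ⊕ 0≤s ⊗ gap s≤1 ⊕ ℚ.nonNegative⁻¹
      ½ ⊗ ℚ.<⇒≤ 0<δ)
        (solve 4 (λ η s ε δ → s :+ δ :- η := (ε :+ con (ℤ.+ 1 / 4) :* δ :- η) :+
          (con (ℤ.+ 1 / 4) :* δ :- :- (s :* s :- ε)) :+ s :* (:1 :- s) :+ :½ :* δ) refl η s ε δ)
    ... | inj₂ _ | inj₂ s≤0 = certify (gap η≤ ⊕ gap (proj₂ (∣q∣≤⇒≤ close)) ⊕ gap s≤0 ⊗ s≥-1 ⊕ s≥ ⊕ s≥)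
        (solve 4 (λ η s ε δ → s :+ δ :- η := (ε :+ con (ℤ.+ 1 / 4) :* δ :- η) :+
          (con (ℤ.+ 1 / 4) :* δ :- :- (s :* s :- ε)) :+ (:0 :- s) :* (s :+ :1) :+ (s :+ con (ℤ.+ 1 / 4) :* δ)
          :+ (s :+ con (ℤ.+ 1 / 4) :* δ)) refl η s ε δ)

  -- Monotonicity of Y(s + τ) in the real number `s`. The equation for `seq y k` lets the same lemma
  -- serve both bounds of the theorem, whose right sides differ by a factor.
  lift-bound : ∀ {κ s τ X Y} {y : ℝ} → (∀ k → seq y k ≡ Y * (seq s k + τ)) → 0ℚ ≤ Y → ℝ.fromℚ κ ℝ.≤ s → X ≤ Y
    * (κ + τ) → ℝ.fromℚ X ℝ.≤ y
  lift-bound {κ} {s} {τ} {X} {Y} {y} y≡ 0≤Y κ≤s X≤ δ 0<δ = go (scale Y 0≤Y 0<δ)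
    where
    go : (∃ λ δ′ → 0ℚ < δ′ × δ′ ≤ 1ℚ × Y * δ′ ≤ δ) → Eventually (λ k → X ≤ seq y k + δ)
    go (δ′ , 0<δ′ , _ , Yδ′≤δ) with K , h ← κ≤s δ′ 0<δ′ = K , λ k K≤k →
      certify (gap X≤ ⊕ 0≤Y ⊗ gap (h k K≤k) ⊕ gap Yδ′≤δ) (trans (cong (λ t → t + δ - X) (y≡ k))
        (solve 7 (λ X Y κ s τ δ′ δ → Y :* (s :+ τ) :+ δ :- X := (Y :* (κ :+ τ) :- X) :+ Y :* (s :+ δ′ :- κ) :+
          (δ :- Y :* δ′)) refl X Y κ (seq s k) τ δ′ δ))

  -- Comparing the exact error with the given real projection.

  module Error (n m : ℕ) (n≡3+m : n ≡ suc (suc (suc m))) (m-large : threshold ℕ.≤ suc (suc m))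
    (A : Subset ∣V∣[ n ]) (c : ℚ)
    (#A : # ∣ A ∣ ≡ c * # (oddFactorial (suc (suc m)))) (0<c : 0ℚ < c)
      (c≤ : c * num 2 ≤ # (suc (2 ℕ.* suc (suc m)))) where
    open Large n m n≡3+m m-large A c #A 0<c c≤ public
    open Conclusion n (suc (suc m)) n≡3+m A c #A (ℚ.<⇒≤ 0<c) c≤ public

    private
      cD>0 : 0ℚ < c * D
      cD>0 = 0<* 0<c 0<D

      cD⁻¹ : ∃ λ r → r * (c * D) ≡ 1ℚ × 0ℚ < r
      cD⁻¹ = inverse cD>0

    -- The squared error of `p` relative to `∑ f`. In the normalised norm, `c D` corresponds to
    -- c/(2n-1), because `|V| τ₀` equals `D`.
    η : ℚ
    η = M.W * proj₁ cD⁻¹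

    W≡ : M.W ≡ η * (c * D)
    W≡ = trans (sym (ℚ.*-identityʳ M.W))
      (trans (cong (M.W *_) (sym (proj₁ (proj₂ cD⁻¹)))) (sym (ℚ.*-assoc M.W (proj₁ cD⁻¹) (c * D))))

    0≤W : 0ℚ ≤ M.W
    0≤W = ∑-nonneg λ v → square≥0 (𝟏 A v - M.p v)

    0≤η : 0ℚ ≤ η
    0≤η = 0≤W ⊗ ℚ.<⇒≤ (proj₂ (proj₂ cD⁻¹))

    |V| : ℚ
    |V| = # ∣V∣[ n ]

    |V|τ : |V| * τ₀ ≡ D
    |V|τ = begin
      |V| * τ₀
        ≡⟨ cong (_* τ₀) (sym (trans (∑-const ∣V∣[ n ] 1ℚ) (ℚ.*-identityʳ |V|))) ⟩
      ∑ {n = ∣V∣[ n ]} (λ _ → 1ℚ) * τ₀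
        ≡⟨ cong (_* τ₀) ∑1 ⟩
      # (suc (2 ℕ.* suc (suc m))) * D * τ₀
        ≡⟨ solve 3 (λ N D τ → N :* D :* τ := τ :* N :* D) refl (# (suc (2 ℕ.* suc (suc m)))) D τ₀ ⟩
      τ₀ * # (suc (2 ℕ.* suc (suc m))) * D
        ≡⟨ trans (cong (_* D) (1/n*n≡1 (2 ℕ.* suc (suc m)))) (ℚ.*-identityˡ D) ⟩
      D ∎
      where
      open ≡-Reasoning
      ∑1 : ∑ {n = ∣V∣[ n ]} (λ _ → 1ℚ) ≡ # (suc (2 ℕ.* suc (suc m))) * D
      ∑1 = trans (count (suc (suc (suc m))) [] [] (sym n≡3+m))
        (#-* (suc (2 ℕ.* suc (suc m))) (oddFactorial (suc (suc m))))

    module _ (ε : ℝ) (P : ℝ[ ∣V∣[ n ] ]) (P∈span : starSpan n P)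
      (close : ∥ 𝟙 A ⊖ P ∥² ℝ.≤ ε ℝ.* ℝ.fromℚ (c * τ₀)) where
      private
        l : ℕ
        l = proj₁ P∈span

        w : Fin l → ℝ
        w = proj₁ (proj₂ P∈span)

        e : Fin l → Edge N
        e = proj₁ (proj₂ (proj₂ P∈span))

      -- The k-th rational approximation of P, again in the span of the stars.
      u : ℕ → Fin ∣V∣[ n ] → ℚ
      u k v = ∑[ j ] (seq (w j) k * 𝟏 (star n (e j)) v)

      P→u : ∀ δ → 0ℚ < δ → Eventually (λ k → ∀ v → ℚ.∣ seq (P v) k - u k v ∣ ≤ δ)
      P→u δ 0<δ = eventually-all λ v → each v (proj₂ (proj₂ (proj₂ P∈span)) v δ 0<δ)
        where
        each : ∀ v → Eventually (λ k → ℚ.∣ seq (P v) k - seq (sum (λ j → w j ℝ.* 𝟙 (star n (e j)) v)) k ∣ ≤ δ) →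
          Eventually (λ k → ℚ.∣ seq (P v) k - u k v ∣ ≤ δ)
        each v (K , h) = K , λ k K≤k → subst (λ t → ℚ.∣ seq (P v) k - t ∣ ≤ δ)
          (trans (sum-seq (λ j → w j ℝ.* 𝟙 (star n (e j)) v) k)
            (∑-cong λ j → cong (seq (w j) k *_) (𝟙-seq (star n (e j)) v k))) (h k K≤k)

      u-⊥ : ∀ k → ∑[ v ] ((𝟏 A v - M.p v) * u k v) ≡ 0ℚ
      u-⊥ k = trans (∑-cong λ v → trans (sym (∑-* (𝟏 A v - M.p v) (λ j → seq (w j) k * 𝟏 (star n (e j)) v)))
        (∑-cong λ j → solve 3 (λ g w s → g :* (w :* s) := w :* (g :* s)) refl (𝟏 A v - M.p v) (seq (w j) k)
        (𝟏 (star n (e j)) v)))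
        (trans (∑-comm (λ v j → seq (w j) k * ((𝟏 A v - M.p v) * 𝟏 (star n (e j)) v))) (∑-zero λ j →
          trans (∑-* (seq (w j) k) (λ v → (𝟏 A v - M.p v) * 𝟏 (star n (e j)) v)) (trans (cong (seq (w j) k *_)
            (trans (∑-cong λ v → cong ((𝟏 A v - M.p v) *_)
              (trans (cong (λ S → 𝟏 S v) (star≡starOf (e j))) (𝟏-starOf (lo (e j)) (hi (e j)) v)))
              (M.f-p⊥x (lo (e j)) (hi (e j))))) (ℚ.*-zeroʳ (seq (w j) k)))))

      distance : ∀ k → |V| * seq (∥ 𝟙 A ⊖ P ∥²) k ≡ ∑[ v ] ((𝟏 A v - seq (P v) k) * (𝟏 A v - seq (P v) k))
      distance k = trans (mean-seq (λ v → (𝟙 A ⊖ P) v ℝ.* (𝟙 A ⊖ P) v) k)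
        (∑-cong λ v → cong (λ t → (t - seq (P v) k) * (t - seq (P v) k)) (𝟙-seq A v k))

      W-bound : ∀ δ → δ ≤ 1ℚ → ∀ k → (∀ v → ℚ.∣ seq (P v) k - u k v ∣ ≤ δ) → (1ℚ - δ) * M.W ≤ |V| * seq
        (∥ 𝟙 A ⊖ P ∥²) k + |V| * δ
      W-bound δ δ≤1 k h = ℚ.≤-trans (monoˡ-≤ (gap δ≤1) (M.best-approximation (u k) (u-⊥ k)))
        (ℚ.≤-trans (ℚ.≤-reflexive (sym (∑-* (1ℚ - δ) (λ v → (𝟏 A v - u k v) * (𝟏 A v - u k v)))))
          (ℚ.≤-trans (∑-mono λ v → perturb (𝟏 A v) (seq (P v) k) (u k v) δ (h v))
            (ℚ.≤-reflexive (trans (∑-+ (λ v → (𝟏 A v - seq (P v) k) * (𝟏 A v - seq (P v) k)) (λ _ → δ))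
              (cong₂ _+_ (sym (distance k)) (∑-const ∣V∣[ n ] δ))))))

      η≤ε : ℝ.fromℚ η ℝ.≤ ε
      -- `W-bound` loses `δ W + |V| δ`, and the k-th terms of the hypothesis lose another `|V| δ`.
      -- So `(2 |V| + W) δ` has to fit into `c D δ′`.
      η≤ε δ′ 0<δ′ = go (scale (num 2 * |V| + M.W) (num≥0 2 ⊗ 0≤# ∣V∣[ n ] ⊕ 0≤W) (0<* cD>0 0<δ′))
        where
        vanish : ∀ {p q} r → p ≡ q → r * (p - q) ≡ 0ℚ
        vanish {p} r refl = trans (cong (r *_) (ℚ.+-inverseʳ p)) (ℚ.*-zeroʳ r)
        go : (∃ λ δ → 0ℚ < δ × δ ≤ 1ℚ × (num 2 * |V| + M.W) * δ ≤ c * D * δ′) → Eventually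
          (λ k → η ≤ seq ε k + δ′)
        go (δ , 0<δ , δ≤1 , Bδ≤) = both (λ k h close → cancelˡ-≤ cD>0 (certify
            (gap (W-bound δ δ≤1 k h) ⊕ 0≤# ∣V∣[ n ] ⊗ gap close ⊕ gap Bδ≤ ⊕ gap (ℚ.≤-reflexive (sym W≡)) ⊕
              ℚ.≤-reflexive (sym (vanish (c * seq ε k) (sym |V|τ))))
              (solve 10 (λ c D V W η τ δ δ′ E S → c :* D :* (E :+ δ′) :- c :* D :* η :=
                (V :* S :+ V :* δ :- (:1 :- δ) :* W) :+ V :* (E :* (c :* τ) :+ δ :- S) :+
                (c :* D :* δ′ :- (:# 2 :* V :+ W) :* δ) :+ (W :- η :* (c :* D)) :+ c :* E :* (D :- V :* τ))
                refl c D |V| M.W η τ₀ δ δ′ (seq ε k) (seq (∥ 𝟙 A ⊖ P ∥²) k))))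
          (P→u δ 0<δ) (close δ 0<δ)

  ≤⇒∣q∣≤ : ∀ {q e} → q ≤ e → - q ≤ e → ℚ.∣ q ∣ ≤ e
  ≤⇒∣q∣≤ {q} {e} h k with ℚ.∣p∣≡p∨∣p∣≡-p q
  ... | inj₁ p = subst (_≤ e) (sym p) h
  ... | inj₂ p = subst (_≤ e) (sym p) k

  -- Chosen so that `100 η ≤ 1`, the smallness used when the large entries are counted; in
  -- particular η ≤ 1, as `below-√` requires.
  ε₀ : ℚ
  ε₀ = ℤ.+ 1 / 100

  module Final (n n′ : ℕ) (n≡1+n′ : n ≡ suc n′) (A : Subset ∣V∣[ n ]) (c : ℚ)
    (#A : num ∣ A ∣ ≡ c * num (oddFactorial n′)) (c≤ : c ≤ ℤ.+ suc (2 ℕ.* n′) / 2) where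

    #A′ : # ∣ A ∣ ≡ c * # (oddFactorial n′)
    #A′ = trans (#≡num ∣ A ∣) (trans #A (cong (c *_) (sym (#≡num (oddFactorial n′)))))

    0≤c : 0ℚ ≤ c
    0≤c = cancelˡ-≤ (0<# (oddFactorial>0 n′)) (ℚ.≤-trans (ℚ.≤-reflexive (ℚ.*-zeroʳ (# (oddFactorial n′))))
      (ℚ.≤-trans (0≤# ∣ A ∣) (ℚ.≤-reflexive (trans #A′ (ℚ.*-comm c (# (oddFactorial n′)))))))

    2c≤ : c * num 2 ≤ # (suc (2 ℕ.* n′))
    2c≤ = ℚ.≤-trans (certify (gap c≤ ⊗ num≥0 2)
        (solve 2 (λ c q → q :* :# 2 :- c :* :# 2 := (q :- c) :* :# 2) refl c (ℤ.+ suc (2 ℕ.* n′) / 2)))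
      (ℚ.≤-reflexive (trans (cong ((ℤ.+ suc (2 ℕ.* n′) / 2) *_) (sym (#≡num 2))) (a/n*n≡a (suc (2 ℕ.* n′)) 1)))

    open Conclusion n n′ n≡1+n′ A c #A′ 0≤c 2c≤ public using
      (Outcome; module Outcome; small-n; c≡0⇒outcome; τ₀; D; Resized)

    RealOutcome : ℝ → Set
    RealOutcome √ε = ∃ λ κ → ℝ.fromℚ κ ℝ.≤ √ε × Outcome κ

  conclude : ∀ n n′ n≡1+n′ A c #A c≤ (ε √ε : ℝ) → ε ℝ.≤ ℝ.fromℚ ε₀ → IsSqrt ε √ε →
    (P : ℝ[ ∣V∣[ n ] ]) → starSpan n P → ∥ 𝟙 A ⊖ P ∥² ℝ.≤ ε ℝ.* ℝ.fromℚ (c * (ℤ.+ 1 / suc (2 ℕ.* n′))) →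
    Final.RealOutcome n n′ n≡1+n′ A c #A c≤ √ε
  conclude n n′ n≡1+n′ A c #A c≤ ε √ε ε≤ sqrt P P∈ close = by n′ n≡1+n′ #A c≤ close (n′ ℕ.≤? threshold)
    where
    -- Quantified over `n′` again, so that matching on it also specialises the hypotheses. The
    -- moments need n ≥ 3, and smaller n lie below the threshold.
    by : ∀ n′ n≡1+n′ #A c≤ → ∥ 𝟙 A ⊖ P ∥² ℝ.≤ ε ℝ.* ℝ.fromℚ (c * (ℤ.+ 1 / suc (2 ℕ.* n′))) → Dec
      (n′ ℕ.≤ threshold) →
      Final.RealOutcome n n′ n≡1+n′ A c #A c≤ √ε
    by n′ n≡1+n′ #A c≤ close (yes small) = 0ℚ , proj₁ sqrt , Conclusion.small-n n n′ n≡1+n′ A c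
      (Final.#A′ n n′ n≡1+n′ A c #A c≤) (Final.0≤c n n′ n≡1+n′ A c #A c≤) (Final.2c≤ n n′ n≡1+n′ A c #A c≤)
      small
    by zero n≡1+n′ #A c≤ close (no ¬small) = ⊥-elim (¬small ℕ.z≤n)
    by (suc zero) n≡1+n′ #A c≤ close (no ¬small) = ⊥-elim
      (¬small (subst (1 ℕ.≤_) (sym threshold≡80) (ℕ.s≤s ℕ.z≤n)))
    by (suc (suc m)) n≡1+n′ #A c≤ close (no ¬small) = cases (c ℚ.≟ 0ℚ)
      where
      module F = Final n (suc (suc m)) n≡1+n′ A c #A c≤
      cases : Dec (c ≡ 0ℚ) → F.RealOutcome √ε
      cases (yes c≡0) = 0ℚ , proj₁ sqrt , Conclusion.c≡0⇒outcome n (suc (suc m)) n≡1+n′ A c F.#A′ F.0≤c F.2c≤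
        c≡0
      cases (no c≢0) = E.η , below-√ {E.η} {ε} {√ε} η≤1 η≤ε sqrt , transport (E.outcome E.η E.0≤η E.W≡ 100η≤1)
        where
        0<c : 0ℚ < c
        0<c = ℚ.≰⇒> (λ c≤0 → c≢0 (ℚ.≤-antisym c≤0 F.0≤c))
        module E = Error n m n≡1+n′ (ℕ.<⇒≤ (ℕ.≰⇒> ¬small)) A c F.#A′ 0<c F.2c≤
        η≤ε : ℝ.fromℚ E.η ℝ.≤ ε
        η≤ε = E.η≤ε ε P P∈ close
        η≤ε₀ : E.η ≤ ε₀
        η≤ε₀ = fromℚ-≤ {E.η} {ε₀} (≤ℝ-trans {ℝ.fromℚ E.η} {ε} {ℝ.fromℚ ε₀} η≤ε ε≤)
        100η≤1 : num 100 * E.η ≤ 1ℚ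
        100η≤1 = certify (num≥0 100 ⊗ gap η≤ε₀)
            (solve 1 (λ η → :1 :- :# 100 :* η := :# 100 :* (con (ℤ.+ 1 / 100) :- η)) refl E.η)
        η≤1 : E.η ≤ 1ℚ
        η≤1 = certify (gap 100η≤1 ⊕ num≥0 99 ⊗ E.0≤η)
            (solve 1 (λ η → :1 :- η := (:1 :- :# 100 :* η) :+ :# 99 :* η) refl E.η)
        -- The two instances of `Conclusion` carry different proofs of `0 ≤ c`, so their records are
        -- distinct types although the fields agree.
        transport : E.Outcome E.η → F.Outcome E.η
        transport o = record { r = O.r ; round≡ = O.round≡ ; stars = O.stars ; c-r = O.c-r ; r-c = O.r-c }
          where module O = E.Outcome o

  0≤C : 0ℚ ≤ C
  0≤C = ℚ.≤-trans (num≥0 2000) 2000≤C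

  real-bounds : ∀ n n′ n≡1+n′ A c #A c≤ (√ε : ℝ) → Final.RealOutcome n n′ n≡1+n′ A c #A c≤ √ε →
    (∃ λ B → IsUnionOfStars n (ℚ.round c) B ×
      ℝ.fromℕ ∣ A △ B ∣ ℝ.≤ ℝ.fromℚ C ℝ.* ℝ.fromℚ (c * c) ℝ.* ℝ.fromℕ (oddFactorial n′) ℝ.*
        (√ε ℝ.+ ℝ.fromℚ (ℤ.+ 1 / suc (2 ℕ.* n′)))) ×
    ℝ.fromℚ (ℚ.∣ c - (ℚ.round c / 1) ∣) ℝ.≤ ℝ.fromℚ C ℝ.* ℝ.fromℚ (c * c) ℝ.*
      (√ε ℝ.+ ℝ.fromℚ (ℤ.+ 1 / suc (2 ℕ.* n′)))
  real-bounds n n′ n≡1+n′ A c #A c≤ √ε (κ , κ≤√ε , o) =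
    (⋃ 𝒮 , (𝒮 , proj₁ (proj₂ O.stars) , proj₁ (proj₂ (proj₂ O.stars)) , trans
    (cong ℤ.+_ (proj₁ (proj₂ (proj₂ (proj₂ O.stars))))) (sym O.round≡) , refl)
      , lift-bound {κ} {√ε} {τ} {num ∣ A △ ⋃ 𝒮 ∣} {Y * num (oddFactorial n′)}
        {ℝ.fromℚ C ℝ.* ℝ.fromℚ (c * c) ℝ.* ℝ.fromℕ (oddFactorial n′) ℝ.* (√ε ℝ.+ ℝ.fromℚ τ)} (λ _ → refl)
          (0≤Y ⊗ subst (0ℚ ≤_) (#≡num (oddFactorial n′)) (0≤# (oddFactorial n′))) κ≤√ε
          (subst₂ (λ p q → p ≤ Y * q * (κ + τ)) (#≡num ∣ A △ ⋃ 𝒮 ∣) (#≡num (oddFactorial n′))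
            (proj₂ (proj₂ (proj₂ (proj₂ O.stars))))))
    , lift-bound {κ} {√ε} {τ} {ℚ.∣ c - (ℚ.round c / 1) ∣} {Y}
      {ℝ.fromℚ C ℝ.* ℝ.fromℚ (c * c) ℝ.* (√ε ℝ.+ ℝ.fromℚ τ)} (λ _ → refl) 0≤Y κ≤√ε
        (subst (λ t → ℚ.∣ c - t ∣ ≤ Y * (κ + τ)) (trans (#≡num O.r) (cong (_/ 1) (sym O.round≡)))
          (≤⇒∣q∣≤ O.c-r (ℚ.≤-trans (ℚ.≤-reflexive (solve 2 (λ c r → :- (c :- r) := r :- c) refl c (# O.r)))
            O.r-c)))
    where
    module O = Final.Outcome n n′ n≡1+n′ A c #A c≤ o
    𝒮 : List (Subset ∣V∣[ n ])
    𝒮 = proj₁ O.stars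
    τ Y : ℚ
    τ = ℤ.+ 1 / suc (2 ℕ.* n′)
    Y = C * (c * c)
    0≤Y : 0ℚ ≤ Y
    0≤Y = 0≤C ⊗ square≥0 c

open import Defs
open import Data.Fin.Subset using (Subset; ∣_∣)
open import Data.Integer.Base using (+_)
import Data.Nat.Properties as ℕ
open import Data.Product.Base using (∃; _×_; _,_)
open import Data.Rational.Base as ℚ using (ℚ)
import Data.Rational.Properties as ℚ
open import Relation.Binary.PropositionalEquality using (_≡_; sym)
open PerfectMatchings using (C; 2000≤C; ε₀; conclude; real-bounds)

theorem1p8 : ∃ λ (C₀ : ℝ) → ∃ λ (ε₀ : ℝ) → 0ℝ < C₀ × 0ℝ < ε₀ ×
    (∀ (n : ℕ) .{{_ : NonZero n}}
    (A : Subset ∣V∣[ n ]) (c : ℚ) →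
    + ∣ A ∣ ℚ./ 1 ≡ c ℚ.* (+ [2n-3]!![ n ] ℚ./ 1) →
    c ℚ.≤ + 2n-1[ n ] ℚ./ 2 →
    (ε √ε : ℝ) → 0ℝ ≤ ε → ε ≤ ε₀ → IsSqrt ε √ε →
    (Proj𝟙A : ℝ[ ∣V∣[ n ] ]) → IsProjection (starSpan n) (𝟙 A) Proj𝟙A →
    ∥ 𝟙 A ⊖ Proj𝟙A ∥² ≤ ε * fromℚ (c ℚ.* (+ 1 ℚ./ 2n-1[ n ])) →
    (∃ λ (B : Subset ∣V∣[ n ]) →
    IsUnionOfStars n (ℚ.round c) B ×
    fromℕ ∣ A △ B ∣
    ≤ C₀ * fromℚ (c ℚ.* c) * fromℕ [2n-3]!![ n ]
    * (√ε + fromℚ (+ 1 ℚ./ 2n-1[ n ])))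
    ×
    fromℚ (ℚ.∣ c ℚ.- (ℚ.round c ℚ./ 1) ∣)
    ≤ C₀ * fromℚ (c ℚ.* c) * (√ε + fromℚ (+ 1 ℚ./ 2n-1[ n ])))
theorem1p8 = fromℚ C , fromℚ ε₀ , (ℚ.1ℚ , ℚ.positive⁻¹ ℚ.1ℚ , 0 , λ _ _ → 1≤C) , (ε₀ , ℚ.positive⁻¹ ε₀ , 0 , λ _ _ → ℚ.≤-reflexive (ℚ.+-identityˡ ε₀)) ,
  λ n A c #A c≤ ε √ε _ ε≤ε₀ √ε-sqrt P (P∈U , _) close →
    real-bounds n (ℕ.pred n) (sym (ℕ.suc-pred n)) A c #A c≤ √ε
      (conclude n (ℕ.pred n) (sym (ℕ.suc-pred n)) A c #A c≤ ε √ε ε≤ε₀ √ε-sqrt P P∈U close)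
  where
  1≤C : ℚ.0ℚ ℚ.+ ℚ.1ℚ ℚ.≤ C
  1≤C = ℚ.≤-trans (ℚ.≤ᵇ⇒≤ _) 2000≤C
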